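{- Let $F$ be a non-Archimedean local field and $E=F\times E'$ with $E'/F$ a ramified quadratic field extension with uniformizer $x$. For integers $a,b\ge0$ and $c\in\mathfrak o$ let $\mathcal O_{a,b,c}$ be the $\mathfrak o$-submodule of $F\times E'$ generated by $(1,1)$, $(0,\pi^a)$, $(0,\pi^bx+c)$. Then: (1) Every order of $E$ is of the form $\mathcal O_{a,b,c}$ with $a\le\min(2b+1,2\,\mathrm{ord}(c))$. Conversely, an $\mathfrak o$-module $\mathcal O_{a,b,c}$ with $a\le\min(2b+1,2\,\mathrm{ord}(c))$ is an order. (2) An order $\mathcal O_{a',b',c'}$ contains an order $\mathcal O_{a,b,c}$ if and only if $a'\le a$, $b'\le b$, and $$\begin{cases}c'\in(\pi^{\max(\lceil a'/2\rceil,\,a'-(b-b'))}) & \text{if }\mathrm{ord}(c)\ge a';\\ c'-\pi^{ -(b-b')}c\in(\pi^{a'-(b-b')}) & \text{if }\mathrm{ord}(c)<a'.\end{cases}$$ In the second case, $\lceil a'/2\rceil\le\mathrm{ord}(c)-(b-b')=\mathrm{ord}(c')$ (and thus $a'-(b-b')>0$). (3) Two orders $\mathcal O_{a',b',c'}$ and $\mathcal O_{a,b,c}$ are equal if and only if $a=a'$, $b=b'$ and $c-c'\in(\pi^a)$. (4) For an order $\mathcal O_{a,b,c}$, $S(\mathcal O_{a,b,c})=a+b$ and the conductor is $\mathfrak f(\mathcal O_{a,b,c})=(\pi^a)\times\bigl(x^{\max(2a,\,2b+1,\,2a+2b-2\mathrm{ord}(c)+1)-1}\bigr)$ as an ideal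 of $\mathcal O_E=\mathfrak o\times\mathfrak o[x]$. (5) An order $\mathcal O_{a,b,c}$ is Gorenstein if and only if $$\begin{cases}a=2b+1\text{ or }a=0 & \text{if }\mathrm{ord}(c)\ge a;\\ a=\min(2b+1,2\,\mathrm{ord}(c)) & \text{if }\mathrm{ord}(c)<a.\end{cases}$$
   Context: $F$ has any characteristic, ring of integers $\mathfrak o$, uniformizer $\pi$; $\mathrm{ord}$ is the normalized valuation of $F$ with $\mathrm{ord}(0)=\infty$. For $j\in\mathbb Z$, $(\pi^j)=\pi^j\mathfrak o\subset F$ in (2) (conditions are read in $F$). $\mathcal O_{E'}=\mathfrak o[x]$ is the ring of integers of $E'$. The maximal order of $E$ is $\mathcal O_E=\mathfrak o\times\mathcal O_{E'}$. An order of $E$ is a subring $\mathcal O\subset E$ containing $\mathfrak o$ (diagonally), finitely generated as an $\mathfrak o$-module, with $F\mathcal O=E$. $S(\mathcal O)$ is the $\mathfrak o$-length of $\mathcal O_E/\mathcal O$; $\mathfrak f(\mathcal O)=\{a\in\mathcal O_E:a\mathcal O_E\subset\mathcal O\}$. A fractional $\mathcal O$-ideal is a finitely generated $\mathcal O$-submodule $I\subset E$ with $FI=E$; it is invertible if $IJ=\mathcal O$ for some fractional ideal $J$. $\mathcal O$ is Gorenstein if every fractional $\mathcal O$-ideal $I$ with $\{y\in E:yI\subset I\}=\mathcal O$ is invertible. -}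

module Defs where

open import Level using (Level; _⊔_; suc; 0ℓ)
open import Algebra.Bundles using (CommutativeRing)
open import Algebra.Morphism.Structures using (IsRingHomomorphism)
import Algebra.Construct.DirectProduct as DirectProduct
import Algebra.Properties.CommutativeMonoid.Sum as Sum
import Algebra.Properties.Semiring.Exp as Exp
open import Data.Fin.Base as Fin using (Fin; inject₁)
open import Data.Integer.Base as ℤ using (ℤ; +_; -[1+_]; 0ℤ; 1ℤ)
import Data.Integer.Properties as ℤ
open import Data.Nat.Base as ℕ using (ℕ)
open import Data.Product using (∃; _×_; _,_; proj₁)
open import Data.Vec.Functional using ([]; _∷_)
open import Function.Bundles using (_⇔_; Equivalence)
open import Relation.Binary.PropositionalEquality as ≡ using (_≡_)
open import Relation.Nullary.Negation using (¬_)
open import Relation.Nullary.Construct.Add.Supremum public using (_⁺; ⊤⁺; [_])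
open import Relation.Unary using (Pred; _∈_; _⊆_; _⊂_; _≐_; _⟨×⟩_)

open import Relation.Binary.Construct.Add.Supremum.NonStrict ℤ._≤_ public using (_≤⁺_)
open import Relation.Binary.Construct.Add.Supremum.Strict ℤ._<_ public using (_<⁺_)

------------------------------------------------------------------------
-- ℤ ∪ {∞}, with ∞ = ⊤⁺

ℤ∞ : Set
ℤ∞ = ℤ ⁺

infixl 6 _+∞_ _⊓∞_
infixl 7 _*∞_

_+∞_ : ℤ∞ → ℤ∞ → ℤ∞
[ m ] +∞ [ n ] = [ m ℤ.+ n ]
[ m ] +∞ ⊤⁺    = ⊤⁺
⊤⁺    +∞ v     = ⊤⁺

_⊓∞_ : ℤ∞ → ℤ∞ → ℤ∞
[ m ] ⊓∞ [ n ] = [ m ℤ.⊓ n ]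
[ m ] ⊓∞ ⊤⁺    = [ m ]
⊤⁺    ⊓∞ v     = v

-- Only used with a positive multiplier.
_*∞_ : ℕ → ℤ∞ → ℤ∞
k *∞ [ n ] = [ + k ℤ.* n ]
k *∞ ⊤⁺    = ⊤⁺

------------------------------------------------------------------------
-- Discretely valued fields and local fields

record DiscretelyValuedField c ℓ : Set (suc (c ⊔ ℓ)) where
  field
    commutativeRing : CommutativeRing c ℓ

  open CommutativeRing commutativeRing public

  -- The valuation decides x ≈ 0, so the field axioms are given for a
  -- discrete field, without an apartness relation.
  field
    1≉0        : ¬ (1# ≈ 0#)
    inverse    : ∀ x → ¬ (x ≈ 0#) → ∃ λ y → x * y ≈ 1#
    ord        : Carrier → ℤ∞
    ord-cong   : ∀ {x y} → x ≈ y → ord x ≡ ord y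
    ord-∞      : ∀ x → ord x ≡ ⊤⁺ ⇔ x ≈ 0#
    ord-*      : ∀ x y → ord (x * y) ≡ ord x +∞ ord y
    ord-+      : ∀ x y → (ord x ⊓∞ ord y) ≤⁺ ord (x + y)
    normalized : ∃ λ t → ord t ≡ [ 1ℤ ]

  𝒪 : Pred Carrier 0ℓ
  𝒪 x = [ 0ℤ ] ≤⁺ ord x

  record Uniformizer : Set (c ⊔ ℓ) where
    field
      element    : Carrier
      ord≡1      : ord element ≡ [ 1ℤ ]

    ≉0 : ¬ (element ≈ 0#)
    ≉0 t≈0 with () ← ≡.trans (≡.sym ord≡1) (Equivalence.from (ord-∞ element) t≈0)

  infixr 8 _^_

  _^_ : Uniformizer → ℤ → Carrier
  t ^ (+ n)    = Exp._^_ semiring (Uniformizer.element t) n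
  t ^ -[1+ n ] = Exp._^_ semiring (proj₁ (inverse (Uniformizer.element t) (Uniformizer.≉0 t))) (ℕ.suc n)

  -- The fractional ideal t^j 𝒪.
  ⟨_^_⟩ : Uniformizer → ℤ → Pred Carrier (c ⊔ ℓ)
  ⟨ t ^ j ⟩ y = ∃ λ u → u ∈ 𝒪 × y ≈ t ^ j * u

  IsCauchy : (ℕ → Carrier) → Set
  IsCauchy s = ∀ N → ∃ λ M → ∀ m n → M ℕ.≤ m → M ℕ.≤ n → [ N ] ≤⁺ ord (s m - s n)

  _ConvergesTo_ : (ℕ → Carrier) → Carrier → Set
  s ConvergesTo y = ∀ N → ∃ λ M → ∀ n → M ℕ.≤ n → [ N ] ≤⁺ ord (s n - y)

record LocalField c ℓ : Set (suc (c ⊔ ℓ)) where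
  field
    discretelyValuedField : DiscretelyValuedField c ℓ

  open DiscretelyValuedField discretelyValuedField public

  field
    complete     : ∀ s → IsCauchy s → ∃ λ y → s ConvergesTo y
    -- Finite residue field: finitely many residue classes modulo the
    -- maximal ideal { y | ord y ≥ 1 }.
    residueCount : ℕ
    residue      : Fin residueCount → Carrier
    residue∈𝒪    : ∀ i → residue i ∈ 𝒪
    residue-surj : ∀ y → y ∈ 𝒪 → ∃ λ i → [ 1ℤ ] ≤⁺ ord (y - residue i)

-- Since F is complete, its valuation extends uniquely to E′; the valuation
-- carried by E′ is the normalized one, and it restricts to e · ord on F,
-- with e the ramification index.
record RamifiedQuadraticExtension {c ℓ} (F : LocalField c ℓ) : Set (suc (c ⊔ ℓ)) where
  private module F = LocalField F
  field
    discretelyValuedField : DiscretelyValuedField c ℓ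

  open DiscretelyValuedField discretelyValuedField public

  field
    ι       : F.Carrier → Carrier
    ι-isHom : IsRingHomomorphism F.rawRing rawRing ι

  open Sum +-commutativeMonoid using (sum)

  field
    basis             : Fin 2 → Carrier
    basis-spans       : ∀ y → ∃ λ (r : Fin 2 → F.Carrier) → y ≈ sum (λ i → ι (r i) * basis i)
    basis-independent : ∀ (r : Fin 2 → F.Carrier) →
                        sum (λ i → ι (r i) * basis i) ≈ 0# → ∀ i → r i F.≈ F.0#
    e                 : ℕ
    ord-ι             : ∀ r → ord (ι r) ≡ e *∞ F.ord r
    ramified          : 1 ℕ.< e

------------------------------------------------------------------------
-- Orders and fractional ideals in E = F × E′

module Orders {c ℓ} (F : LocalField c ℓ) (E′ : RamifiedQuadraticExtension F) where

  module F  = LocalField F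
  module E′ = RamifiedQuadraticExtension E′

  E : CommutativeRing c ℓ
  E = DirectProduct.commutativeRing F.commutativeRing E′.commutativeRing

  open CommutativeRing E
  open Sum +-commutativeMonoid using (sum)

  Subset : Set (suc (c ⊔ ℓ))
  Subset = Pred Carrier (c ⊔ ℓ)

  Δ : F.Carrier → Carrier
  Δ r = r , E′.ι r

  ΔF : Subset
  ΔF y = ∃ λ r → y ≈ Δ r

  Δ𝒪 : Subset
  Δ𝒪 y = ∃ λ r → r ∈ F.𝒪 × y ≈ Δ r

  𝒪E : Pred Carrier 0ℓ
  𝒪E = F.𝒪 ⟨×⟩ E′.𝒪

  Span : Subset → ∀ {n} → (Fin n → Carrier) → Subset
  Span R {n} g y = ∃ λ (r : Fin n → Carrier) → (∀ i → r i ∈ R) × y ≈ sum (λ i → r i * g i)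

  infixl 7 _·_

  _·_ : Subset → Subset → Subset
  (P · Q) y = ∃ λ n → ∃ λ (p : Fin n → Carrier) → ∃ λ (q : Fin n → Carrier) →
              (∀ i → p i ∈ P) × (∀ i → q i ∈ Q) × y ≈ sum (λ i → p i * q i)

  FinitelyGenerated : Subset → Subset → Set (c ⊔ ℓ)
  FinitelyGenerated R M = ∃ λ n → ∃ λ (g : Fin n → Carrier) → M ≐ Span R g

  record IsSubmodule (R M : Subset) : Set (c ⊔ ℓ) where
    field
      resp     : ∀ {y z} → y ≈ z → y ∈ M → z ∈ M
      0∈       : 0# ∈ M
      +-closed : ∀ {y z} → y ∈ M → z ∈ M → y + z ∈ M
      *-closed : ∀ {r y} → r ∈ R → y ∈ M → r * y ∈ M

  record IsOrder (O : Subset) : Set (c ⊔ ℓ) where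
    field
      resp              : ∀ {y z} → y ≈ z → y ∈ O → z ∈ O
      0∈                : 0# ∈ O
      1∈                : 1# ∈ O
      +-closed          : ∀ {y z} → y ∈ O → z ∈ O → y + z ∈ O
      neg-closed        : ∀ {y} → y ∈ O → - y ∈ O
      *-closed          : ∀ {y z} → y ∈ O → z ∈ O → y * z ∈ O
      contains-Δ𝒪       : Δ𝒪 ⊆ O
      finitelyGenerated : FinitelyGenerated Δ𝒪 O
      F·O=E             : ∀ y → y ∈ ΔF · O

  -- Submodules of M / N are the submodules of M containing N, so this is a
  -- strict chain of k + 1 submodules of M / N.
  record QuotientChain {p q} (R : Subset) (N : Pred Carrier p) (M : Pred Carrier q) (k : ℕ)
         : Set (suc (c ⊔ ℓ) ⊔ p ⊔ q) where
    field
      member      : Fin (ℕ.suc k) → Subset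
      isSubmodule : ∀ i → IsSubmodule R (member i)
      lower       : ∀ i → N ⊆ member i
      upper       : ∀ i → member i ⊆ M
      strict      : ∀ (i : Fin k) → member (inject₁ i) ⊂ member (Fin.suc i)

  -- The R-length of M / N is n: the longest strict chain of submodules has n steps.
  QuotientLength : ∀ {p q} → Subset → Pred Carrier p → Pred Carrier q → ℕ → Set (suc (c ⊔ ℓ) ⊔ p ⊔ q)
  QuotientLength R N M n = QuotientChain R N M n × (∀ k → QuotientChain R N M k → k ℕ.≤ n)

  S[_]≡_ : Subset → ℕ → Set (suc (c ⊔ ℓ))
  S[ O ]≡ n = QuotientLength Δ𝒪 O 𝒪E n

  conductor : Subset → Subset
  conductor O a = a ∈ 𝒪E × (∀ y → y ∈ 𝒪E → a * y ∈ O)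

  record IsFractionalIdeal (O I : Subset) : Set (c ⊔ ℓ) where
    field
      isSubmodule       : IsSubmodule O I
      finitelyGenerated : FinitelyGenerated O I
      F·I=E             : ∀ y → y ∈ ΔF · I

  Invertible : Subset → Subset → Set (suc (c ⊔ ℓ))
  Invertible O I = ∃ λ J → IsFractionalIdeal O J × (I · J) ≐ O

  multiplierRing : Subset → Subset
  multiplierRing I y = ∀ z → z ∈ I → y * z ∈ I

  Gorenstein : Subset → Set (suc (c ⊔ ℓ))
  Gorenstein O = ∀ I → IsFractionalIdeal O I → multiplierRing I ≐ O → Invertible O I

  module Family (π : F.Uniformizer) (x : E′.Uniformizer) where

    -- 𝒪[ a , b , c ] is generated over 𝒪 by (1,1), (0,π^a) and (0,π^b x + c).
    𝒪[_,_,_] : ℕ → ℕ → F.Carrier → Subset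
    𝒪[ a , b , c ] = Span Δ𝒪
      ( 1#
      ∷ (F.0# , E′.ι (π F.^ (+ a)))
      ∷ (F.0# , E′.ι (π F.^ (+ b)) E′.* E′.Uniformizer.element x E′.+ E′.ι c)
      ∷ [])

-- The bound min(2b+1, 2v), for v = ord(c).
orderBound : ℕ → ℤ∞ → ℤ∞
orderBound b v = [ + (2 ℕ.* b ℕ.+ 1) ] ⊓∞ (2 *∞ v)

-- max(2a, 2b+1, 2a+2b-2v+1) - 1, for v = ord(c); for v = ∞ the last entry is
-- -∞ and drops out.
conductorExponent : ℕ → ℕ → ℤ∞ → ℤ
conductorExponent a b [ v ] =
  (+ (2 ℕ.* a) ℤ.⊔ + (2 ℕ.* b ℕ.+ 1) ℤ.⊔ (+ (2 ℕ.* a ℕ.+ 2 ℕ.* b) ℤ.- + 2 ℤ.* v ℤ.+ 1ℤ)) ℤ.- 1ℤ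
conductorExponent a b ⊤⁺ =
  (+ (2 ℕ.* a) ℤ.⊔ + (2 ℕ.* b ℕ.+ 1)) ℤ.- 1ℤ

{-# OPTIONS --safe #-}
module Submission where

-- Since e > 1, the valuations e · ord r of r and e · ord s + 1 of s x never
-- agree for r , s ∈ F.  Hence 1 , x is a basis of E′ over F, e = 2, and x is a
-- root of an Eisenstein polynomial x² = p + q x.  Lattices in E are handled
-- through F-linear functionals E → F: on a finitely generated module a
-- functional attains its least valuation at a generator, and elimination with
-- such elements brings an order to the basis 1, e₁ = (0 , π^a),
-- e₂ = (0 , π^b x + c).
--
-- In this basis e₁² = π^a e₁, e₁ e₂ = π^a e₂ and e₂² = A e₂ + B e₁, where
-- π^a B is up to sign the norm of π^b x + c and has valuation
-- min(2b + 1, 2 ord(c)).  So closure under multiplication is the inequality of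
-- (1), while (2), (3) and (4) compare valuations of coordinates.
--
-- For (5), if B is a unit or a = 0, a functional θ makes the order O self-dual
-- for the form θ(y z); then the θ-dual of a fractional ideal with multiplier
-- ring O is its inverse.  Otherwise 𝒪 + 𝒪 e₁ + 𝒪 B⁻¹ e₂, the dual of O for the
-- e₁-coordinate of y z, has multiplier ring O and is not invertible.

-- Submodules are bare predicates: membership cannot be decided, and nothing exhibits an element of
-- least valuation. Finite generation therefore enters only as the statement that a lower bound for
-- a functional at the generators holds on the whole module. This yields pivots, and it passes from
-- generators over O to generators over 𝒪. The submodules in a chain that measures the length come
-- without generators; there least valuations exist only up to double negation, which suffices
-- because the resulting bound on the length is decidable. The square in x² = p + q x cannot be
-- completed in characteristic 2, so q is kept; the trace term it adds to the norm of π^b x + c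
-- never dominates. Self-duality gives inverses by dualizing twice. Let I* be the θ-dual of I. The
-- elements k with θ(k I I*) integral are those with k I inside I** = I, that is, the multiplier
-- ring O. Hence I I* is the dual of O, which is O again. The form θ(y z) with θ the e₁-coordinate
-- is perfect exactly when B is a unit. For a = 0 the order is the product of 𝒪 and 𝒪[π^b x + c],
-- and a second θ, adapted to that product, replaces it.

open import Defs
open import Level using (Level; _⊔_)
open import Algebra.Bundles using (CommutativeRing)
open import Algebra.Morphism.Structures using (IsRingHomomorphism)
import Algebra.Properties.AbelianGroup as AbelianGroupProperties
import Algebra.Properties.CommutativeMonoid.Sum as Sum
import Algebra.Properties.Ring as RingProperties
import Algebra.Properties.Semiring.Mult.TCOptimised as Mult
import Algebra.Properties.Semiring.Sum as SemiringSum
open import Algebra.Solver.Ring.AlmostCommutativeRing using (fromCommutativeRing; _-Raw-AlmostCommutative⟶_)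
import Algebra.Solver.Ring as RingSolver
open import Data.Fin.Base using (Fin; zero; suc; toℕ; inject₁; fromℕ; combine; remQuot)
open import Data.Fin.Induction using (<-weakInduction)
import Data.Fin.Properties as Fin
open import Data.Integer.Base as ℤ using (ℤ; +_; -[1+_]; 0ℤ; 1ℤ)
import Data.Integer.Properties as ℤ
import Data.Integer.Solver as ℤ
import Data.Maybe.Base as Maybe
open import Data.Nat.Base as ℕ using (ℕ; zero; suc; ⌈_/2⌉)
import Data.Nat.Divisibility as ℕ
open import Data.Nat.Induction using (<-rec)
import Data.Nat.Properties as ℕ
open import Data.Product using (∃; _×_; _,_; proj₁; proj₂; uncurry)
import Data.Sign.Base as Sign
open import Data.Sum.Base using (_⊎_; inj₁; inj₂)
open import Data.Vec.Functional using ([]; _∷_)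
open import Function.Base using (_∘_; id)
open import Function.Bundles using (_⇔_; Equivalence; mk⇔)
open import Relation.Binary.Construct.Add.Supremum.NonStrict ℤ._≤_ using ([_]; _≤⊤⁺)
open import Relation.Binary.Construct.Add.Supremum.Strict ℤ._<_ using ([_])
open import Relation.Binary.PropositionalEquality as ≡ using (_≡_)
open import Relation.Nullary.Construct.Add.Supremum using ([]-injective)
open import Relation.Nullary.Decidable using (yes; no; decidable-stable)
open import Relation.Nullary.Decidable.Core using (dec⇒maybe)
open import Relation.Nullary.Negation using (¬_; contradiction)
open import Relation.Unary using (Pred; _∈_; _⊆_; _⊂_; _≐_; _⟨×⟩_)

-- The solver needs coefficients with a computing equality, which an abstract
-- ring lacks, so it takes them in ℤ.
module IntegerRingSolver {c ℓ} (R : CommutativeRing c ℓ) where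

  open CommutativeRing R
  open AbelianGroupProperties +-abelianGroup using (⁻¹-∙-comm; ⁻¹-involutive; ε⁻¹≈ε)
  open RingProperties ring using (-‿distribˡ-*; -‿distribʳ-*)
  open Mult semiring using (×-homo-+; ×1-homo-*; 1+×) renaming (_×_ to _×′_)
  open import Relation.Binary.Reasoning.Setoid setoid

  private
    ⟦_⟧ℤ : ℤ → Carrier
    ⟦ + n ⟧ℤ      = n ×′ 1#
    ⟦ -[1+ n ] ⟧ℤ = - (suc n ×′ 1#)

    x+y-[x+z]≈y-z : ∀ x y z → (x + y) - (x + z) ≈ y - z
    x+y-[x+z]≈y-z x y z = begin
      (x + y) - (x + z)       ≈⟨ +-cong (+-comm x y) (sym (⁻¹-∙-comm x z)) ⟩
      (y + x) + (- x + - z)   ≈⟨ +-assoc y x _ ⟩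
      y + (x + (- x + - z))   ≈⟨ +-congˡ (+-assoc x (- x) (- z)) ⟨
      y + ((x - x) + - z)     ≈⟨ +-congˡ (+-congʳ (-‿inverseʳ x)) ⟩
      y + (0# + - z)          ≈⟨ +-congˡ (+-identityˡ (- z)) ⟩
      y - z                   ∎

    ⊖-homo : ∀ m n → ⟦ m ℤ.⊖ n ⟧ℤ ≈ m ×′ 1# - n ×′ 1#
    ⊖-homo zero    zero    = sym (-‿inverseʳ 0#)
    ⊖-homo zero    (suc n) = sym (+-identityˡ _)
    ⊖-homo (suc m) zero    = sym (trans (+-congˡ ε⁻¹≈ε) (+-identityʳ _))
    ⊖-homo (suc m) (suc n) = begin
      ⟦ suc m ℤ.⊖ suc n ⟧ℤ            ≡⟨ ≡.cong ⟦_⟧ℤ (ℤ.[1+m]⊖[1+n]≡m⊖n m n) ⟩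
      ⟦ m ℤ.⊖ n ⟧ℤ                    ≈⟨ ⊖-homo m n ⟩
      m ×′ 1# - n ×′ 1#                  ≈⟨ x+y-[x+z]≈y-z 1# (m ×′ 1#) (n ×′ 1#) ⟨
      (1# + m ×′ 1#) - (1# + n ×′ 1#)    ≈⟨ +-cong (1+× m 1#) (-‿cong (1+× n 1#)) ⟨
      suc m ×′ 1# - suc n ×′ 1#          ∎

    +-homo : ∀ i j → ⟦ i ℤ.+ j ⟧ℤ ≈ ⟦ i ⟧ℤ + ⟦ j ⟧ℤ
    +-homo (+ m)    (+ n)    = ×-homo-+ 1# m n
    +-homo (+ m)    -[1+ n ] = ⊖-homo m (suc n)
    +-homo -[1+ m ] (+ n)    = trans (⊖-homo n (suc m)) (+-comm _ _)
    +-homo -[1+ m ] -[1+ n ] = begin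
      - ((2 ℕ.+ (m ℕ.+ n)) ×′ 1#)          ≡⟨ ≡.cong (λ k → - (suc k ×′ 1#)) (≡.sym (ℕ.+-suc m n)) ⟩
      - ((suc m ℕ.+ suc n) ×′ 1#)          ≈⟨ -‿cong (×-homo-+ 1# (suc m) (suc n)) ⟩
      - (suc m ×′ 1# + suc n ×′ 1#)         ≈⟨ ⁻¹-∙-comm _ _ ⟨
      - (suc m ×′ 1#) + - (suc n ×′ 1#)     ∎

    -‿homo : ∀ i → ⟦ ℤ.- i ⟧ℤ ≈ - ⟦ i ⟧ℤ
    -‿homo (+ zero)    = sym ε⁻¹≈ε
    -‿homo (+ (suc n)) = refl
    -‿homo -[1+ n ]    = sym (⁻¹-involutive _)

    *-homo : ∀ i j → ⟦ i ℤ.* j ⟧ℤ ≈ ⟦ i ⟧ℤ * ⟦ j ⟧ℤ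
    *-homo (+ m) (+ n) = begin
      ⟦ Sign.+ ℤ.◃ m ℕ.* n ⟧ℤ   ≡⟨ ≡.cong ⟦_⟧ℤ (ℤ.+◃n≡+n (m ℕ.* n)) ⟩
      (m ℕ.* n) ×′ 1#            ≈⟨ ×1-homo-* m n ⟩
      (m ×′ 1#) * (n ×′ 1#)       ∎
    *-homo (+ m) -[1+ n ] = begin
      ⟦ Sign.- ℤ.◃ m ℕ.* suc n ⟧ℤ   ≡⟨ ≡.cong ⟦_⟧ℤ (ℤ.-◃n≡-n (m ℕ.* suc n)) ⟩
      ⟦ ℤ.- (+ (m ℕ.* suc n)) ⟧ℤ    ≈⟨ -‿homo (+ (m ℕ.* suc n)) ⟩
      - ((m ℕ.* suc n) ×′ 1#)        ≈⟨ -‿cong (×1-homo-* m (suc n)) ⟩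
      - ((m ×′ 1#) * (suc n ×′ 1#))   ≈⟨ -‿distribʳ-* _ _ ⟩
      (m ×′ 1#) * - (suc n ×′ 1#)     ∎
    *-homo -[1+ m ] (+ n) = begin
      ⟦ Sign.- ℤ.◃ suc m ℕ.* n ⟧ℤ   ≡⟨ ≡.cong ⟦_⟧ℤ (ℤ.-◃n≡-n (suc m ℕ.* n)) ⟩
      ⟦ ℤ.- (+ (suc m ℕ.* n)) ⟧ℤ    ≈⟨ -‿homo (+ (suc m ℕ.* n)) ⟩
      - ((suc m ℕ.* n) ×′ 1#)        ≈⟨ -‿cong (×1-homo-* (suc m) n) ⟩
      - ((suc m ×′ 1#) * (n ×′ 1#))   ≈⟨ -‿distribˡ-* _ _ ⟩
      - (suc m ×′ 1#) * (n ×′ 1#)     ∎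
    *-homo -[1+ m ] -[1+ n ] = begin
      (suc m ℕ.* suc n) ×′ 1#                ≈⟨ ×1-homo-* (suc m) (suc n) ⟩
      (suc m ×′ 1#) * (suc n ×′ 1#)           ≈⟨ ⁻¹-involutive _ ⟨
      - - ((suc m ×′ 1#) * (suc n ×′ 1#))     ≈⟨ -‿cong (-‿distribˡ-* _ _) ⟩
      - (- (suc m ×′ 1#) * (suc n ×′ 1#))     ≈⟨ -‿distribʳ-* _ _ ⟩
      - (suc m ×′ 1#) * - (suc n ×′ 1#)       ∎

    morphism : ℤ.+-*-rawRing -Raw-AlmostCommutative⟶ fromCommutativeRing R
    morphism = record
      { ⟦_⟧    = ⟦_⟧ℤ
      ; +-homo = +-homo
      ; *-homo = *-homo
      ; -‿homo = -‿homo
      ; 0-homo = refl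
      ; 1-homo = refl
      }

  open RingSolver ℤ.+-*-rawRing (fromCommutativeRing R) morphism
    (λ i j → Maybe.map (λ i≡j → reflexive (≡.cong ⟦_⟧ℤ i≡j)) (dec⇒maybe (i ℤ.≟ j))) public
    using (solve; _:=_; con; _:+_; _:*_; _:-_; :-_)

-- Linear inequalities between integers

module IntegerInequalities where

  open ℤ.+-*-Solver public using () renaming
    (solve to ℤ-solve; con to κ; _:+_ to _⊕_; _:-_ to _⊖_; _:*_ to _⊗_; _:=_ to _⊜_)
  open import Data.Integer.Base using (_+_; _-_; _*_; _≤_)

  -- d is the slack of the derived inequality.
  lin₁ : ∀ d {i j k l} → i ≤ j → l - k ≡ (j - i) + + d → k ≤ l
  lin₁ d i≤j eq = ℤ.0≤i-j⇒j≤i (≡.subst (0ℤ ≤_) (≡.sym eq)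
    (ℤ.+-mono-≤ (ℤ.i≤j⇒0≤j-i i≤j) (ℤ.+≤+ (ℕ.z≤n {d}))))

  lin₂ : ∀ d {i j i′ j′ k l} → i ≤ j → i′ ≤ j′ → l - k ≡ (j - i) + (j′ - i′) + + d → k ≤ l
  lin₂ d i≤j i′≤j′ eq = ℤ.0≤i-j⇒j≤i (≡.subst (0ℤ ≤_) (≡.sym eq)
    (ℤ.+-mono-≤ (ℤ.+-mono-≤ (ℤ.i≤j⇒0≤j-i i≤j) (ℤ.i≤j⇒0≤j-i i′≤j′)) (ℤ.+≤+ (ℕ.z≤n {d}))))

  -- Strictness is written `j + 1ℤ ≤ i` because `lin₁` and `lin₂` combine only weak inequalities.
  ≤-or-> : ∀ i j → i ≤ j ⊎ j + 1ℤ ≤ i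
  ≤-or-> i j with i ℤ.≤? j
  ... | yes i≤j = inj₁ i≤j
  ... | no  i≰j = inj₂ (≡.subst (_≤ i) (ℤ.+-comm 1ℤ j) (ℤ.i<j⇒suc[i]≤j (ℤ.≰⇒> i≰j)))

  i+1≰i : ∀ {i} → ¬ (i + 1ℤ ≤ i)
  i+1≰i {i} p with lin₁ 0 {k = 1ℤ} {0ℤ} p (ℤ-solve 1 (λ i → κ 0ℤ ⊖ κ 1ℤ ⊜ i ⊖ (i ⊕ κ 1ℤ) ⊕ κ 0ℤ) ≡.refl i)
  ... | ℤ.+≤+ ()

  double-≤ : ∀ {i j} → i ≤ j → i + i ≤ j + j
  double-≤ p = ℤ.+-mono-≤ p p

  -- Otherwise `j + 1ℤ ≤ i`, and doubling contradicts the hypothesis. The spare unit lets one lemma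
  -- serve both the even valuations of elements of F in E′ and the odd valuations of their multiples
  -- by x.
  halve : ∀ {i j} → i + i ≤ j + j + 1ℤ → i ≤ j
  halve {i} {j} p with ≤-or-> i j
  ... | inj₁ i≤j = i≤j
  ... | inj₂ j<i = contradiction 
    (lin₂ 0 p (double-≤ j<i)
      (ℤ-solve 2 (λ i j → κ 0ℤ ⊖ (κ 0ℤ ⊕ κ 1ℤ) ⊜ (j ⊕ j ⊕ κ 1ℤ) ⊖ (i ⊕ i) ⊕ (i ⊕ i ⊖ (j ⊕ κ 1ℤ ⊕ (j ⊕ κ 1ℤ))) ⊕ κ 0ℤ)
        ≡.refl i j)) (i+1≰i {0ℤ})

  halve-< : ∀ {i j} → i + i + 1ℤ ≤ j + j → i + 1ℤ ≤ j
  halve-< {i} {j} p = halve {i + 1ℤ} {j} (lin₁ 0 p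
    (ℤ-solve 2 (λ i j → j ⊕ j ⊕ κ 1ℤ ⊖ (i ⊕ κ 1ℤ ⊕ (i ⊕ κ 1ℤ)) ⊜ j ⊕ j ⊖ (i ⊕ i ⊕ κ 1ℤ) ⊕ κ 0ℤ) ≡.refl i j))

  2*≡+ : ∀ i → + 2 * i ≡ i + i
  2*≡+ i = ℤ-solve 1 (λ i → κ (+ 2) ⊗ i ⊜ i ⊕ i) ≡.refl i

  2b+1≡ : ∀ b → + b + + b + 1ℤ ≡ + (2 ℕ.* b ℕ.+ 1)
  2b+1≡ b = ≡.cong (λ k → + (b ℕ.+ k ℕ.+ 1)) (≡.sym (ℕ.+-identityʳ b))

-- Valuations and powers of a uniformizer

module Valuation {c ℓ} (K : DiscretelyValuedField c ℓ) where

  open DiscretelyValuedField K hiding (zero)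
  open IntegerInequalities
  open IntegerRingSolver commutativeRing

  infix 4 _≤ord_

  -- Lower bounds hold for 0 and survive sums without a case distinction on ∞; exact valuations are
  -- used only for divisors and dominant terms.
  _≤ord_ : ℤ → Carrier → Set
  n ≤ord y = [ n ] ≤⁺ ord y

  ≤ord-resp : ∀ {n y z} → y ≈ z → n ≤ord y → n ≤ord z
  ≤ord-resp {n} y≈z = ≡.subst ([ n ] ≤⁺_) (ord-cong y≈z)

  ≤⁺-mono : ∀ {m n v} → m ℤ.≤ n → [ n ] ≤⁺ v → [ m ] ≤⁺ v
  ≤⁺-mono m≤n [ n≤k ]    = [ ℤ.≤-trans m≤n n≤k ]
  ≤⁺-mono m≤n (_ ≤⊤⁺) = _ ≤⊤⁺

  ≤ord-mono : ∀ {m n} y → m ℤ.≤ n → n ≤ord y → m ≤ord y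
  ≤ord-mono y = ≤⁺-mono

  ≤ord-0 : ∀ {n y} → y ≈ 0# → n ≤ord y
  ≤ord-0 {n} y≈0 = ≡.subst ([ n ] ≤⁺_) (≡.sym (Equivalence.from (ord-∞ _) y≈0)) (_ ≤⊤⁺)

  ≤ord-+ : ∀ {n} y z → n ≤ord y → n ≤ord z → n ≤ord y + z
  ≤ord-+ {n} y z p q = go (ord y) (ord z) p q (ord-+ y z)
    where
    go : ∀ u v {w} → [ n ] ≤⁺ u → [ n ] ≤⁺ v → (u ⊓∞ v) ≤⁺ w → [ n ] ≤⁺ w
    go [ k ] [ l ] [ p ] [ q ] [ r ]       = [ ℤ.≤-trans (ℤ.⊓-glb p q) r ]
    go [ k ] ⊤⁺    [ p ] _     [ r ]       = [ ℤ.≤-trans p r ]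
    go ⊤⁺    [ l ] _     [ q ] [ r ]       = [ ℤ.≤-trans q r ]
    go _     _     _     _     (_ ≤⊤⁺) = _ ≤⊤⁺

  ≤ord-* : ∀ {m n} y z → m ≤ord y → n ≤ord z → (m ℤ.+ n) ≤ord y * z
  ≤ord-* {m} {n} y z p q = ≡.subst ([ m ℤ.+ n ] ≤⁺_) (≡.sym (ord-* y z)) (go p q)
    where
    go : ∀ {u v} → [ m ] ≤⁺ u → [ n ] ≤⁺ v → [ m ℤ.+ n ] ≤⁺ (u +∞ v)
    go [ p ]       [ q ]       = [ ℤ.+-mono-≤ p q ]
    go [ p ]       (_ ≤⊤⁺) = _ ≤⊤⁺
    go (_ ≤⊤⁺) q           = _ ≤⊤⁺

  zero-or-ord : ∀ y → y ≈ 0# ⊎ ∃ λ k → ord y ≡ [ k ]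
  zero-or-ord y = go (ord y) ≡.refl
    where
    go : ∀ v → ord y ≡ v → y ≈ 0# ⊎ ∃ λ k → ord y ≡ [ k ]
    go [ k ] eq = inj₂ (k , eq)
    go ⊤⁺    eq = inj₁ (Equivalence.to (ord-∞ y) eq)

  ord-finite : ∀ {y} → ¬ (y ≈ 0#) → ∃ λ k → ord y ≡ [ k ]
  ord-finite {y} y≉0 with zero-or-ord y
  ... | inj₁ y≈0 = contradiction y≈0 y≉0
  ... | inj₂ fin = fin

  ord-finite⇒≉0 : ∀ {y k} → ord y ≡ [ k ] → ¬ (y ≈ 0#)
  ord-finite⇒≉0 {y} eq y≈0 with () ← ≡.trans (≡.sym eq) (Equivalence.from (ord-∞ y) y≈0)

  ord≡⇒≤ord : ∀ {y k} → ord y ≡ [ k ] → k ≤ord y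
  ord≡⇒≤ord {k = k} eq = ≡.subst ([ k ] ≤⁺_) (≡.sym eq) [ ℤ.≤-refl ]

  ≤ord⇒≤ : ∀ {y n k} → ord y ≡ [ k ] → n ≤ord y → n ℤ.≤ k
  ≤ord⇒≤ {n = n} eq p with [ q ] ← ≡.subst ([ n ] ≤⁺_) eq p = q

  ≤⇒≤ord : ∀ {y n k} → ord y ≡ [ k ] → n ℤ.≤ k → n ≤ord y
  ≤⇒≤ord {y} eq n≤k = ≤ord-mono y n≤k (ord≡⇒≤ord eq)

  ≤ord-or-ord< : ∀ n y → n ≤ord y ⊎ ∃ λ k → k ℤ.+ 1ℤ ℤ.≤ n × ord y ≡ [ k ]
  ≤ord-or-ord< n y with zero-or-ord y
  ... | inj₁ y≈0 = inj₁ (≤ord-0 y≈0)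
  ... | inj₂ (k , eq) with ≤-or-> n k
  ...   | inj₁ n≤k = inj₁ (≤⇒≤ord eq n≤k)
  ...   | inj₂ k<n = inj₂ (k , k<n , eq)

  ≤ord-all⇒≈0 : ∀ {y} → (∀ n → n ≤ord y) → y ≈ 0#
  ≤ord-all⇒≈0 {y} p with zero-or-ord y
  ... | inj₁ y≈0 = y≈0
  ... | inj₂ (k , eq) = contradiction (≤ord⇒≤ eq (p (k ℤ.+ 1ℤ))) i+1≰i

  -- Supplies the pivots of the elimination: an entry of least valuation divides all the others.
  minimal-ord : ∀ {n} (f : Fin n → Carrier) →
                (∀ i → f i ≈ 0#) ⊎ (∃ λ i → ∃ λ k → ord (f i) ≡ [ k ] × (∀ j → k ≤ord f j))
  minimal-ord {zero}  f = inj₁ λ ()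
  minimal-ord {suc n} f with zero-or-ord (f zero) | minimal-ord (f ∘ suc)
  ... | inj₁ f₀≈0 | inj₁ f≈0 = inj₁ λ { zero → f₀≈0 ; (suc i) → f≈0 i }
  ... | inj₁ f₀≈0 | inj₂ (i , k , eq , k≤f) = inj₂ (suc i , k , eq , λ { zero → ≤ord-0 f₀≈0 ; (suc j) → k≤f j })
  ... | inj₂ (k , eq) | inj₁ f≈0 = inj₂ (zero , k , eq , λ { zero → ord≡⇒≤ord eq ; (suc j) → ≤ord-0 (f≈0 j) })
  ... | inj₂ (k₀ , eq₀) | inj₂ (i , k , eq , k≤f) with ℤ.≤-total k₀ k
  ...   | inj₁ k₀≤k = inj₂ (zero , k₀ , eq₀ , λ { zero → ord≡⇒≤ord eq₀ ; (suc j) → ≤ord-mono _ k₀≤k (k≤f j) })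
  ...   | inj₂ k≤k₀ = inj₂ (suc i , k , eq , λ { zero → ≤⇒≤ord eq₀ k≤k₀ ; (suc j) → k≤f j })

  ord-*-finite : ∀ {y z k l} → ord y ≡ [ k ] → ord z ≡ [ l ] → ord (y * z) ≡ [ k ℤ.+ l ]
  ord-*-finite {y} {z} p q = ≡.trans (ord-* y z) (≡.cong₂ _+∞_ p q)

  ord-1 : ord 1# ≡ [ 0ℤ ]
  ord-1 with ord-finite 1≉0
  ... | k , eq = ≡.trans eq (≡.cong [_] k≡0)
    where
    k≡k+k-k : ∀ k → k ≡ (k ℤ.+ k) ℤ.- k
    k≡k+k-k = ℤ-solve 1 (λ k → k ⊜ k ⊕ k ⊖ k) ≡.refl
    k+k≡k : k ℤ.+ k ≡ k
    k+k≡k = []-injective (≡.trans (≡.sym (ord-*-finite eq eq)) (≡.trans (ord-cong (*-identityˡ 1#)) eq))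
    k≡0 : k ≡ 0ℤ
    k≡0 = ≡.trans (k≡k+k-k k) (≡.trans (≡.cong (ℤ._- k) k+k≡k) (ℤ.+-inverseʳ k))

  ≤ord-1 : 0ℤ ≤ord 1#
  ≤ord-1 = ord≡⇒≤ord ord-1

  -- ord (-1) is k with k + k = ord 1 = 0.
  ≤ord--1 : 0ℤ ≤ord (- 1#)
  ≤ord--1 with zero-or-ord (- 1#)
  ... | inj₁ -1≈0 = ≤ord-0 -1≈0
  ... | inj₂ (k , eq) = ≤⇒≤ord eq
      (halve (lin₁ 1 (≤ord⇒≤ (ord-*-finite eq eq) (≤ord-resp [-1]² ≤ord-1))
      (ℤ-solve 1 (λ k → k ⊕ k ⊕ κ 1ℤ ⊖ (κ 0ℤ ⊕ κ 0ℤ) ⊜ k ⊕ k ⊖ κ 0ℤ ⊕ κ 1ℤ) ≡.refl k)))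
    where
    [-1]² : 1# ≈ (- 1#) * (- 1#)
    [-1]² = solve 0 (con 1ℤ := (:- con 1ℤ) :* (:- con 1ℤ)) refl

  ≤ord-neg : ∀ {n} y → n ≤ord y → n ≤ord (- y)
  ≤ord-neg {n} y p = ≤ord-mono (- y) (ℤ.≤-reflexive (≡.sym (ℤ.+-identityˡ n)))
    (≤ord-resp (solve 1 (λ y → (:- con 1ℤ) :* y := :- y) refl y) (≤ord-* (- 1#) y ≤ord--1 p))

  ≤ord-- : ∀ {n} y z → n ≤ord y → n ≤ord z → n ≤ord (y - z)
  ≤ord-- y z p q = ≤ord-+ y (- z) p (≤ord-neg z q)

  ≤ord-*-integral : ∀ {n} y z → 0ℤ ≤ord y → n ≤ord z → n ≤ord (y * z)
  ≤ord-*-integral {n} y z p q = ≡.subst (λ m → m ≤ord (y * z)) (ℤ.+-identityˡ n) (≤ord-* y z p q)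

  ≤ord-cancel : ∀ {t k n} y → ord t ≡ [ k ] → (k ℤ.+ n) ≤ord (t * y) → n ≤ord y
  ≤ord-cancel {t} {k} {n} y eq p with zero-or-ord y
  ... | inj₁ y≈0 = ≤ord-0 y≈0
  ... | inj₂ (l , eq′) = ≤⇒≤ord eq′
      (lin₁ 0 (≤ord⇒≤ (ord-*-finite eq eq′) p) (ℤ-solve 3 (λ k l n → l ⊖ n ⊜ k ⊕ l ⊖ (k ⊕ n) ⊕ κ 0ℤ) ≡.refl k l n))

  ord-≡ : ∀ {y k} → k ≤ord y → ¬ ((k ℤ.+ 1ℤ) ≤ord y) → ord y ≡ [ k ]
  ord-≡ {y} {k} p ¬p with ≤ord-or-ord< (k ℤ.+ 1ℤ) y
  ... | inj₁ q = contradiction q ¬p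
  ... | inj₂ (l , l<k , eq) = ≡.trans eq
      (≡.cong [_] (ℤ.≤-antisym (lin₁ 0 l<k (ℤ-solve 2 (λ k l → k ⊖ l ⊜ k ⊕ κ 1ℤ ⊖ (l ⊕ κ 1ℤ) ⊕ κ 0ℤ) ≡.refl k l))
      (≤ord⇒≤ eq p)))

  -- A larger valuation of the sum would pass to `y = (y + z) - z`.
  ord-+-strict : ∀ {y z k} → ord y ≡ [ k ] → (k ℤ.+ 1ℤ) ≤ord z → ord (y + z) ≡ [ k ]
  ord-+-strict {y} {z} {k} eq p = ord-≡
    (≤ord-+ y z (ord≡⇒≤ord eq) (≤ord-mono z (ℤ.i≤i+j k 1ℤ) p))
    (λ q → i+1≰i (≤ord⇒≤ eq (≤ord-resp (solve 2 (λ y z → (y :+ z) :- z := y) refl y z) (≤ord-- (y + z) z q p))))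

  ord-neg : ∀ {y k} → ord y ≡ [ k ] → ord (- y) ≡ [ k ]
  ord-neg {y} eq = ord-≡ (≤ord-neg y (ord≡⇒≤ord eq))
    (λ p → i+1≰i (≤ord⇒≤ eq (≤ord-resp (solve 1 (λ y → :- (:- y) := y) refl y) (≤ord-neg (- y) p))))

  invert : ∀ {y k} → ord y ≡ [ k ] → ∃ λ y⁻¹ → y⁻¹ * y ≈ 1# × ord y⁻¹ ≡ [ ℤ.- k ]
  invert {y} {k} eq with inverse y (ord-finite⇒≉0 eq)
  ... | z , yz≈1 = z , zy≈1 , ord-z
    where
    zy≈1 = trans (*-comm z y) yz≈1
    ord-z : ord z ≡ [ ℤ.- k ]
    ord-z with zero-or-ord z
    ... | inj₁ z≈0 = contradiction (trans (sym yz≈1) (trans (*-congˡ z≈0) (zeroʳ y))) 1≉0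
    ... | inj₂ (l , eq′) = ≡.trans eq′
        (≡.cong [_] (l≡-k (≡.trans (≡.sym (ord-*-finite eq eq′)) (≡.trans (ord-cong yz≈1) ord-1))))
      where
      l≡-k : [ k ℤ.+ l ] ≡ [ 0ℤ ] → l ≡ ℤ.- k
      l≡-k p = ≡.trans (≡.trans l≡ (≡.cong (ℤ._- k) ([]-injective p))) (ℤ.+-identityˡ (ℤ.- k))
        where
        l≡ : l ≡ (k ℤ.+ l) ℤ.- k
        l≡ = ℤ-solve 2 (λ k l → l ⊜ k ⊕ l ⊖ k) ≡.refl k l

  ≈0-cancel : ∀ {y k} z → ord y ≡ [ k ] → y * z ≈ 0# → z ≈ 0#
  ≈0-cancel {y} z eq yz≈0 with invert eq
  ... | y⁻¹ , y⁻¹y≈1 , _ = begin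
    z               ≈⟨ *-identityˡ z ⟨
    1# * z          ≈⟨ *-congʳ y⁻¹y≈1 ⟨
    (y⁻¹ * y) * z   ≈⟨ *-assoc y⁻¹ y z ⟩
    y⁻¹ * (y * z)   ≈⟨ *-congˡ yz≈0 ⟩
    y⁻¹ * 0#        ≈⟨ zeroʳ y⁻¹ ⟩
    0#              ∎
    where open import Relation.Binary.Reasoning.Setoid setoid

  module _ (t : Uniformizer) where

    open Uniformizer t

    private
      t⁻¹ : Carrier
      t⁻¹ = proj₁ (inverse element ≉0)

      t*[t⁻¹*y]≈y : ∀ y → element * (t⁻¹ * y) ≈ y
      t*[t⁻¹*y]≈y y = trans (sym (*-assoc _ _ y)) (trans (*-congʳ (proj₂ (inverse element ≉0))) (*-identityˡ y))

    ^-suc : ∀ m → t ^ ℤ.suc m ≈ element * t ^ m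
    ^-suc (+ n)          = refl
    ^-suc -[1+ zero ]    = sym (t*[t⁻¹*y]≈y 1#)
    ^-suc -[1+ suc n ]   = sym (t*[t⁻¹*y]≈y _)

    -- Negative powers are powers of a chosen inverse. For negative `m` both sides are multiplied by
    -- `element`, which raises the exponent by one and so lets the recursion run towards 0.
    ^-homo-+ : ∀ m n → t ^ (m ℤ.+ n) ≈ t ^ m * t ^ n
    ^-homo-+ (+ zero) n = begin
      t ^ (0ℤ ℤ.+ n)   ≡⟨ ≡.cong (t ^_) (ℤ.+-identityˡ n) ⟩
      t ^ n            ≈⟨ *-identityˡ _ ⟨
      1# * t ^ n       ∎
      where open import Relation.Binary.Reasoning.Setoid setoid
    ^-homo-+ (+ suc m) n = begin
      t ^ (+ suc m ℤ.+ n)             ≡⟨ ≡.cong (t ^_) (ℤ.suc-+ m n) ⟩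
      t ^ ℤ.suc (+ m ℤ.+ n)           ≈⟨ ^-suc (+ m ℤ.+ n) ⟩
      element * t ^ (+ m ℤ.+ n)       ≈⟨ *-congˡ (^-homo-+ (+ m) n) ⟩
      element * (t ^ (+ m) * t ^ n)   ≈⟨ *-assoc _ _ _ ⟨
      t ^ (+ suc m) * t ^ n           ∎
      where open import Relation.Binary.Reasoning.Setoid setoid
    ^-homo-+ -[1+ m ] n = *-cancel (begin
      element * t ^ (-[1+ m ] ℤ.+ n)         ≈⟨ ^-suc (-[1+ m ] ℤ.+ n) ⟨
      t ^ ℤ.suc (-[1+ m ] ℤ.+ n)             ≡⟨ ≡.cong (t ^_) (ℤ.+-assoc 1ℤ -[1+ m ] n) ⟨
      t ^ (ℤ.suc -[1+ m ] ℤ.+ n)             ≈⟨ step m ⟩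
      t ^ ℤ.suc -[1+ m ] * t ^ n             ≈⟨ *-congʳ (^-suc -[1+ m ]) ⟩
      (element * t ^ -[1+ m ]) * t ^ n       ≈⟨ *-assoc _ _ _ ⟩
      element * (t ^ -[1+ m ] * t ^ n)       ∎)
      where
      open import Relation.Binary.Reasoning.Setoid setoid
      step : ∀ m → t ^ (ℤ.suc -[1+ m ] ℤ.+ n) ≈ t ^ ℤ.suc -[1+ m ] * t ^ n
      step zero    = ^-homo-+ 0ℤ n
      step (suc m) = ^-homo-+ -[1+ m ] n
      *-cancel : ∀ {y z} → element * y ≈ element * z → y ≈ z
      *-cancel {y} {z} p = trans (sym (*-cancel′ y)) (trans (*-congˡ p) (*-cancel′ z))
        where
        *-cancel′ : ∀ y → t⁻¹ * (element * y) ≈ y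
        *-cancel′ y = trans (solve 3 (λ s t y → s :* (t :* y) := t :* (s :* y)) refl t⁻¹ element y) (t*[t⁻¹*y]≈y y)

    t^-n*t^n≈1 : ∀ n → t ^ (ℤ.- n) * t ^ n ≈ 1#
    t^-n*t^n≈1 n = trans (sym (^-homo-+ (ℤ.- n) n)) (reflexive (≡.cong (t ^_) (ℤ.+-inverseˡ n)))

    t^n*t^-n*y≈y : ∀ n y → t ^ n * (t ^ (ℤ.- n) * y) ≈ y
    t^n*t^-n*y≈y n y = trans (solve 3 (λ s t y → s :* (t :* y) := (t :* s) :* y) refl _ _ y)
      (trans (*-congʳ (t^-n*t^n≈1 n)) (*-identityˡ y))

    ord-^+ : ∀ n → ord (t ^ (+ n)) ≡ [ + n ]
    ord-^+ zero    = ord-1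
    ord-^+ (suc n) = ord-*-finite ord≡1 (ord-^+ n)

    ord-^ : ∀ n → ord (t ^ n) ≡ [ n ]
    ord-^ (+ n) = ord-^+ n
    ord-^ -[1+ n ] with invert (ord-^+ (suc n))
    ... | z , z*≈1 , ord-z = ≡.trans (ord-cong (begin
      t ^ -[1+ n ]                                  ≈⟨ *-identityˡ _ ⟨
      1# * t ^ -[1+ n ]                             ≈⟨ *-congʳ z*≈1 ⟨
      (z * t ^ (+ suc n)) * t ^ -[1+ n ]            ≈⟨ solve 3 (λ u v w → (u :* v) :* w := u :* (w :* v)) refl _ _ _ ⟩
      z * (t ^ -[1+ n ] * t ^ (+ suc n))            ≈⟨ *-congˡ (t^-n*t^n≈1 (+ suc n)) ⟩
      z * 1#                                        ≈⟨ *-identityʳ z ⟩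
      z                                             ∎)) ord-z
      where open import Relation.Binary.Reasoning.Setoid setoid

    ≤ord-^* : ∀ {n} k y → n ≤ord y → (k ℤ.+ n) ≤ord (t ^ k * y)
    ≤ord-^* k y = ≤ord-* (t ^ k) y (ord≡⇒≤ord (ord-^ k))

    ≤ord⇒∈⟨^⟩ : ∀ {n y} → n ≤ord y → ⟨ t ^ n ⟩ y
    ≤ord⇒∈⟨^⟩ {n} {y} p = t ^ (ℤ.- n) * y ,
      ≤ord-mono (t ^ (ℤ.- n) * y) (ℤ.≤-reflexive (≡.sym (ℤ.+-inverseˡ n))) (≤ord-^* (ℤ.- n) y p) ,
      sym (t^n*t^-n*y≈y n y)

    ∈⟨^⟩⇒≤ord : ∀ {n y} → ⟨ t ^ n ⟩ y → n ≤ord y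
    ∈⟨^⟩⇒≤ord {n} {y} (u , u∈𝒪 , y≈) = ≤ord-mono y (ℤ.≤-reflexive (≡.sym (ℤ.+-identityʳ n)))
      (≤ord-resp (sym y≈) (≤ord-^* n u u∈𝒪))

    t^-k*-integral : ∀ k {y} → k ≤ord y → 0ℤ ≤ord (t ^ (ℤ.- k) * y)
    t^-k*-integral k {y} p = ≤ord-mono _ (ℤ.≤-reflexive (≡.sym (ℤ.+-inverseˡ k))) (≤ord-^* (ℤ.- k) y p)

    t^-k*-integral⁻ : ∀ k {y} → 0ℤ ≤ord (t ^ (ℤ.- k) * y) → k ≤ord y
    t^-k*-integral⁻ k {y} p = ≤ord-cancel y (ord-^ (ℤ.- k)) (≤ord-mono _ (ℤ.≤-reflexive (ℤ.+-inverseˡ k)) p)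

-- Coordinates r + s x on E′ and the Eisenstein equation of x

module Coordinates {c ℓ} (F₀ : LocalField c ℓ) (E₀ : RamifiedQuadraticExtension F₀)
                   (x : RamifiedQuadraticExtension.Uniformizer E₀) where

  private
    module F = LocalField F₀
    module VF = Valuation F.discretelyValuedField

  open RamifiedQuadraticExtension E₀ hiding (zero)
  open Valuation discretelyValuedField
  open IsRingHomomorphism ι-isHom renaming (⟦⟧-cong to ι-cong) using (+-homo; *-homo; -‿homo; 0#-homo; 1#-homo)
  open IntegerInequalities
  open IntegerRingSolver commutativeRing
  open import Relation.Binary.Reasoning.Setoid setoid

  X : Carrier
  X = Uniformizer.element x

  coord : F.Carrier → F.Carrier → Carrier
  coord r s = ι r + ι s * X

  coord-cong : ∀ {r r′ s s′} → r F.≈ r′ → s F.≈ s′ → coord r s ≈ coord r′ s′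
  coord-cong p q = +-cong (ι-cong p) (*-congʳ (ι-cong q))

  coord-+ : ∀ r s r′ s′ → coord r s + coord r′ s′ ≈ coord (r F.+ r′) (s F.+ s′)
  coord-+ r s r′ s′ = begin
    coord r s + coord r′ s′             ≈⟨ solve 5
      (λ r s r′ s′ X → (r :+ s :* X) :+ (r′ :+ s′ :* X) := (r :+ r′) :+ (s :+ s′) :* X) refl (ι r) (ι s) (ι r′) (ι s′)
      X ⟩
    (ι r + ι r′) + (ι s + ι s′) * X     ≈⟨ +-cong (+-homo r r′) (*-congʳ (+-homo s s′)) ⟨
    coord (r F.+ r′) (s F.+ s′)         ∎

  ι*coord : ∀ t r s → ι t * coord r s ≈ coord (t F.* r) (t F.* s)
  ι*coord t r s = begin
    ι t * coord r s                     ≈⟨ solve 4 (λ t r s X → t :* (r :+ s :* X) := t :* r :+ (t :* s) :* X) refl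
      (ι t) (ι r) (ι s) X ⟩
    ι t * ι r + (ι t * ι s) * X         ≈⟨ +-cong (*-homo t r) (*-congʳ (*-homo t s)) ⟨
    coord (t F.* r) (t F.* s)           ∎

  coord-neg : ∀ r s → - coord r s ≈ coord (F.- r) (F.- s)
  coord-neg r s = begin
    - coord r s             ≈⟨ solve 3 (λ r s X → :- (r :+ s :* X) := (:- r) :+ (:- s) :* X) refl (ι r) (ι s) X ⟩
    - ι r + (- ι s) * X     ≈⟨ +-cong (-‿homo r) (*-congʳ (-‿homo s)) ⟨
    coord (F.- r) (F.- s)   ∎

  coord-- : ∀ r s r′ s′ → coord r s - coord r′ s′ ≈ coord (r F.- r′) (s F.- s′)
  coord-- r s r′ s′ = trans (+-congˡ (coord-neg r′ s′)) (coord-+ r s (F.- r′) (F.- s′))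

  coord-ι : ∀ r → coord r F.0# ≈ ι r
  coord-ι r = trans (+-congˡ (trans (*-congʳ 0#-homo) (zeroˡ X))) (+-identityʳ (ι r))

  coord-ι*X : ∀ s → coord F.0# s ≈ ι s * X
  coord-ι*X s = trans (+-congʳ 0#-homo) (+-identityˡ _)

  private
    ord-ι⁻ : ∀ {r k} → ord (ι r) ≡ [ k ] → ∃ λ i → F.ord r ≡ [ i ] × k ≡ + e ℤ.* i
    ord-ι⁻ {r} eq with F.ord r | ≡.trans (≡.sym eq) (ord-ι r)
    ... | [ i ] | eq′ = i , ≡.refl , []-injective eq′

    ord-ι*X⁻ : ∀ {s k} → ord (ι s * X) ≡ [ k ] → ∃ λ i → F.ord s ≡ [ i ] × k ≡ + e ℤ.* i ℤ.+ 1ℤ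
    ord-ι*X⁻ {s} eq with F.ord s | ≡.trans (≡.sym eq)
      (≡.trans (ord-* (ι s) X) (≡.cong₂ _+∞_ (ord-ι s) (Uniformizer.ord≡1 x)))
    ... | [ i ] | eq′ = i , ≡.refl , []-injective eq′

    e∤1 : ∀ i → ¬ (+ e ℤ.* i ≡ 1ℤ)
    e∤1 i eq = ℕ.<-irrefl (≡.sym (ℕ.m*n≡1⇒m≡1 e ℤ.∣ i ∣ (≡.trans (≡.sym (ℤ.abs-* (+ e) i)) (≡.cong ℤ.∣_∣ eq))))
      ramified

    ord-ι≢ord-ι*X : ∀ {r s k} → ord (ι r) ≡ [ k ] → ¬ (ord (ι s * X) ≡ [ k ])
    ord-ι≢ord-ι*X p q with ord-ι⁻ p | ord-ι*X⁻ q
    ... | i , _ , k≡ei | j , _ , k≡ej+1 = e∤1 (i ℤ.- j) (≡.trans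
      (ℤ-solve 3 (λ e i j → e ⊗ (i ⊖ j) ⊜ e ⊗ i ⊖ e ⊗ j) ≡.refl (+ e) i j)
      (≡.trans (≡.cong (ℤ._- (+ e ℤ.* j)) (≡.trans (≡.sym k≡ei) k≡ej+1))
        (ℤ-solve 2 (λ e j → e ⊗ j ⊕ κ 1ℤ ⊖ e ⊗ j ⊜ κ 1ℤ) ≡.refl (+ e) j)))

  -- The two summands have valuations in different classes modulo `e`, so the smaller one is the
  -- valuation of the sum and no cancellation can hide it.
  ≤ord-coord⁻ : ∀ {n} r s → n ≤ord coord r s → n ≤ord ι r × n ≤ord ι s * X
  ≤ord-coord⁻ {n} r s p with ≤ord-or-ord< n (ι r)
  ... | inj₁ q = q , ≤ord-resp (solve 2 (λ u v → (u :+ v) :- u := v) refl (ι r) (ι s * X)) (≤ord-- _ _ p q)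
  ... | inj₂ (k , k<n , eq) with ≤ord-or-ord< (k ℤ.+ 1ℤ) (ι s * X)
  ...   | inj₁ q = contradiction (ℤ.≤-trans k<n (≤ord⇒≤ (ord-+-strict eq q) p)) i+1≰i
  ...   | inj₂ (l , l<k+1 , eq′) with ≤-or-> k l
  ...     | inj₁ k≤l = contradiction (≡.trans eq′ (≡.cong [_] (ℤ.≤-antisym l≤k k≤l))) (ord-ι≢ord-ι*X eq)
    where
    l≤k : l ℤ.≤ k
    l≤k = lin₁ 0 l<k+1 (ℤ-solve 2 (λ l k → k ⊖ l ⊜ k ⊕ κ 1ℤ ⊖ (l ⊕ κ 1ℤ) ⊕ κ 0ℤ) ≡.refl l k)
  ...     | inj₂ l<k = contradiction
    (ℤ.≤-trans (lin₁ 1 l<k (ℤ-solve 2 (λ l k → k ⊕ κ 1ℤ ⊖ (l ⊕ κ 1ℤ) ⊜ k ⊖ (l ⊕ κ 1ℤ) ⊕ κ 1ℤ) ≡.refl l k))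
      (ℤ.≤-trans k<n (≤ord⇒≤ (ord-+-strict eq′ (≤⇒≤ord eq l<k)) (≤ord-resp (+-comm _ _) p)))) i+1≰i

  ι≈0 : ∀ {r} → ι r ≈ 0# → r F.≈ F.0#
  ι≈0 {r} ιr≈0 with VF.zero-or-ord r
  ... | inj₁ r≈0 = r≈0
  ... | inj₂ (k , eq) = contradiction ιr≈0 (ord-finite⇒≉0 (≡.trans (ord-ι r) (≡.cong (e *∞_) eq)))

  coord≈0 : ∀ {r s} → coord r s ≈ 0# → r F.≈ F.0# × s F.≈ F.0#
  coord≈0 {r} {s} eq = r≈0 , s≈0
    where
    r≈0 : r F.≈ F.0#
    r≈0 with zero-or-ord (ι r)
    ... | inj₁ ιr≈0 = ι≈0 ιr≈0
    ... | inj₂ (k , eq′) = contradiction (≤ord⇒≤ eq′ (proj₁ (≤ord-coord⁻ r s (≤ord-0 eq)))) i+1≰i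
    s≈0 : s F.≈ F.0#
    s≈0 = ι≈0 (≈0-cancel (ι s) (Uniformizer.ord≡1 x) (begin
      X * ι s      ≈⟨ *-comm X (ι s) ⟩
      ι s * X      ≈⟨ coord-ι*X s ⟨
      coord F.0# s ≈⟨ coord-cong (F.sym r≈0) F.refl ⟩
      coord r s    ≈⟨ eq ⟩
      0#           ∎))

  coord-injective : ∀ {r s r′ s′} → coord r s ≈ coord r′ s′ → r F.≈ r′ × s F.≈ s′
  coord-injective {r} {s} {r′} {s′} eq = x-y≈0 (proj₁ zeros) , x-y≈0 (proj₂ zeros)
    where
    open IntegerRingSolver F.commutativeRing renaming (solve to F-solve; _:+_ to _:+′_; _:-_ to _:-′_; _:=_ to _:=′_)
      using ()
    zeros = coord≈0 (trans (sym (coord-- r s r′ s′)) (trans (+-congʳ eq) (-‿inverseʳ _)))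
    x-y≈0 : ∀ {y z} → y F.- z F.≈ F.0# → y F.≈ z
    x-y≈0 {y} {z} p = F.trans (F-solve 2 (λ y z → y :=′ (y :-′ z) :+′ z) F.refl y z)
      (F.trans (F.+-congʳ p) (F.+-identityˡ z))

  -- 1 and X have valuations 0 and 1 modulo e, so they are independent, and
  -- the matrix expressing them in the given basis is invertible.
  private
    b₀ b₁ : Carrier
    b₀ = basis zero
    b₁ = basis (suc zero)

    abstract
      expand : ∀ y → ∃ λ r₀ → ∃ λ r₁ → y ≈ ι r₀ * b₀ + ι r₁ * b₁
      expand y with basis-spans y
      ... | r , eq = r zero , r (suc zero) , trans eq (+-congˡ (+-identityʳ _))

    α₀ α₁ β₀ β₁ D : F.Carrier
    α₀ = proj₁ (expand 1#)
    α₁ = proj₁ (proj₂ (expand 1#))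
    β₀ = proj₁ (expand X)
    β₁ = proj₁ (proj₂ (expand X))
    D = α₀ F.* β₁ F.- α₁ F.* β₀

    coord-expand : ∀ r s → coord r s ≈ ι r * (ι α₀ * b₀ + ι α₁ * b₁) + ι s * (ι β₀ * b₀ + ι β₁ * b₁)
    coord-expand r s = +-cong (trans (sym (*-identityʳ _)) (*-congˡ (proj₂ (proj₂ (expand 1#)))))
      (*-congˡ (proj₂ (proj₂ (expand X))))

    ιD : ι D ≈ ι α₀ * ι β₁ - ι α₁ * ι β₀
    ιD = trans (+-homo _ _) (+-cong (*-homo _ _) (trans (-‿homo _) (-‿cong (*-homo _ _))))

    -- Cramer's rule: eliminating `b₁` from the expansions of 1 and `X` leaves the determinant `D`
    -- in front of `b₀`.
    D*b₀ : coord β₁ (F.- α₁) ≈ ι D * b₀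
    D*b₀ = begin
      coord β₁ (F.- α₁)
        ≈⟨ coord-expand β₁ (F.- α₁) ⟩
      ι β₁ * (ι α₀ * b₀ + ι α₁ * b₁) + ι (F.- α₁) * (ι β₀ * b₀ + ι β₁ * b₁)
        ≈⟨ +-congˡ (*-congʳ (-‿homo α₁)) ⟩
      ι β₁ * (ι α₀ * b₀ + ι α₁ * b₁) + (- ι α₁) * (ι β₀ * b₀ + ι β₁ * b₁)
        ≈⟨ solve 6 (λ a₀ a₁ c₀ c₁ b₀ b₁ → c₁ :* (a₀ :* b₀ :+ a₁ :* b₁) :+ (:- a₁) :* (c₀ :* b₀ :+ c₁ :* b₁) :=
          (a₀ :* c₁ :- a₁ :* c₀) :* b₀) refl (ι α₀) (ι α₁) (ι β₀) (ι β₁) b₀ b₁ ⟩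
      (ι α₀ * ι β₁ - ι α₁ * ι β₀) * b₀
        ≈⟨ *-congʳ ιD ⟨
      ι D * b₀ ∎

    D*b₁ : coord (F.- β₀) α₀ ≈ ι D * b₁
    D*b₁ = begin
      coord (F.- β₀) α₀
        ≈⟨ coord-expand (F.- β₀) α₀ ⟩
      ι (F.- β₀) * (ι α₀ * b₀ + ι α₁ * b₁) + ι α₀ * (ι β₀ * b₀ + ι β₁ * b₁)
        ≈⟨ +-congʳ (*-congʳ (-‿homo β₀)) ⟩
      (- ι β₀) * (ι α₀ * b₀ + ι α₁ * b₁) + ι α₀ * (ι β₀ * b₀ + ι β₁ * b₁)
        ≈⟨ solve 6 (λ a₀ a₁ c₀ c₁ b₀ b₁ → (:- c₀) :* (a₀ :* b₀ :+ a₁ :* b₁) :+ a₀ :* (c₀ :* b₀ :+ c₁ :* b₁) :=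
          (a₀ :* c₁ :- a₁ :* c₀) :* b₁) refl (ι α₀) (ι α₁) (ι β₀) (ι β₁) b₀ b₁ ⟩
      (ι α₀ * ι β₁ - ι α₁ * ι β₀) * b₁
        ≈⟨ *-congʳ ιD ⟨
      ι D * b₁ ∎

    F-neg≈0 : ∀ {y} → F.- y F.≈ F.0# → y F.≈ F.0#
    F-neg≈0 {y} p = F.trans (F.sym (⁻¹-involutive y)) (F.trans (F.-‿cong p) ε⁻¹≈ε)
      where open import Algebra.Properties.AbelianGroup F.+-abelianGroup using (⁻¹-involutive; ε⁻¹≈ε)

    -- If `D` vanished, the two relations from Cramer's rule would be linear relations between 1 and
    -- `X`. Their independence makes `α₀` and `α₁` zero, and then the expansion of 1 gives 1 = 0.
    D≉0 : ¬ (D F.≈ F.0#)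
    D≉0 D≈0 = 1≉0 (begin
      1#                            ≈⟨ proj₂ (proj₂ (expand 1#)) ⟩
      ι α₀ * b₀ + ι α₁ * b₁         ≈⟨ +-cong (*-congʳ (ι-cong α₀≈0)) (*-congʳ (ι-cong α₁≈0)) ⟩
      ι F.0# * b₀ + ι F.0# * b₁     ≈⟨ +-cong (*-congʳ 0#-homo) (*-congʳ 0#-homo) ⟩
      0# * b₀ + 0# * b₁             ≈⟨ solve 2 (λ u v → con 0ℤ :* u :+ con 0ℤ :* v := con 0ℤ) refl b₀ b₁ ⟩
      0#                            ∎)
      where
      ιD*≈0 : ∀ b → ι D * b ≈ 0#
      ιD*≈0 b = trans (*-congʳ (trans (ι-cong D≈0) 0#-homo)) (zeroˡ b)
      α₁≈0 = F-neg≈0 (proj₂ (coord≈0 (trans D*b₀ (ιD*≈0 b₀))))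
      α₀≈0 = proj₂ (coord≈0 (trans D*b₁ (ιD*≈0 b₁)))

  abstract
    coordinates : ∀ y → ∃ λ r → ∃ λ s → y ≈ coord r s
    coordinates y = D⁻¹ F.* r , D⁻¹ F.* s , (begin
      y                                        ≈⟨ proj₂ (proj₂ (expand y)) ⟩
      ι r₀ * b₀ + ι r₁ * b₁                    ≈⟨ *-identityˡ _ ⟨
      1# * (ι r₀ * b₀ + ι r₁ * b₁)             ≈⟨ *-congʳ ιD⁻¹*ιD≈1 ⟨
      (ι D⁻¹ * ι D) * (ι r₀ * b₀ + ι r₁ * b₁)  ≈⟨ *-assoc _ _ _ ⟩
      ι D⁻¹ * (ι D * (ι r₀ * b₀ + ι r₁ * b₁))  ≈⟨ *-congˡ ιD*y ⟩
      ι D⁻¹ * coord r s                        ≈⟨ ι*coord D⁻¹ r s ⟩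
      coord (D⁻¹ F.* r) (D⁻¹ F.* s)            ∎)
      where
      r₀ r₁ D⁻¹ r s : F.Carrier
      r₀ = proj₁ (expand y)
      r₁ = proj₁ (proj₂ (expand y))
      D⁻¹ = proj₁ (F.inverse D D≉0)
      r = r₀ F.* β₁ F.+ r₁ F.* (F.- β₀)
      s = r₀ F.* (F.- α₁) F.+ r₁ F.* α₀
      ιD⁻¹*ιD≈1 : ι D⁻¹ * ι D ≈ 1#
      ιD⁻¹*ιD≈1 = trans (sym (*-homo D⁻¹ D))
        (trans (ι-cong (F.trans (F.*-comm D⁻¹ D) (proj₂ (F.inverse D D≉0)))) 1#-homo)
      ιD*y : ι D * (ι r₀ * b₀ + ι r₁ * b₁) ≈ coord r s
      ιD*y = begin
        ι D * (ι r₀ * b₀ + ι r₁ * b₁)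
          ≈⟨ solve 5 (λ d r₀ r₁ b₀ b₁ → d :* (r₀ :* b₀ :+ r₁ :* b₁) := r₀ :* (d :* b₀) :+ r₁ :* (d :* b₁)) refl (ι D)
            (ι r₀) (ι r₁) b₀ b₁ ⟩
        ι r₀ * (ι D * b₀) + ι r₁ * (ι D * b₁)
          ≈⟨ +-cong (*-congˡ D*b₀) (*-congˡ D*b₁) ⟨
        ι r₀ * coord β₁ (F.- α₁) + ι r₁ * coord (F.- β₀) α₀
          ≈⟨ +-cong (ι*coord r₀ β₁ (F.- α₁)) (ι*coord r₁ (F.- β₀) α₀) ⟩
        coord (r₀ F.* β₁) (r₀ F.* (F.- α₁)) + coord (r₁ F.* (F.- β₀)) (r₁ F.* α₀)
          ≈⟨ coord-+ _ _ _ _ ⟩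
        coord r s ∎

  re im : Carrier → F.Carrier
  re y = proj₁ (coordinates y)
  im y = proj₁ (proj₂ (coordinates y))

  coord-re-im : ∀ y → y ≈ coord (re y) (im y)
  coord-re-im y = proj₂ (proj₂ (coordinates y))

  re-im-unique : ∀ {y r s} → y ≈ coord r s → re y F.≈ r × im y F.≈ s
  re-im-unique {y} eq = coord-injective (trans (sym (coord-re-im y)) eq)

  -- X² = p + q X is an Eisenstein equation.
  p q : F.Carrier
  p = re (X * X)
  q = im (X * X)

  coord-* : ∀ r s r′ s′ → coord r s * coord r′ s′ ≈
            coord (r F.* r′ F.+ s F.* s′ F.* p) (r F.* s′ F.+ s F.* r′ F.+ s F.* s′ F.* q)
  coord-* r s r′ s′ = begin
    coord r s * coord r′ s′
      ≈⟨ solve 5 (λ r s r′ s′ X → (r :+ s :* X) :* (r′ :+ s′ :* X) := (r :* r′ :+ (r :* s′ :+ s :* r′) :* X) :+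
        (s :* s′) :* (X :* X)) refl (ι r) (ι s) (ι r′) (ι s′) X ⟩
    (ι r * ι r′ + (ι r * ι s′ + ι s * ι r′) * X) + (ι s * ι s′) * (X * X)
      ≈⟨ +-cong (+-cong (*-homo r r′) (*-congʳ (trans (+-homo _ _) (+-cong (*-homo r s′) (*-homo s r′)))))
        (*-cong (*-homo s s′) (sym (coord-re-im (X * X)))) ⟨
    coord (r F.* r′) (r F.* s′ F.+ s F.* r′) + ι (s F.* s′) * coord p q
      ≈⟨ +-congˡ (ι*coord _ p q) ⟩
    coord (r F.* r′) (r F.* s′ F.+ s F.* r′) + coord (s F.* s′ F.* p) (s F.* s′ F.* q)
      ≈⟨ coord-+ _ _ _ _ ⟩
    coord (r F.* r′ F.+ s F.* s′ F.* p) (r F.* s′ F.+ s F.* r′ F.+ s F.* s′ F.* q) ∎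

  private
    ord-X² : ord (X * X) ≡ [ + 2 ]
    ord-X² = ord-*-finite (Uniformizer.ord≡1 x) (Uniformizer.ord≡1 x)

    2≤ord-p,qX : + 2 ≤ord ι p × + 2 ≤ord ι q * X
    2≤ord-p,qX = ≤ord-coord⁻ p q (≤ord-resp (coord-re-im (X * X)) (ord≡⇒≤ord ord-X²))

    -- A finite valuation of `ι q * X` is 1 modulo `e`, which 2 is not since `e` exceeds 1. So only
    -- `ι p` can account for the valuation 2 of `X * X`.
    ord-ιp : ord (ι p) ≡ [ + 2 ]
    ord-ιp = ord-≡ (proj₁ 2≤ord-p,qX) (λ 3≤ → go 3≤)
      where
      go : ¬ (+ 3 ≤ord ι p)
      go 3≤ιp with ≤ord-or-ord< (+ 3) (ι q * X)
      ... | inj₁ 3≤qX = i+1≰i (≤ord⇒≤ ord-X² (≤ord-resp (sym (coord-re-im (X * X))) (≤ord-+ _ _ 3≤ιp 3≤qX)))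
      ... | inj₂ (k , k<3 , eq) with ord-ι*X⁻ eq
      ...   | i , _ , k≡ = e∤1 i (≡.trans (ℤ-solve 2 (λ e i → e ⊗ i ⊜ e ⊗ i ⊕ κ 1ℤ ⊖ κ 1ℤ) ≡.refl (+ e) i)
                                          (≡.cong (ℤ._- 1ℤ) (≡.trans (≡.sym k≡) k≡2)))
        where
        k≡2 : k ≡ + 2
        k≡2 = ℤ.≤-antisym (lin₁ 0 k<3 (ℤ-solve 1 (λ k → κ (+ 2) ⊖ k ⊜ κ (+ 3) ⊖ (k ⊕ κ 1ℤ) ⊕ κ 0ℤ) ≡.refl k))
          (≤ord⇒≤ eq (proj₂ 2≤ord-p,qX))

  -- `e` divides the valuation of every nonzero `ι r`, in particular the valuation 2 of `ι p`.
  e≡2 : e ≡ 2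
  e≡2 with ord-ι⁻ ord-ιp
  ... | i , _ , 2≡ = ℕ.≤-antisym (ℕ.∣⇒≤
      (ℕ.divides ℤ.∣ i ∣ (≡.trans (≡.cong ℤ.∣_∣ 2≡) (≡.trans (ℤ.abs-* (+ e) i) (ℕ.*-comm e ℤ.∣ i ∣))))) ramified

  ord-ι-finite : ∀ {r k} → F.ord r ≡ [ k ] → ord (ι r) ≡ [ k ℤ.+ k ]
  ord-ι-finite {r} {k} eq = ≡.trans (ord-ι r) (≡.trans (≡.cong₂ _*∞_ e≡2 eq) (≡.cong [_] (2*≡+ k)))

  ord-ι*X-finite : ∀ {s k} → F.ord s ≡ [ k ] → ord (ι s * X) ≡ [ k ℤ.+ k ℤ.+ 1ℤ ]
  ord-ι*X-finite eq = ord-*-finite (ord-ι-finite eq) (Uniformizer.ord≡1 x)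

  1≤ord-p : 1ℤ VF.≤ord p
  1≤ord-p with VF.≤ord-or-ord< 1ℤ p
  ... | inj₁ 1≤p = 1≤p
  ... | inj₂ (k , k<1 , eq) = VF.≤⇒≤ord eq
      (halve (lin₁ 1 (≤ord⇒≤ (ord-ι-finite eq) (ord≡⇒≤ord ord-ιp))
      (ℤ-solve 1 (λ k → k ⊕ k ⊕ κ 1ℤ ⊖ κ (+ 2) ⊜ k ⊕ k ⊖ κ (+ 2) ⊕ κ 1ℤ) ≡.refl k)))

  ord-p : F.ord p ≡ [ 1ℤ ]
  ord-p = VF.ord-≡ 1≤ord-p go
    where
    go : ¬ (+ 2 VF.≤ord p)
    go 2≤p with VF.zero-or-ord p
    ... | inj₁ p≈0 = ord-finite⇒≉0 ord-ιp (trans (ι-cong p≈0) 0#-homo)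
    ... | inj₂ (k , eq) with ℤ.≤-trans (double-≤ (VF.≤ord⇒≤ eq 2≤p)) (≤ord⇒≤ ord-ιp (ord≡⇒≤ord (ord-ι-finite eq)))
    ...   | ℤ.+≤+ (ℕ.s≤s (ℕ.s≤s ()))

  1≤ord-q : 1ℤ VF.≤ord q
  1≤ord-q with VF.zero-or-ord q
  ... | inj₁ q≈0 = VF.≤ord-0 q≈0
  ... | inj₂ (k , eq) = VF.≤⇒≤ord eq (halve (≤ord⇒≤ (ord-ι*X-finite eq) (proj₂ 2≤ord-p,qX)))

  -- The bounds are conditional on a finite valuation, so that a zero coordinate imposes none.
  ≤ord-coord : ∀ {n r s} → n ≤ord coord r s ⇔
    ((∀ k → F.ord r ≡ [ k ] → n ℤ.≤ k ℤ.+ k) × (∀ k → F.ord s ≡ [ k ] → n ℤ.≤ k ℤ.+ k ℤ.+ 1ℤ))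
  ≤ord-coord {n} {r} {s} = mk⇔
    (λ p → (λ k eq → ≤ord⇒≤ (ord-ι-finite eq) (proj₁ (≤ord-coord⁻ r s p))) ,
           (λ k eq → ≤ord⇒≤ (ord-ι*X-finite eq) (proj₂ (≤ord-coord⁻ r s p))))
    (λ (f , g) → ≤ord-+ _ _ (n≤ιr f) (n≤ιsX g))
    where
    n≤ιr : (∀ k → F.ord r ≡ [ k ] → n ℤ.≤ k ℤ.+ k) → n ≤ord ι r
    n≤ιr f with VF.zero-or-ord r
    ... | inj₁ r≈0 = ≤ord-0 (trans (ι-cong r≈0) 0#-homo)
    ... | inj₂ (k , eq) = ≤⇒≤ord (ord-ι-finite eq) (f k eq)
    n≤ιsX : (∀ k → F.ord s ≡ [ k ] → n ℤ.≤ k ℤ.+ k ℤ.+ 1ℤ) → n ≤ord ι s * X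
    n≤ιsX g with VF.zero-or-ord s
    ... | inj₁ s≈0 = ≤ord-0 (trans (*-congʳ (trans (ι-cong s≈0) 0#-homo)) (zeroˡ X))
    ... | inj₂ (k , eq) = ≤⇒≤ord (ord-ι*X-finite eq) (g k eq)


  coord-integral⇒ : ∀ {r s} → 0ℤ VF.≤ord r → 0ℤ VF.≤ord s → 0ℤ ≤ord coord r s
  coord-integral⇒ 0≤r 0≤s = Equivalence.from ≤ord-coord
    ((λ k eq → ℤ.+-mono-≤ (VF.≤ord⇒≤ eq 0≤r) (VF.≤ord⇒≤ eq 0≤r)) ,
     (λ k eq → ℤ.+-mono-≤ (ℤ.+-mono-≤ (VF.≤ord⇒≤ eq 0≤s) (VF.≤ord⇒≤ eq 0≤s)) (ℤ.+≤+ (ℕ.z≤n {1}))))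

  ≤ord-∀ : ∀ {n y} → (∀ k → F.ord y ≡ [ k ] → n ℤ.≤ k) → n VF.≤ord y
  ≤ord-∀ {n} {y} f with VF.zero-or-ord y
  ... | inj₁ y≈0 = VF.≤ord-0 y≈0
  ... | inj₂ (k , eq) = VF.≤⇒≤ord eq (f k eq)

  coord-integral⇐ : ∀ {r s} → 0ℤ ≤ord coord r s → 0ℤ VF.≤ord r × 0ℤ VF.≤ord s
  coord-integral⇐ p = let (f , g) = Equivalence.to ≤ord-coord p in
    ≤ord-∀ (λ k eq → halve {0ℤ} {k} (ℤ.≤-trans (f k eq) (ℤ.i≤i+j (k ℤ.+ k) 1ℤ))) ,
    ≤ord-∀ (λ k eq → halve {0ℤ} {k} (g k eq))

  re-im-integral : ∀ {y} → 0ℤ ≤ord y → 0ℤ VF.≤ord re y × 0ℤ VF.≤ord im y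
  re-im-integral {y} p = coord-integral⇐ (≤ord-resp (coord-re-im y) p)

-- Linear functionals on E and finitely generated modules

module Lattices {c ℓ} (F₀ : LocalField c ℓ) (E₀ : RamifiedQuadraticExtension F₀)
                (π : LocalField.Uniformizer F₀) (x : RamifiedQuadraticExtension.Uniformizer E₀) where

  open Orders F₀ E₀
  open CommutativeRing E hiding (zero)
  open Sum +-commutativeMonoid using (sum; sum-cong-≋; ∑-distrib-+; sum-replicate-zero)
  open SemiringSum semiring using (*-distribˡ-sum)
  open Valuation F.discretelyValuedField
  open Coordinates F₀ E₀ x
  open IntegerRingSolver F.commutativeRing using () renaming
    (solve to F-solve; _:+_ to _:+′_; _:-_ to _:-′_; _:*_ to _:*′_; :-_ to :-′_; _:=_ to _:=′_; con to con′)
  open IntegerRingSolver E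

  infixl 8 _⋆_
  _⋆_ : F.Carrier → Carrier → Carrier
  t ⋆ y = Δ t * y

  private module ιH = IsRingHomomorphism E′.ι-isHom

  Δ-cong : ∀ {r s} → r F.≈ s → Δ r ≈ Δ s
  Δ-cong p = p , ιH.⟦⟧-cong p

  Δ-+ : ∀ r s → Δ (r F.+ s) ≈ Δ r + Δ s
  Δ-+ r s = F.refl , ιH.+-homo r s

  Δ-* : ∀ r s → Δ (r F.* s) ≈ Δ r * Δ s
  Δ-* r s = F.refl , ιH.*-homo r s

  Δ-neg : ∀ r → Δ (F.- r) ≈ - Δ r
  Δ-neg r = F.refl , ιH.-‿homo r

  Δ-0 : Δ F.0# ≈ 0#
  Δ-0 = F.refl , ιH.0#-homo

  Δ-1 : Δ F.1# ≈ 1#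
  Δ-1 = F.refl , ιH.1#-homo

  record Functional : Set (c ⊔ ℓ) where
    infix 8 _⟨$⟩_
    field
      _⟨$⟩_  : Carrier → F.Carrier
      ⟨$⟩-cong : ∀ {y z} → y ≈ z → _⟨$⟩_ y F.≈ _⟨$⟩_ z
      ⟨$⟩-+  : ∀ y z → _⟨$⟩_ (y + z) F.≈ _⟨$⟩_ y F.+ _⟨$⟩_ z
      ⟨$⟩-⋆  : ∀ t y → _⟨$⟩_ (t ⋆ y) F.≈ t F.* _⟨$⟩_ y

    ⟨$⟩-neg : ∀ y → _⟨$⟩_ (- y) F.≈ F.- _⟨$⟩_ y
    ⟨$⟩-neg y = F.trans (⟨$⟩-cong -y≈)
      (F.trans (⟨$⟩-⋆ (F.- F.1#) y) (F-solve 1 (λ y → (:-′ con′ 1ℤ) :*′ y :=′ :-′ y) F.refl (_⟨$⟩_ y)))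
      where
      -y≈ : - y ≈ (F.- F.1#) ⋆ y
      -y≈ = trans (solve 1 (λ y → :- y := (:- con 1ℤ) :* y) refl y) (*-congʳ (sym (trans (Δ-neg F.1#) (-‿cong Δ-1))))

    ⟨$⟩-- : ∀ y z → _⟨$⟩_ (y - z) F.≈ _⟨$⟩_ y F.- _⟨$⟩_ z
    ⟨$⟩-- y z = F.trans (⟨$⟩-+ y (- z)) (F.+-congˡ (⟨$⟩-neg z))

    ⟨$⟩-0 : _⟨$⟩_ 0# F.≈ F.0#
    ⟨$⟩-0 = F.trans (⟨$⟩-cong (sym (zeroʳ (Δ F.0#)))) (F.trans (⟨$⟩-⋆ F.0# 0#) (F.zeroˡ _))

    ≤ord-sum : ∀ {k n} (f : Fin n → Carrier) → (∀ i → k ≤ord (_⟨$⟩_ (f i))) → k ≤ord (_⟨$⟩_ (sum f))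
    ≤ord-sum {n = zero}  f p = ≤ord-0 ⟨$⟩-0
    ≤ord-sum {n = suc n} f p = ≤ord-resp (F.sym (⟨$⟩-+ _ _)) (≤ord-+ _ _ (p zero) (≤ord-sum (f ∘ suc) (p ∘ suc)))

    sum≈0 : ∀ {n} (f : Fin n → Carrier) → (∀ i → _⟨$⟩_ (f i) F.≈ F.0#) → _⟨$⟩_ (sum f) F.≈ F.0#
    sum≈0 f p = ≤ord-all⇒≈0 λ k → ≤ord-sum f (≤ord-0 ∘ p)

  open Functional public using (_⟨$⟩_)
  open Functional hiding (_⟨$⟩_)

  precompose : (φ : Functional) (f : Carrier → Carrier) → (∀ {y z} → y ≈ z → f y ≈ f z) →
               (∀ y z → f (y + z) ≈ f y + f z) → (∀ t y → f (t ⋆ y) ≈ t ⋆ f y) → Functional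
  precompose φ f f-cong f-+ f-⋆ = record
    { _⟨$⟩_    = λ y → φ ⟨$⟩ f y
    ; ⟨$⟩-cong = λ p → ⟨$⟩-cong φ (f-cong p)
    ; ⟨$⟩-+    = λ y z → F.trans (⟨$⟩-cong φ (f-+ y z)) (⟨$⟩-+ φ (f y) (f z))
    ; ⟨$⟩-⋆    = λ t y → F.trans (⟨$⟩-cong φ (f-⋆ t y)) (⟨$⟩-⋆ φ t (f y))
    }

  infixl 8 _∘*_ _*∘_
  _∘*_ : Functional → Carrier → Functional
  φ ∘* z = precompose φ (_* z) *-congʳ (λ y y′ → distribʳ z y y′) (λ t y → *-assoc (Δ t) y z)

  _*∘_ : F.Carrier → Functional → Functional
  t *∘ φ = record
    { _⟨$⟩_    = λ y → t F.* φ ⟨$⟩ y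
    ; ⟨$⟩-cong = λ p → F.*-congˡ (⟨$⟩-cong φ p)
    ; ⟨$⟩-+    = λ y z → F.trans (F.*-congˡ (⟨$⟩-+ φ y z)) (F.distribˡ t _ _)
    ; ⟨$⟩-⋆    = λ s y → F.trans (F.*-congˡ (⟨$⟩-⋆ φ s y))
      (F-solve 3 (λ t s y → t :*′ (s :*′ y) :=′ s :*′ (t :*′ y)) F.refl t s (φ ⟨$⟩ y))
    }

  infixl 6 _⟨-⟩_
  _⟨-⟩_ : Functional → Functional → Functional
  φ ⟨-⟩ χ = record
    { _⟨$⟩_    = λ y → φ ⟨$⟩ y F.- χ ⟨$⟩ y
    ; ⟨$⟩-cong = λ p → F.+-cong (⟨$⟩-cong φ p) (F.-‿cong (⟨$⟩-cong χ p))
    ; ⟨$⟩-+    = λ y z → F.trans (F.+-cong (⟨$⟩-+ φ y z) (F.-‿cong (⟨$⟩-+ χ y z)))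
                   (F-solve 4 (λ a b c d → (a :+′ b) :-′ (c :+′ d) :=′ (a :-′ c) :+′ (b :-′ d)) F.refl (φ ⟨$⟩ y)
                     (φ ⟨$⟩ z) (χ ⟨$⟩ y) (χ ⟨$⟩ z))
    ; ⟨$⟩-⋆    = λ t y → F.trans (F.+-cong (⟨$⟩-⋆ φ t y) (F.-‿cong (⟨$⟩-⋆ χ t y)))
                   (F-solve 3 (λ t a b → t :*′ a :-′ t :*′ b :=′ t :*′ (a :-′ b)) F.refl t (φ ⟨$⟩ y) (χ ⟨$⟩ y))
    }

  fst-functional re-functional im-functional : Functional
  fst-functional = record { _⟨$⟩_ = proj₁ ; ⟨$⟩-cong = proj₁ ; ⟨$⟩-+ = λ y z → F.refl ; ⟨$⟩-⋆ = λ t y → F.refl }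
  re-functional = record
    { _⟨$⟩_    = re ∘ proj₂
    ; ⟨$⟩-cong = λ {y} {z} p → proj₁ (re-im-unique (E′.trans (proj₂ p) (coord-re-im (proj₂ z))))
    ; ⟨$⟩-+    = λ y z → proj₁ (re-im-unique
      (E′.trans (E′.+-cong (coord-re-im (proj₂ y)) (coord-re-im (proj₂ z))) (coord-+ _ _ _ _)))
    ; ⟨$⟩-⋆    = λ t y → proj₁ (re-im-unique (E′.trans (E′.*-congˡ (coord-re-im (proj₂ y))) (ι*coord t _ _)))
    }
  im-functional = record
    { _⟨$⟩_    = im ∘ proj₂
    ; ⟨$⟩-cong = λ {y} {z} p → proj₂ (re-im-unique (E′.trans (proj₂ p) (coord-re-im (proj₂ z))))
    ; ⟨$⟩-+    = λ y z → proj₂ (re-im-unique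
      (E′.trans (E′.+-cong (coord-re-im (proj₂ y)) (coord-re-im (proj₂ z))) (coord-+ _ _ _ _)))
    ; ⟨$⟩-⋆    = λ t y → proj₂ (re-im-unique (E′.trans (E′.*-congˡ (coord-re-im (proj₂ y))) (ι*coord t _ _)))
    }

  -- Generation is recorded by its effect on functionals rather than by coefficients. Nothing more
  -- is needed to find a pivot, and the property is easy to transport along products.
  Generators : Subset → Set (c ⊔ ℓ)
  Generators M = ∃ λ n → ∃ λ (g : Fin n → Carrier) → (∀ i → g i ∈ M) ×
    (∀ φ k → (∀ i → k ≤ord (φ ⟨$⟩ g i)) → ∀ {y} → y ∈ M → k ≤ord (φ ⟨$⟩ y))

  -- The dual form of F M = E. It guarantees that a nonzero functional cannot vanish at all
  -- generators, hence that a pivot exists.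
  Full : Subset → Set (c ⊔ ℓ)
  Full M = ∀ φ → (∀ {y} → y ∈ M → φ ⟨$⟩ y F.≈ F.0#) → ∀ y → φ ⟨$⟩ y F.≈ F.0#

  module _ {R M : Subset} (isSubmodule : IsSubmodule R M) where
    open IsSubmodule isSubmodule

    sum-closed : ∀ {n} (f : Fin n → Carrier) → (∀ i → f i ∈ M) → sum f ∈ M
    sum-closed {zero}  f p = 0∈
    sum-closed {suc n} f p = +-closed (p zero) (sum-closed (f ∘ suc) (p ∘ suc))

    span⊆ : ∀ {n} (g : Fin n → Carrier) → (∀ i → g i ∈ M) → Span R g ⊆ M
    span⊆ g g∈M (r , r∈R , y≈) = resp (sym y≈) (sum-closed _ (λ i → *-closed (r∈R i) (g∈M i)))

    restrict : Δ𝒪 ⊆ R → IsSubmodule Δ𝒪 M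
    restrict Δ𝒪⊆R = record { resp = resp ; 0∈ = 0∈ ; +-closed = +-closed ; *-closed = λ r∈ → *-closed (Δ𝒪⊆R r∈) }

  module _ {M : Subset} (isSubmodule : IsSubmodule Δ𝒪 M) where
    open IsSubmodule isSubmodule

    ⋆-closed : ∀ {t y} → 0ℤ ≤ord t → y ∈ M → t ⋆ y ∈ M
    ⋆-closed {t} p = *-closed (t , p , refl)

    neg-closed : ∀ {y} → y ∈ M → - y ∈ M
    neg-closed {y} y∈M = resp (trans (*-congʳ (trans (Δ-neg F.1#) (-‿cong Δ-1)))
      (solve 1 (λ y → (:- con 1ℤ) :* y := :- y) refl y))
                              (⋆-closed ≤ord--1 y∈M)

    ∸-closed : ∀ {y z} → y ∈ M → z ∈ M → y - z ∈ M
    ∸-closed y∈M z∈M = +-closed y∈M (neg-closed z∈M)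

  1∈Δ𝒪 : 1# ∈ Δ𝒪
  1∈Δ𝒪 = F.1# , ≤ord-1 , sym Δ-1

  0∈Δ𝒪 : 0# ∈ Δ𝒪
  0∈Δ𝒪 = F.0# , ≤ord-0 F.refl , sym Δ-0

  generator∈span : ∀ (R : Subset) → 1# ∈ R → 0# ∈ R → ∀ {n} (g : Fin n → Carrier) i → g i ∈ Span R g
  generator∈span R 1∈R 0∈R g i = δ i , δ∈ i , δ-sum g i
    where
    δ : ∀ {n} → Fin n → Fin n → Carrier
    δ zero    zero    = 1#
    δ zero    (suc j) = 0#
    δ (suc i) zero    = 0#
    δ (suc i) (suc j) = δ i j
    δ∈ : ∀ {n} (i j : Fin n) → δ i j ∈ R
    δ∈ zero    zero    = 1∈R
    δ∈ zero    (suc j) = 0∈R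
    δ∈ (suc i) zero    = 0∈R
    δ∈ (suc i) (suc j) = δ∈ i j
    0-sum : ∀ {n} (g : Fin n → Carrier) → sum (λ i → 0# * g i) ≈ 0#
    0-sum {zero}  g = refl
    0-sum {suc n} g = trans (+-cong (zeroˡ _) (0-sum (g ∘ suc))) (+-identityˡ 0#)
    δ-sum : ∀ {n} (g : Fin n → Carrier) i → g i ≈ sum (λ j → δ i j * g j)
    δ-sum g zero    = sym (trans (+-cong (*-identityˡ _) (0-sum (g ∘ suc))) (+-identityʳ _))
    δ-sum g (suc i) = trans (δ-sum (g ∘ suc) i) (sym (trans (+-congʳ (zeroˡ _)) (+-identityˡ _)))

  span-isSubmodule : ∀ {k} (g : Fin k → Carrier) → IsSubmodule Δ𝒪 (Span Δ𝒪 g)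
  span-isSubmodule {k} g = record
    { resp     = λ { y≈z (r , r∈ , y≈) → r , r∈ , trans (sym y≈z) y≈ }
    ; 0∈       = (λ _ → 0#) , (λ _ → 0∈Δ𝒪) , sym (trans (sum-cong-≋ (λ i → zeroˡ (g i))) (sum-replicate-zero k))
    ; +-closed = λ { (r , r∈ , y≈) (s , s∈ , z≈) → (λ i → r i + s i) ,
        (λ i → let (t , t∈ , r≈) = r∈ i ; (u , u∈ , s≈) = s∈ i in t F.+ u , ≤ord-+ t u t∈ u∈ , trans (+-cong r≈ s≈)
          (sym (Δ-+ t u))) ,
        trans (+-cong y≈ z≈) (trans (sym (∑-distrib-+ (λ i → r i * g i) (λ i → s i * g i)))
          (sum-cong-≋ (λ i → sym (distribʳ (g i) (r i) (s i))))) }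
    ; *-closed = λ { {t} (u , u∈ , t≈) (r , r∈ , y≈) → (λ i → t * r i) ,
        (λ i → let (v , v∈ , r≈) = r∈ i in u F.* v , ≤ord-*-integral u v u∈ v∈ , trans (*-cong t≈ r≈) (sym (Δ-* u v)))
          ,
        trans (*-congˡ y≈) (trans (*-distribˡ-sum t (λ i → r i * g i))
          (sum-cong-≋ (λ i → sym (*-assoc t (r i) (g i))))) }
    }

  finitelyGenerated⇒generators : ∀ {M} → FinitelyGenerated Δ𝒪 M → IsSubmodule Δ𝒪 M → Generators M
  finitelyGenerated⇒generators (n , g , M⊆ , ⊆M) isSubmodule = n , g ,
    (λ i → ⊆M (generator∈span Δ𝒪 1∈Δ𝒪 0∈Δ𝒪 g i)) ,
    λ φ k k≤φg y∈M → let (r , r∈ , y≈) = M⊆ y∈M in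
      ≤ord-resp (⟨$⟩-cong φ (sym y≈)) (≤ord-sum φ _ (λ i → let (t , t∈ , r≈) = r∈ i in
        ≤ord-resp (F.sym (F.trans (⟨$⟩-cong φ (*-congʳ r≈)) (⟨$⟩-⋆ φ t (g i)))) (≤ord-*-integral t _ t∈ (k≤φg i))))
  spanning⇒full : ∀ {M} → (∀ y → y ∈ ΔF · M) → Full M
  spanning⇒full all φ φM≈0 y = let (n , p , q , p∈ , q∈ , y≈) = all y in
    F.trans (⟨$⟩-cong φ y≈) (sum≈0 φ _ (λ i → let (t , p≈) = p∈ i in
      F.trans (⟨$⟩-cong φ (*-congʳ p≈)) (F.trans (⟨$⟩-⋆ φ t (q i)) (F.trans (F.*-congˡ (φM≈0 (q∈ i))) (F.zeroʳ t)))))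

  *∈· : ∀ (P Q : Subset) {y z} → y ∈ P → z ∈ Q → y * z ∈ P · Q
  *∈· P Q {y} {z} y∈P z∈Q = 1 , (λ _ → y) , (λ _ → z) , (λ _ → y∈P) , (λ _ → z∈Q) , sym (+-identityʳ _)

  -- The products of the two generating families work. For fixed `g j` the map `y ↦ φ (y * g j)` is
  -- again a functional, so a bound at the products `e i * g j` extends to `y * g j` for all `y` in
  -- `R`.
  generators-extend : ∀ {R M} → Generators R → IsSubmodule R M → FinitelyGenerated R M → 1# ∈ R → 0# ∈ R → Generators
    M
  generators-extend {R} {M} (m , e , e∈R , genR) isSubmodule (n , g , M⊆ , ⊆M) 1∈R 0∈R =
    m ℕ.* n , (λ k → uncurry eg (remQuot n k)) ,
      (λ k → IsSubmodule.*-closed isSubmodule (e∈R _) (⊆M (generator∈span R 1∈R 0∈R g _))) ,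
    λ φ k k≤ y∈M → let (r , r∈ , y≈) = M⊆ y∈M in
      ≤ord-resp (⟨$⟩-cong φ (sym y≈)) (≤ord-sum φ _ (λ j →
        genR (φ ∘* g j) k (λ i → ≤ord-resp (⟨$⟩-cong φ (reflexive (≡.cong (uncurry eg) (Fin.remQuot-combine i j))))
          (k≤ (combine i j))) (r∈ j)))
    where
    eg : Fin m → Fin n → Carrier
    eg i j = e i * g j

-- Gaussian elimination with functionals

module Frames {c ℓ} (F₀ : LocalField c ℓ) (E₀ : RamifiedQuadraticExtension F₀)
              (π : LocalField.Uniformizer F₀) (x : RamifiedQuadraticExtension.Uniformizer E₀) where

  open Orders F₀ E₀
  open CommutativeRing E hiding (zero)
  open Sum +-commutativeMonoid using (sum; sum-cong-≋; ∑-distrib-+)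
  open SemiringSum semiring using (*-distribˡ-sum)
  open Valuation F.discretelyValuedField
  open Coordinates F₀ E₀ x
  open Lattices F₀ E₀ π x
  open Functional hiding (_⟨$⟩_)
  open IntegerRingSolver E

  comb : ∀ {n} → (Fin n → Functional) → (Fin n → Carrier) → Carrier → Carrier
  comb ψ w y = sum (λ i → (ψ i ⟨$⟩ y) ⋆ w i)

  comb-cong : ∀ {n} (ψ : Fin n → Functional) w {y z} → y ≈ z → comb ψ w y ≈ comb ψ w z
  comb-cong ψ w p = sum-cong-≋ (λ i → *-congʳ (Δ-cong (⟨$⟩-cong (ψ i) p)))

  comb-+ : ∀ {n} (ψ : Fin n → Functional) w y z → comb ψ w (y + z) ≈ comb ψ w y + comb ψ w z
  comb-+ ψ w y z = trans
    (sum-cong-≋ (λ i → trans (*-congʳ (trans (Δ-cong (⟨$⟩-+ (ψ i) y z)) (Δ-+ _ _))) (distribʳ (w i) _ _)))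
    (∑-distrib-+ (λ i → (ψ i ⟨$⟩ y) ⋆ w i) (λ i → (ψ i ⟨$⟩ z) ⋆ w i))

  comb-⋆ : ∀ {n} (ψ : Fin n → Functional) w t y → comb ψ w (t ⋆ y) ≈ t ⋆ comb ψ w y
  comb-⋆ ψ w t y = trans
    (sum-cong-≋ (λ i → trans (*-congʳ (trans (Δ-cong (⟨$⟩-⋆ (ψ i) t y)) (Δ-* _ _))) (*-assoc _ _ (w i))))
    (sym (*-distribˡ-sum (Δ t) (λ i → (ψ i ⟨$⟩ y) ⋆ w i)))

  comb∈ : ∀ {n} (ψ : Fin n → Functional) w {M : Subset} → IsSubmodule Δ𝒪 M → (∀ i → w i ∈ M) →
          ∀ {y} → (∀ i → 0ℤ ≤ord (ψ i ⟨$⟩ y)) → comb ψ w y ∈ M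
  comb∈ ψ w isSubmodule w∈M p = sum-closed isSubmodule _ (λ i → ⋆-closed isSubmodule (p i) (w∈M i))

  -- A frame need not be a basis: only the expansion of y is required.
  record Frame (M : Subset) {n} (w : Fin n → Carrier) (ψ : Fin n → Functional) : Set (c ⊔ ℓ) where
    field
      w∈M      : ∀ i → w i ∈ M
      integral : ∀ i {y} → y ∈ M → 0ℤ ≤ord (ψ i ⟨$⟩ y)
      expand   : ∀ y → y ≈ comb ψ w y

    ⊆span : M ⊆ Span Δ𝒪 w
    ⊆span {y} y∈M = (λ i → Δ (ψ i ⟨$⟩ y)) , (λ i → _ , integral i y∈M , refl) , expand y

    member : IsSubmodule Δ𝒪 M → ∀ {y} → (∀ i → 0ℤ ≤ord (ψ i ⟨$⟩ y)) → y ∈ M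
    member isSubmodule {y} p = IsSubmodule.resp isSubmodule (sym (expand y)) (comb∈ ψ w isSubmodule w∈M p)

    generators : Generators M
    generators = n , w , w∈M , λ φ k k≤ {y} y∈M → ≤ord-resp (⟨$⟩-cong φ (sym (expand y)))
      (≤ord-sum φ _ (λ i → ≤ord-resp (F.sym (⟨$⟩-⋆ φ _ (w i))) (≤ord-*-integral _ _ (integral i y∈M) (k≤ i))))

    spanning : ∀ y → y ∈ ΔF · M
    spanning y = n , (λ i → Δ (ψ i ⟨$⟩ y)) , w , (λ i → _ , refl) , w∈M , expand y

    full : Full M
    full = spanning⇒full spanning

    isFractionalIdeal : ∀ {R} → Δ𝒪 ⊆ R → IsSubmodule R M → IsFractionalIdeal R M
    isFractionalIdeal Δ𝒪⊆R isSubmodule = record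
      { isSubmodule       = isSubmodule
      ; finitelyGenerated = n , w , (λ y∈M → let (r , r∈ , y≈) = ⊆span y∈M in r , (λ i → Δ𝒪⊆R (r∈ i)) , y≈) , span⊆
        isSubmodule w w∈M
      ; F·I=E             = spanning
      }

  -- The stage of Gaussian elimination at which the functionals with joint
  -- kernel K have been used.
  record PartialFrame (M : Subset) (K : Pred Carrier ℓ) {n} (w : Fin n → Carrier) (ψ : Fin n → Functional) : Set
    (c ⊔ ℓ) where
    field
      K-resp   : ∀ {y z} → y ≈ z → y ∈ K → z ∈ K
      w∈M      : ∀ i → w i ∈ M
      integral : ∀ i {y} → y ∈ M → 0ℤ ≤ord (ψ i ⟨$⟩ y)
      residue  : ∀ y → y - comb ψ w y ∈ K
      vanish   : ∀ {y} → y ∈ K → comb ψ w y ≈ 0#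

  record Extension (M : Subset) (K : Pred Carrier ℓ) (φ : Functional) {n} (w : Fin n → Carrier)
    (ψ : Fin n → Functional) : Set (c ⊔ ℓ) where
    field
      exponent : ℤ
      v        : Carrier
      χ        : Functional
      v∈K      : v ∈ K
      φv       : φ ⟨$⟩ v F.≈ π F.^ exponent
      extended : PartialFrame M (λ y → y ∈ K × φ ⟨$⟩ y F.≈ F.0#) (v ∷ w) (χ ∷ ψ)

  abstract

    -- The pivot is a generator at which `φ`, corrected by the earlier vectors, has least valuation.
    -- Minimality makes the new coordinate integral on all of `M`; the witness `y₀` rules out that
    -- every generator gives 0.
    extend : ∀ {M K n} {w : Fin n → Carrier} {ψ} → IsSubmodule Δ𝒪 M → Generators M → Full M → PartialFrame M K w ψ →
             ∀ φ y₀ → y₀ ∈ K → ¬ (φ ⟨$⟩ y₀ F.≈ F.0#) → Extension M K φ w ψ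
    extend {M} {K} {n} {w} {ψ} isSubmodule (m , g , g∈M , gen) fullM pf φ y₀ y₀∈K φy₀≉0 = step
      (minimal-ord (λ i → φ∘res ⟨$⟩ g i))
      where
      open PartialFrame pf
      open IsSubmodule isSubmodule using (resp)
      -- Projection to `K` along the vectors already chosen. It preserves `M` because their
      -- coefficients are integral there.
      res : Carrier → Carrier
      res y = y - comb ψ w y
      φ∘res : Functional
      φ∘res = precompose φ res (λ p → +-cong p (-‿cong (comb-cong ψ w p)))
        (λ y z → trans (+-congˡ (-‿cong (comb-+ ψ w y z)))
          (solve 4 (λ y z a b → (y :+ z) :- (a :+ b) := (y :- a) :+ (z :- b)) refl y z _ _))
        (λ t y → trans (+-congˡ (-‿cong (comb-⋆ ψ w t y)))
          (solve 3 (λ t y a → t :* y :- t :* a := t :* (y :- a)) refl (Δ t) y _))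
      φ∘res-K : ∀ {y} → y ∈ K → φ∘res ⟨$⟩ y F.≈ φ ⟨$⟩ y
      φ∘res-K {y} y∈K = ⟨$⟩-cong φ (trans (+-congˡ (-‿cong (vanish y∈K))) (solve 1 (λ y → y :- con 0ℤ := y) refl y))
      res∈M : ∀ {y} → y ∈ M → res y ∈ M
      res∈M {y} y∈M = ∸-closed isSubmodule y∈M (comb∈ ψ w isSubmodule w∈M (λ i → integral i y∈M))
      step : (∀ i → φ∘res ⟨$⟩ g i F.≈ F.0#) ⊎
        (∃ λ i → ∃ λ k → F.ord (φ∘res ⟨$⟩ g i) ≡ [ k ] × (∀ j → k ≤ord (φ∘res ⟨$⟩ g j))) →
             Extension M K φ w ψ
      step (inj₁ φ≈0) = contradiction
        (F.trans (F.sym (φ∘res-K y₀∈K))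
          (fullM φ∘res (λ y∈M → ≤ord-all⇒≈0 (λ k → gen φ∘res k (λ i → ≤ord-0 (φ≈0 i)) y∈M)) y₀)) φy₀≉0
      step (inj₂ (i , k , ord≡k , k≤)) = record
        { exponent = k ; v = v ; χ = χ ; v∈K = residue z ; φv = φ∘res-z
        ; extended = record
          { K-resp   = λ { p (y∈K , φy≈0) → K-resp p y∈K , F.trans (⟨$⟩-cong φ (sym p)) φy≈0 }
          ; w∈M      = λ { zero → res∈M z∈M ; (suc i) → w∈M i }
          ; integral = λ { zero {y} y∈M → t^-k*-integral π k {φ∘res ⟨$⟩ y} (gen φ∘res k k≤ y∈M) ; (suc i) → integral i
            }
          ; residue  = λ y → K-resp (sym (residue≈ y)) (residue (y - (χ ⟨$⟩ y) ⋆ z)) , φ-residue y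
          ; vanish   = λ { {y} (y∈K , φy≈0) → begin
              (χ ⟨$⟩ y) ⋆ v + comb ψ w y   ≈⟨ +-cong
                (*-congʳ (trans (Δ-cong (F.trans (F.*-congˡ (F.trans (φ∘res-K y∈K) φy≈0)) (F.zeroʳ _))) Δ-0))
                (vanish y∈K) ⟩
              0# * v + 0#                  ≈⟨ solve 1 (λ v → con 0ℤ :* v :+ con 0ℤ := con 0ℤ) refl v ⟩
              0#                           ∎ }
          }
        }
        where
        open import Relation.Binary.Reasoning.Setoid setoid
        u⁻¹ : F.Carrier
        u⁻¹ = proj₁ (invert ord≡k)
        -- A unit of 𝒪 that turns the pivot value into an exact power of π, so that the generators
        -- `(0 , π^a)` and `(0 , π^b x + c)` later appear without stray units.
        ε : F.Carrier
        ε = π F.^ k F.* u⁻¹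
        z v : Carrier
        z = ε ⋆ g i
        v = res z
        χ : Functional
        χ = (π F.^ (ℤ.- k)) *∘ φ∘res
        0≤ε : 0ℤ ≤ord ε
        0≤ε = ≤ord-mono ε (ℤ.≤-reflexive (≡.sym (ℤ.+-inverseʳ k)))
          (≤ord-^* π k u⁻¹ (ord≡⇒≤ord (proj₂ (proj₂ (invert ord≡k)))))
        z∈M : z ∈ M
        z∈M = ⋆-closed isSubmodule 0≤ε (g∈M i)
        φ∘res-z : φ∘res ⟨$⟩ z F.≈ π F.^ k
        φ∘res-z = F.trans (⟨$⟩-⋆ φ∘res ε (g i))
          (F.trans (F.*-assoc _ _ _) (F.trans (F.*-congˡ (proj₁ (proj₂ (invert ord≡k)))) (F.*-identityʳ _)))
        -- Since `v` is itself a residue, the new residue of `y` is an old residue of a modified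
        -- element, and therefore stays in `K`.
        residue≈ : ∀ y → y - ((χ ⟨$⟩ y) ⋆ v + comb ψ w y) ≈ res (y - (χ ⟨$⟩ y) ⋆ z)
        residue≈ y = begin
          y - ((χ ⟨$⟩ y) ⋆ v + comb ψ w y)
            ≈⟨ solve 5 (λ y t z a b → y :- (t :* (z :- a) :+ b) := (y :- t :* z) :- (b :- t :* a)) refl y
              (Δ (χ ⟨$⟩ y)) z (comb ψ w z) (comb ψ w y) ⟩
          (y - (χ ⟨$⟩ y) ⋆ z) - (comb ψ w y - (χ ⟨$⟩ y) ⋆ comb ψ w z)
            ≈⟨ +-congˡ (-‿cong comb-sub) ⟨
          res (y - (χ ⟨$⟩ y) ⋆ z) ∎
          where
          comb-sub : comb ψ w (y - (χ ⟨$⟩ y) ⋆ z) ≈ comb ψ w y - (χ ⟨$⟩ y) ⋆ comb ψ w z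
          comb-sub = begin
            comb ψ w (y - (χ ⟨$⟩ y) ⋆ z)
              ≈⟨ comb-cong ψ w (+-congˡ (trans (solve 2 (λ t z → :- (t :* z) := (:- t) :* z) refl _ z)
                (*-congʳ (sym (Δ-neg _))))) ⟩
            comb ψ w (y + (F.- (χ ⟨$⟩ y)) ⋆ z)
              ≈⟨ trans (comb-+ ψ w y _) (+-congˡ (comb-⋆ ψ w _ z)) ⟩
            comb ψ w y + (F.- (χ ⟨$⟩ y)) ⋆ comb ψ w z
              ≈⟨ +-congˡ (trans (*-congʳ (Δ-neg _)) (solve 2 (λ t z → (:- t) :* z := :- (t :* z)) refl _ _)) ⟩
            comb ψ w y - (χ ⟨$⟩ y) ⋆ comb ψ w z ∎
        φ-residue : ∀ y → φ ⟨$⟩ (y - ((χ ⟨$⟩ y) ⋆ v + comb ψ w y)) F.≈ F.0#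
        φ-residue y = F.trans (⟨$⟩-cong φ (residue≈ y)) (F.trans (⟨$⟩-- φ∘res y _) (F.trans
          (F.+-congˡ (F.-‿cong (F.trans (⟨$⟩-⋆ φ∘res (χ ⟨$⟩ y) z) (F.trans (F.*-congˡ φ∘res-z)
            (F.trans (F.*-comm _ _) (t^n*t^-n*y≈y π k (φ∘res ⟨$⟩ y))))))) (F.-‿inverseʳ _)))

    -- The first coordinate, `im` and `re` have joint kernel 0, so nothing remains after three
    -- extensions. The elements 1, (0 , x) and (0 , 1) witness that each functional is nonzero on
    -- the kernel of its predecessors.
    frame : ∀ {M} → IsSubmodule Δ𝒪 M → Generators M → Full M → ∃ λ n → ∃ λ (w : Fin n → Carrier) → ∃ λ ψ → Frame M w ψ
    frame {M} isSubmodule gens fullM = 3 , (v e₃ ∷ v e₂ ∷ v e₁ ∷ []) , (χ e₃ ∷ χ e₂ ∷ χ e₁ ∷ []) , record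
      { w∈M = extended e₃ .PartialFrame.w∈M
      ; integral = extended e₃ .PartialFrame.integral
      ; expand = λ y → let ((((_ , fst≈0) , im≈0) , re≈0)) = extended e₃ .PartialFrame.residue y in
          x-y≈0 (fst≈0 , E′.trans (coord-re-im _)
            (E′.trans (coord-cong re≈0 im≈0) (E′.trans (coord-ι F.0#) (proj₂ Δ-0)))) }
      where
      open Extension using (v; χ; extended)
      open import Algebra.Properties.AbelianGroup +-abelianGroup using () renaming (x∙y⁻¹≈ε⇒x≈y to x-y≈0′)
      x-y≈0 : ∀ {y z} → y - z ≈ 0# → y ≈ z
      x-y≈0 = x-y≈0′ _ _
      e₁ : Extension M (λ y → y ≈ y) fst-functional [] []
      e₁ = extend isSubmodule gens fullM
        (record { K-resp = λ _ _ → refl ; w∈M = λ () ; integral = λ () ; residue = λ y → refl {y - 0#} ; vanish = λ _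
        → refl })
             fst-functional 1# refl F.1≉0
      e₂ : Extension M (λ y → y ≈ y × proj₁ y F.≈ F.0#) im-functional (v e₁ ∷ []) (χ e₁ ∷ [])
      e₂ = extend isSubmodule gens fullM (extended e₁) im-functional (F.0# , coord F.0# F.1#) (refl , F.refl)
             λ p → F.1≉0 (F.trans (F.sym (proj₂ (re-im-unique E′.refl))) p)
      e₃ : Extension M (λ y → (y ≈ y × proj₁ y F.≈ F.0#) × im (proj₂ y) F.≈ F.0#) re-functional (v e₂ ∷ v e₁ ∷ [])
        (χ e₂ ∷ χ e₁ ∷ [])
      e₃ = extend isSubmodule gens fullM (extended e₂) re-functional (F.0# , coord F.1# F.0#)
        ((refl , F.refl) , proj₂ (re-im-unique E′.refl))
             λ p → F.1≉0 (F.trans (F.sym (proj₁ (re-im-unique E′.refl))) p)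

-- The basis 1, e₁, e₂ and its multiplication table

module StandardFrame {ℓ₁ ℓ₂} (F₀ : LocalField ℓ₁ ℓ₂) (E₀ : RamifiedQuadraticExtension F₀)
                     (π : LocalField.Uniformizer F₀) (x : RamifiedQuadraticExtension.Uniformizer E₀)
                     (m n : ℤ) (c : LocalField.Carrier F₀) where

  open Orders F₀ E₀
  open CommutativeRing E hiding (zero)
  open Valuation F.discretelyValuedField
  open Coordinates F₀ E₀ x
  open Lattices F₀ E₀ π x
  open Frames F₀ E₀ π x
  open Functional hiding (_⟨$⟩_)
  open IntegerInequalities
  open IntegerRingSolver F.commutativeRing using () renaming
    (solve to F-solve; _:+_ to _:+′_; _:-_ to _:-′_; _:*_ to _:*′_; :-_ to :-′_; _:=_ to _:=′_; con to con′)
  open IntegerRingSolver E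
  private
    module ιH = IsRingHomomorphism E′.ι-isHom

    Pm Pn Pm⁻ Pn⁻ : F.Carrier
    Pm  = π F.^ m
    Pn  = π F.^ n
    Pm⁻ = π F.^ (ℤ.- m)
    Pn⁻ = π F.^ (ℤ.- n)

  e₁ e₂ : Carrier
  e₁ = F.0# , E′.ι Pm
  e₂ = F.0# , E′.ι Pn E′.* X E′.+ E′.ι c

  basis : Fin 3 → Carrier
  basis = 1# ∷ e₁ ∷ e₂ ∷ []

  -- The dual basis, obtained by solving `s = γ π^n` and `r = u + β π^m + γ c` for the element (u ,
  -- r + s x).
  α β γ : Functional
  α = fst-functional
  γ = Pn⁻ *∘ im-functional
  β = Pm⁻ *∘ (re-functional ⟨-⟩ fst-functional ⟨-⟩ c *∘ γ)

  coords : Fin 3 → Functional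
  coords = α ∷ β ∷ γ ∷ []

  -- The exponents are integers because elimination delivers them as valuations, before closure
  -- under multiplication shows that they are nonnegative.
  O : Subset
  O = Span Δ𝒪 basis

  -- For z = π^n x + c, `A` is the trace and `N` is minus the norm, so z² = A z + N. Writing (0 , 1)
  -- as π^(-m) e₁ turns `N` into the coefficient `B`.
  A N B : F.Carrier
  A = Pn F.* q F.+ (c F.+ c)
  N = c F.* c F.+ Pn F.* Pn F.* p F.- A F.* c
  B = Pm⁻ F.* N

  γ-coord : ∀ {u y r s} → y E′.≈ coord r s → γ ⟨$⟩ (u , y) F.≈ Pn⁻ F.* s
  γ-coord y≈ = F.*-congˡ (proj₂ (re-im-unique y≈))

  β-coord : ∀ {u y r s} → y E′.≈ coord r s → β ⟨$⟩ (u , y) F.≈ Pm⁻ F.* (r F.- u F.- c F.* (Pn⁻ F.* s))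
  β-coord y≈ = F.*-congˡ (F.+-cong (F.+-congʳ (proj₁ (re-im-unique y≈))) (F.-‿cong (F.*-congˡ (γ-coord {F.0#} y≈))))

  e₂≈ : proj₂ e₂ E′.≈ coord c Pn
  e₂≈ = E′.+-comm _ _

  1≈ : E′.1# E′.≈ coord F.1# F.0#
  1≈ = E′.sym (E′.trans (coord-ι F.1#) ιH.1#-homo)

  coordinate≈ : ∀ {u r s y α′ β′ γ′} → y E′.≈ coord r s → u F.≈ α′ → r F.≈ α′ F.+ β′ F.* Pm F.+ γ′ F.* c → s F.≈ γ′
    F.* Pn →
                (β ⟨$⟩ (u , y) F.≈ β′) × (γ ⟨$⟩ (u , y) F.≈ γ′)
  coordinate≈ {u} {r} {s} {y} {α′} {β′} {γ′} y≈ u≈ r≈ s≈ = (begin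
      β ⟨$⟩ (u , y)                                                   ≈⟨ β-coord y≈ ⟩
      Pm⁻ F.* (r F.- u F.- c F.* (Pn⁻ F.* s))                         ≈⟨ F.*-congˡ
        (F.+-cong (F.+-cong r≈ (F.-‿cong u≈)) (F.-‿cong (F.*-congˡ Pn⁻*s))) ⟩
      Pm⁻ F.* (α′ F.+ β′ F.* Pm F.+ γ′ F.* c F.- α′ F.- c F.* γ′)     ≈⟨ F-solve 6
        (λ P⁻ P a b g c → P⁻ :*′ (a :+′ b :*′ P :+′ g :*′ c :-′ a :-′ c :*′ g) :=′ (P⁻ :*′ P) :*′ b) F.refl Pm⁻ Pm α′
        β′ γ′ c ⟩
      (Pm⁻ F.* Pm) F.* β′                                             ≈⟨ F.*-congʳ (t^-n*t^n≈1 π m) ⟩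
      F.1# F.* β′                                                     ≈⟨ F.*-identityˡ β′ ⟩
      β′                                                              ∎) ,
    F.trans (γ-coord {u} y≈) Pn⁻*s
    where
    open import Relation.Binary.Reasoning.Setoid F.setoid
    Pn⁻*s : Pn⁻ F.* s F.≈ γ′
    Pn⁻*s = begin
      Pn⁻ F.* s              ≈⟨ F.*-congˡ s≈ ⟩
      Pn⁻ F.* (γ′ F.* Pn)    ≈⟨ F-solve 3 (λ P⁻ P g → P⁻ :*′ (g :*′ P) :=′ (P⁻ :*′ P) :*′ g) F.refl Pn⁻ Pn γ′ ⟩
      (Pn⁻ F.* Pn) F.* γ′    ≈⟨ F.*-congʳ (t^-n*t^n≈1 π n) ⟩
      F.1# F.* γ′            ≈⟨ F.*-identityˡ γ′ ⟩
      γ′                     ∎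

  -- The trailing `0#` makes this definitionally a `sum` over `Fin 3`, so membership in `O` can be
  -- proved by `refl`.
  elt : F.Carrier → F.Carrier → F.Carrier → Carrier
  elt a b g = a ⋆ 1# + (b ⋆ e₁ + (g ⋆ e₂ + 0#))

  elt-cong : ∀ {a a′ b b′ g g′} → a F.≈ a′ → b F.≈ b′ → g F.≈ g′ → elt a b g ≈ elt a′ b′ g′
  elt-cong p q r = +-cong (*-congʳ (Δ-cong p)) (+-cong (*-congʳ (Δ-cong q)) (+-congʳ (*-congʳ (Δ-cong r))))

  elt-fst : ∀ a b g → proj₁ (elt a b g) F.≈ a
  elt-fst = F-solve 3 (λ a b g → a :*′ con′ 1ℤ :+′ (b :*′ con′ 0ℤ :+′ (g :*′ con′ 0ℤ :+′ con′ 0ℤ)) :=′ a) F.refl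

  elt-snd : ∀ a b g → proj₂ (elt a b g) E′.≈ coord (a F.+ b F.* Pm F.+ g F.* c) (g F.* Pn)
  elt-snd a b g = begin
    proj₂ (elt a b g)
      ≈⟨ E′-solve 7 (λ a b g P Q c X → a :*″ con″ 1ℤ :+″ (b :*″ P :+″ (g :*″ (Q :*″ X :+″ c) :+″ con″ 0ℤ)) :=″
        (a :+″ b :*″ P :+″ g :*″ c) :+″ (g :*″ Q) :*″ X) E′.refl (E′.ι a) (E′.ι b) (E′.ι g) (E′.ι Pm) (E′.ι Pn)
        (E′.ι c) X ⟩
    (E′.ι a E′.+ E′.ι b E′.* E′.ι Pm E′.+ E′.ι g E′.* E′.ι c) E′.+ (E′.ι g E′.* E′.ι Pn) E′.* X
      ≈⟨ E′.+-cong (E′.+-cong (E′.+-congˡ (ιH.*-homo b Pm)) (ιH.*-homo g c)) (E′.*-congʳ (ιH.*-homo g Pn)) ⟨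
    (E′.ι a E′.+ E′.ι (b F.* Pm) E′.+ E′.ι (g F.* c)) E′.+ E′.ι (g F.* Pn) E′.* X
      ≈⟨ E′.+-congʳ (E′.trans (ιH.+-homo _ _) (E′.+-congʳ (ιH.+-homo _ _))) ⟨
    coord (a F.+ b F.* Pm F.+ g F.* c) (g F.* Pn) ∎
    where
    open import Relation.Binary.Reasoning.Setoid E′.setoid
    open IntegerRingSolver E′.commutativeRing using () renaming
      (solve to E′-solve; _:+_ to _:+″_; _:*_ to _:*″_; _:=_ to _:=″_; con to con″)

  α-elt : ∀ a b g → α ⟨$⟩ elt a b g F.≈ a
  α-elt = elt-fst

  β-elt : ∀ a b g → β ⟨$⟩ elt a b g F.≈ b
  β-elt a b g = proj₁ (coordinate≈ (elt-snd a b g) (elt-fst a b g) F.refl F.refl)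

  γ-elt : ∀ a b g → γ ⟨$⟩ elt a b g F.≈ g
  γ-elt a b g = proj₂ (coordinate≈ (elt-snd a b g) (elt-fst a b g) F.refl F.refl)

  expand-elt : ∀ y → y ≈ elt (α ⟨$⟩ y) (β ⟨$⟩ y) (γ ⟨$⟩ y)
  expand-elt y = F.sym (elt-fst _ _ _) , E′.sym
    (E′.trans (elt-snd _ _ _) (E′.trans (coord-cong r≈ s≈) (E′.sym (coord-re-im (proj₂ y)))))
    where
    open import Relation.Binary.Reasoning.Setoid F.setoid
    a g r s : F.Carrier
    a = proj₁ y
    g = γ ⟨$⟩ y
    r = re (proj₂ y)
    s = im (proj₂ y)
    s≈ : g F.* Pn F.≈ s
    s≈ = F.trans (F.*-comm g Pn) (t^n*t^-n*y≈y π n s)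
    r≈ : a F.+ (β ⟨$⟩ y) F.* Pm F.+ g F.* c F.≈ r
    r≈ = begin
      a F.+ (β ⟨$⟩ y) F.* Pm F.+ g F.* c          ≈⟨ F.+-congʳ
        (F.+-congˡ (F.trans (F.*-comm _ Pm) (t^n*t^-n*y≈y π m _))) ⟩
      a F.+ (r F.- a F.- c F.* g) F.+ g F.* c     ≈⟨ F-solve 4
        (λ a r c g → a :+′ (r :-′ a :-′ c :*′ g) :+′ g :*′ c :=′ r) F.refl a r c g ⟩
      r                                           ∎

  e₁²≈ : e₁ * e₁ ≈ Pm ⋆ e₁
  e₁²≈ = F-solve 1 (λ P → con′ 0ℤ :*′ con′ 0ℤ :=′ P :*′ con′ 0ℤ) F.refl Pm , E′.refl

  e₁e₂≈ : e₁ * e₂ ≈ Pm ⋆ e₂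
  e₁e₂≈ = F-solve 1 (λ P → con′ 0ℤ :*′ con′ 0ℤ :=′ P :*′ con′ 0ℤ) F.refl Pm , E′.refl

  e₂²≈ : e₂ * e₂ ≈ A ⋆ e₂ + B ⋆ e₁
  e₂²≈ = F-solve 2 (λ P Q → con′ 0ℤ :*′ con′ 0ℤ :=′ P :*′ con′ 0ℤ :+′ Q :*′ con′ 0ℤ) F.refl A B , (begin
    proj₂ e₂ E′.* proj₂ e₂
      ≈⟨ E′.*-cong e₂≈ e₂≈ ⟩
    coord c Pn E′.* coord c Pn
      ≈⟨ coord-* c Pn c Pn ⟩
    coord (c F.* c F.+ Pn F.* Pn F.* p) (c F.* Pn F.+ Pn F.* c F.+ Pn F.* Pn F.* q)
      ≈⟨ coord-cong re-part (F-solve 3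
        (λ c P q → c :*′ P :+′ P :*′ c :+′ P :*′ P :*′ q :=′ (P :*′ q :+′ (c :+′ c)) :*′ P) F.refl c Pn q) ⟩
    coord (A F.* c F.+ B F.* Pm) (A F.* Pn)
      ≈⟨ coord-cong F.refl (F.+-identityʳ _) ⟨
    coord (A F.* c F.+ B F.* Pm) (A F.* Pn F.+ F.0#)
      ≈⟨ coord-+ _ _ _ _ ⟨
    coord (A F.* c) (A F.* Pn) E′.+ coord (B F.* Pm) F.0#
      ≈⟨ E′.+-cong (E′.trans (E′.*-congˡ e₂≈) (ι*coord A c Pn))
        (E′.trans (E′.sym (ιH.*-homo B Pm)) (E′.sym (coord-ι _))) ⟨
    E′.ι A E′.* proj₂ e₂ E′.+ E′.ι B E′.* E′.ι Pm ∎)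
    where
    open import Relation.Binary.Reasoning.Setoid E′.setoid
    re-part : c F.* c F.+ Pn F.* Pn F.* p F.≈ A F.* c F.+ B F.* Pm
    re-part = F.trans (F-solve 2 (λ u v → u :=′ v :+′ (u :-′ v)) F.refl (c F.* c F.+ Pn F.* Pn F.* p) (A F.* c))
      (F.+-congˡ (F.sym (F.trans (F.*-comm B Pm) (t^n*t^-n*y≈y π m N))))

  -- The structure constants. There is no third formula because the first coordinate `α` is
  -- multiplicative.
  β* γ* : F.Carrier → F.Carrier → F.Carrier → F.Carrier → F.Carrier → F.Carrier → F.Carrier
  β* a b g a′ b′ g′ = a F.* b′ F.+ b F.* a′ F.+ Pm F.* (b F.* b′) F.+ B F.* (g F.* g′)
  γ* a b g a′ b′ g′ = a F.* g′ F.+ g F.* a′ F.+ Pm F.* (b F.* g′ F.+ g F.* b′) F.+ A F.* (g F.* g′)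

  elt-* : ∀ a b g a′ b′ g′ → elt a b g * elt a′ b′ g′ ≈ elt (a F.* a′) (β* a b g a′ b′ g′) (γ* a b g a′ b′ g′)
  elt-* a b g a′ b′ g′ = begin
    elt a b g * elt a′ b′ g′
      ≈⟨ solve 8 (λ a b g a′ b′ g′ e f →
           (a :* con 1ℤ :+ (b :* e :+ (g :* f :+ con 0ℤ))) :* (a′ :* con 1ℤ :+ (b′ :* e :+ (g′ :* f :+ con 0ℤ)))
           := (a :* a′ :+ (a :* b′ :+ b :* a′) :* e :+ (a :* g′ :+ g :* a′) :* f)
              :+ ((b :* b′) :* (e :* e) :+ (b :* g′ :+ g :* b′) :* (e :* f) :+ (g :* g′) :* (f :* f)))
           refl (Δ a) (Δ b) (Δ g) (Δ a′) (Δ b′) (Δ g′) e₁ e₂ ⟩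
    (Δ a * Δ a′ + (Δ a * Δ b′ + Δ b * Δ a′) * e₁ + (Δ a * Δ g′ + Δ g * Δ a′) * e₂)
      + ((Δ b * Δ b′) * (e₁ * e₁) + (Δ b * Δ g′ + Δ g * Δ b′) * (e₁ * e₂) + (Δ g * Δ g′) * (e₂ * e₂))
      ≈⟨ +-cong (+-cong (+-cong (sym (Δ-* a a′)) (*-congʳ (Δ-+* a b′ b a′))) (*-congʳ (Δ-+* a g′ g a′)))
                (+-cong (+-cong (*-cong (sym (Δ-* b b′)) e₁²≈) (*-cong (Δ-+* b g′ g b′) e₁e₂≈))
                  (*-cong (sym (Δ-* g g′)) e₂²≈)) ⟩
    (Δ (a F.* a′) + Δ u * e₁ + Δ v * e₂) +
      (Δ (b F.* b′) * (Δ Pm * e₁) + Δ w * (Δ Pm * e₂) + Δ (g F.* g′) * (Δ A * e₂ + Δ B * e₁))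
      ≈⟨ +-cong (+-congʳ (+-congʳ (sym (*-identityʳ _))))
        (+-cong (+-cong (reassoc (b F.* b′) Pm e₁) (reassoc w Pm e₂))
           (trans (distribˡ (Δ (g F.* g′)) (Δ A * e₂) (Δ B * e₁))
             (+-cong (reassoc (g F.* g′) A e₂) (reassoc (g F.* g′) B e₁)))) ⟩
    (Δ (a F.* a′) * 1# + Δ u * e₁ + Δ v * e₂)
      + (Δ (Pm F.* (b F.* b′)) * e₁ + Δ (Pm F.* w) * e₂ + (Δ (A F.* (g F.* g′)) * e₂ + Δ (B F.* (g F.* g′)) * e₁))
      ≈⟨ solve 9 (λ a u v b w f g e₁ e₂ → (a :+ u :* e₁ :+ v :* e₂) :+ (b :* e₁ :+ w :* e₂ :+ (f :* e₂ :+ g :* e₁))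
           := a :+ ((u :+ b :+ g) :* e₁ :+ ((v :+ w :+ f) :* e₂ :+ con 0ℤ))) refl
           (Δ (a F.* a′) * 1#) (Δ u) (Δ v) (Δ (Pm F.* (b F.* b′))) (Δ (Pm F.* w)) (Δ (A F.* (g F.* g′)))
             (Δ (B F.* (g F.* g′))) e₁ e₂ ⟩
    Δ (a F.* a′) * 1# + ((Δ u + Δ (Pm F.* (b F.* b′)) + Δ (B F.* (g F.* g′))) * e₁ +
      ((Δ v + Δ (Pm F.* w) + Δ (A F.* (g F.* g′))) * e₂ + 0#))
      ≈⟨ +-congˡ (+-cong (*-congʳ (Δ-++ u _ _)) (+-congʳ (*-congʳ (Δ-++ v _ _)))) ⟩
    elt (a F.* a′) (β* a b g a′ b′ g′) (γ* a b g a′ b′ g′) ∎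
    where
    open import Relation.Binary.Reasoning.Setoid setoid
    u v w : F.Carrier
    u = a F.* b′ F.+ b F.* a′
    v = a F.* g′ F.+ g F.* a′
    w = b F.* g′ F.+ g F.* b′
    Δ-+* : ∀ a b c d → Δ a * Δ b + Δ c * Δ d ≈ Δ (a F.* b F.+ c F.* d)
    Δ-+* a b c d = trans (+-cong (sym (Δ-* a b)) (sym (Δ-* c d))) (sym (Δ-+ _ _))
    Δ-++ : ∀ a b c → Δ a + Δ b + Δ c ≈ Δ (a F.+ b F.+ c)
    Δ-++ a b c = trans (+-congʳ (sym (Δ-+ a b))) (sym (Δ-+ _ c))
    reassoc : ∀ s t y → Δ s * (Δ t * y) ≈ Δ (t F.* s) * y
    reassoc s t y = trans (solve 3 (λ s t y → s :* (t :* y) := (t :* s) :* y) refl (Δ s) (Δ t) y)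
      (*-congʳ (sym (Δ-* t s)))

  O-isSubmodule : IsSubmodule Δ𝒪 O
  O-isSubmodule = span-isSubmodule basis

  elt∈O : ∀ {a b g} → 0ℤ ≤ord a → 0ℤ ≤ord b → 0ℤ ≤ord g → elt a b g ∈ O
  elt∈O {a} {b} {g} p q r = (Δ a ∷ Δ b ∷ Δ g ∷ []) ,
    (λ { zero → a , p , refl ; (suc zero) → b , q , refl ; (suc (suc zero)) → g , r , refl }) , refl

  integral⇒∈O : ∀ {y} → 0ℤ ≤ord (α ⟨$⟩ y) → 0ℤ ≤ord (β ⟨$⟩ y) → 0ℤ ≤ord (γ ⟨$⟩ y) → y ∈ O
  integral⇒∈O {y} p q r = IsSubmodule.resp O-isSubmodule (sym (expand-elt y)) (elt∈O p q r)

  ∈O⇒elt : ∀ {y} → y ∈ O → ∃ λ a → ∃ λ b → ∃ λ g → (0ℤ ≤ord a × 0ℤ ≤ord b × 0ℤ ≤ord g) × y ≈ elt a b g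
  ∈O⇒elt (r , r∈ , y≈) =
    let (a , a∈ , a≈) = r∈ zero ; (b , b∈ , b≈) = r∈ (suc zero) ; (g , g∈ , g≈) = r∈ (suc (suc zero)) in
    a , b , g , (a∈ , b∈ , g∈) , trans y≈ (+-cong (*-congʳ a≈) (+-cong (*-congʳ b≈) (+-congʳ (*-congʳ g≈))))

  ∈O⇒integral : ∀ {y} → y ∈ O → 0ℤ ≤ord (α ⟨$⟩ y) × 0ℤ ≤ord (β ⟨$⟩ y) × 0ℤ ≤ord (γ ⟨$⟩ y)
  ∈O⇒integral y∈O = let (a , b , g , (p , q , r) , y≈) = ∈O⇒elt y∈O in
    ≤ord-resp (F.sym (F.trans (⟨$⟩-cong α y≈) (α-elt a b g))) p ,
    ≤ord-resp (F.sym (F.trans (⟨$⟩-cong β y≈) (β-elt a b g))) q ,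
    ≤ord-resp (F.sym (F.trans (⟨$⟩-cong γ y≈) (γ-elt a b g))) r

  basis∈O : ∀ i → basis i ∈ O
  basis∈O = generator∈span Δ𝒪 1∈Δ𝒪 0∈Δ𝒪 basis

  O-frame : Frame O basis coords
  O-frame = record
    { w∈M      = basis∈O
    ; integral = λ { zero y∈O → proj₁ (∈O⇒integral y∈O) ; (suc zero) y∈O → proj₁ (proj₂ (∈O⇒integral y∈O))
                   ; (suc (suc zero)) y∈O → proj₂ (proj₂ (∈O⇒integral y∈O)) }
    ; expand   = expand-elt
    }

  0≤ord-P : ∀ {k} → 0ℤ ℤ.≤ k → 0ℤ ≤ord (π F.^ k)
  0≤ord-P = ≤⇒≤ord (ord-^ π _)

  isOrder : 0ℤ ℤ.≤ m → 0ℤ ≤ord A → 0ℤ ≤ord B → IsOrder O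
  isOrder 0≤m 0≤A 0≤B = record
    { resp              = IsSubmodule.resp O-isSubmodule
    ; 0∈                = IsSubmodule.0∈ O-isSubmodule
    ; 1∈                = basis∈O zero
    ; +-closed          = IsSubmodule.+-closed O-isSubmodule
    ; neg-closed        = neg-closed O-isSubmodule
    ; *-closed          = λ y∈O z∈O →
        let (a , b , g , (a∈ , b∈ , g∈) , y≈) = ∈O⇒elt y∈O
            (a′ , b′ , g′ , (a′∈ , b′∈ , g′∈) , z≈) = ∈O⇒elt z∈O in
        IsSubmodule.resp O-isSubmodule (sym (trans (*-cong y≈ z≈) (elt-* a b g a′ b′ g′)))
          (elt∈O (a∈ ⊛ a′∈)
            (≤ord-+ _ _ (≤ord-+ _ _ (≤ord-+ _ _ (a∈ ⊛ b′∈) (b∈ ⊛ a′∈)) (0≤ord-P 0≤m ⊛ (b∈ ⊛ b′∈))) (0≤B ⊛ (g∈ ⊛ g′∈)))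
            (≤ord-+ _ _ (≤ord-+ _ _ (≤ord-+ _ _ (a∈ ⊛ g′∈) (g∈ ⊛ a′∈))
              (0≤ord-P 0≤m ⊛ ≤ord-+ _ _ (b∈ ⊛ g′∈) (g∈ ⊛ b′∈))) (0≤A ⊛ (g∈ ⊛ g′∈))))
    ; contains-Δ𝒪       = λ { (t , t∈ , y≈) → IsSubmodule.resp O-isSubmodule (trans (*-identityʳ _) (sym y≈))
      (⋆-closed O-isSubmodule t∈ (basis∈O zero)) }
    ; finitelyGenerated = 3 , basis , id , id
    ; F·O=E             = Frame.spanning O-frame
    }
    where
    infixr 7 _⊛_
    _⊛_ : ∀ {y z} → 0ℤ ≤ord y → 0ℤ ≤ord z → 0ℤ ≤ord (y F.* z)
    _⊛_ = ≤ord-*-integral _ _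

  -- Two products suffice: the e₁-coordinate of `e₁ * e₁` is π^m, and `e₂ * e₂` has coordinates `B`
  -- and `A`.
  closed⇒ : (∀ {y z} → y ∈ O → z ∈ O → y * z ∈ O) → 0ℤ ℤ.≤ m × 0ℤ ≤ord A × 0ℤ ≤ord B
  closed⇒ *-closed =
    ≤ord⇒≤ (ord-^ π m) (≤ord-resp (F.trans (⟨$⟩-cong β (trans e₁²≈ Pm⋆e₁≈)) (β-elt F.0# Pm F.0#))
      (proj₁ (proj₂ (∈O⇒integral (*-closed (basis∈O (suc zero)) (basis∈O (suc zero))))))) ,
    ≤ord-resp (F.trans (⟨$⟩-cong γ (trans e₂²≈ A⋆e₂+B⋆e₁≈)) (γ-elt F.0# B A)) (proj₂ (proj₂ (∈O⇒integral e₂²∈O))) ,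
    ≤ord-resp (F.trans (⟨$⟩-cong β (trans e₂²≈ A⋆e₂+B⋆e₁≈)) (β-elt F.0# B A)) (proj₁ (proj₂ (∈O⇒integral e₂²∈O)))
    where
    e₂²∈O : e₂ * e₂ ∈ O
    e₂²∈O = *-closed (basis∈O (suc (suc zero))) (basis∈O (suc (suc zero)))
    Pm⋆e₁≈ : Pm ⋆ e₁ ≈ elt F.0# Pm F.0#
    Pm⋆e₁≈ = sym (trans (+-cong (*-congʳ Δ-0) (+-congˡ (+-congʳ (*-congʳ Δ-0))))
      (solve 3 (λ P e f → con 0ℤ :* con 1ℤ :+ (P :* e :+ (con 0ℤ :* f :+ con 0ℤ)) := P :* e) refl (Δ Pm) e₁ e₂))
    A⋆e₂+B⋆e₁≈ : A ⋆ e₂ + B ⋆ e₁ ≈ elt F.0# B A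
    A⋆e₂+B⋆e₁≈ = sym (trans (+-congʳ (*-congʳ Δ-0))
      (solve 4 (λ A B e f → con 0ℤ :* con 1ℤ :+ (B :* e :+ (A :* f :+ con 0ℤ)) := A :* f :+ B :* e) refl (Δ A) (Δ B)
        e₁ e₂))

  -- N is, up to sign, the norm of π ^ n x + c, whose two main terms have
  -- valuations of different parity.
  ord-N : ((n ℤ.+ 1ℤ) ≤ord c × F.ord N ≡ [ n ℤ.+ n ℤ.+ 1ℤ ]) ⊎
          (∃ λ v → F.ord c ≡ [ v ] × v ℤ.≤ n × F.ord N ≡ [ v ℤ.+ v ])
  -- The cross term `Pn * q * c` never dominates: since `q` has positive valuation, it lies strictly
  -- above `Pn * Pn * p` in the first case and above `c * c` in the second.
  ord-N with ≤ord-or-ord< (n ℤ.+ 1ℤ) c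
  ... | inj₁ n<c = inj₁ (n<c , ≡.trans (ord-cong N≈) (ord-+-strict ord-PnPnp
        (≤ord-neg _ (≤ord-+ _ _ (≤ord-mono _ (ℤ.≤-reflexive (2n+2≡ n))
          (≤ord-* _ _ (≤ord-* _ _ (ord≡⇒≤ord (ord-^ π n)) 1≤ord-q) n<c))
                               (≤ord-mono _ (ℤ.≤-reflexive (2n+2≡ n)) (≤ord-* _ _ n<c n<c))))))
    where
    open F using (ord-cong)
    2n+2≡ : ∀ n → n ℤ.+ n ℤ.+ 1ℤ ℤ.+ 1ℤ ≡ n ℤ.+ 1ℤ ℤ.+ (n ℤ.+ 1ℤ)
    2n+2≡ = ℤ-solve 1 (λ n → n ⊕ n ⊕ κ 1ℤ ⊕ κ 1ℤ ⊜ n ⊕ κ 1ℤ ⊕ (n ⊕ κ 1ℤ)) ≡.refl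
    ord-PnPnp : F.ord (Pn F.* Pn F.* p) ≡ [ n ℤ.+ n ℤ.+ 1ℤ ]
    ord-PnPnp = ord-*-finite (ord-*-finite (ord-^ π n) (ord-^ π n)) ord-p
    N≈ : N F.≈ Pn F.* Pn F.* p F.- (Pn F.* q F.* c F.+ c F.* c)
    N≈ = F-solve 4 (λ P p q c → c :*′ c :+′ P :*′ P :*′ p :-′ (P :*′ q :+′ (c :+′ c)) :*′ c :=′ P :*′ P :*′ p :-′
      (P :*′ q :*′ c :+′ c :*′ c)) F.refl Pn p q c
  ... | inj₂ (v , v<n+1 , ord≡v) = inj₂ (v , ord≡v , v≤n , ≡.trans (ord-cong N≈) (ord-+-strict ord-cc
        (≤ord-- _ _ (≤ord-mono _ (2v+1≤ v n v≤n v≤n)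
          (≤ord-* _ _ (≤ord-* _ _ (ord≡⇒≤ord (ord-^ π n)) (ord≡⇒≤ord (ord-^ π n))) 1≤ord-p))
                    (≤ord-mono _ (2v+1≤ v n v≤n (ℤ.≤-refl {v}))
                      (≤ord-resp (F-solve 3 (λ P c q → P :*′ c :*′ q :=′ P :*′ q :*′ c) F.refl Pn c q)
                      (≤ord-* _ _ (≤ord-* _ _ (ord≡⇒≤ord (ord-^ π n)) (ord≡⇒≤ord ord≡v)) 1≤ord-q))))))
    where
    open F using (ord-cong)
    v≤n : v ℤ.≤ n
    v≤n = lin₁ 0 v<n+1 (ℤ-solve 2 (λ v n → n ⊖ v ⊜ n ⊕ κ 1ℤ ⊖ (v ⊕ κ 1ℤ) ⊕ κ 0ℤ) ≡.refl v n)
    2v+1≤ : ∀ v n {w} → v ℤ.≤ n → v ℤ.≤ w → v ℤ.+ v ℤ.+ 1ℤ ℤ.≤ n ℤ.+ w ℤ.+ 1ℤ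
    2v+1≤ v n p q = ℤ.+-monoˡ-≤ 1ℤ (ℤ.+-mono-≤ p q)
    -c≈ : F.ord (F.- c) ≡ [ v ]
    -c≈ = ord-neg ord≡v
    ord-cc : F.ord ((F.- c) F.* c) ≡ [ v ℤ.+ v ]
    ord-cc = ord-*-finite -c≈ ord≡v
    N≈ : N F.≈ (F.- c) F.* c F.+ (Pn F.* Pn F.* p F.- Pn F.* q F.* c)
    N≈ = F-solve 4 (λ P p q c → c :*′ c :+′ P :*′ P :*′ p :-′ (P :*′ q :+′ (c :+′ c)) :*′ c :=′ (:-′ c) :*′ c :+′
      (P :*′ P :*′ p :-′ P :*′ q :*′ c)) F.refl Pn p q c

  ord-B : ∀ {k} → F.ord N ≡ [ k ] → F.ord B ≡ [ k ℤ.- m ]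
  ord-B {k} eq = ≡.trans (ord-*-finite (ord-^ π (ℤ.- m)) eq) (≡.cong [_] (ℤ.+-comm (ℤ.- m) k))

  N-finite : ∃ λ k → F.ord N ≡ [ k ]
  N-finite with ord-N
  ... | inj₁ (_ , eq)         = _ , eq
  ... | inj₂ (_ , _ , _ , eq) = _ , eq

-- Classification of the orders

module OrderFamily {ℓ₁ ℓ₂} (F₀ : LocalField ℓ₁ ℓ₂) (E₀ : RamifiedQuadraticExtension F₀)
                   (π : LocalField.Uniformizer F₀) (x : RamifiedQuadraticExtension.Uniformizer E₀) where

  open Orders F₀ E₀
  open Family π x
  open CommutativeRing E hiding (zero)
  open Valuation F.discretelyValuedField
  open Coordinates F₀ E₀ x
  open Lattices F₀ E₀ π x
  open Frames F₀ E₀ π x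
  open Functional hiding (_⟨$⟩_)
  open IntegerInequalities
  open IntegerRingSolver F.commutativeRing using () renaming
    (solve to F-solve; _:+_ to _:+′_; _:-_ to _:-′_; _:*_ to _:*′_; :-_ to :-′_; _:=_ to _:=′_; con to con′)
  open IntegerRingSolver E
  module Std = StandardFrame F₀ E₀ π x

  ord-N≡orderBound : ∀ m b c → F.ord (Std.N m (+ b) c) ≡ orderBound b (F.ord c)
  ord-N≡orderBound m b c with Std.ord-N m (+ b) c
  ... | inj₁ (b<c , eq) = ≡.trans eq (go (F.ord c) b<c)
    where
    go : ∀ v → [ + b ℤ.+ 1ℤ ] ≤⁺ v → [ + b ℤ.+ + b ℤ.+ 1ℤ ] ≡ orderBound b v
    go ⊤⁺    _       = ≡.cong [_] (2b+1≡ b)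
    go [ v ] [ b<v ] = ≡.cong [_] (≡.trans (2b+1≡ b) (≡.sym (ℤ.i≤j⇒i⊓j≡i (≡.subst₂ ℤ._≤_ (2b+1≡ b) (≡.sym (2*≡+ v))
      (lin₁ 1 (double-≤ b<v) (ℤ-solve 2 (λ b v → v ⊕ v ⊖ (b ⊕ b ⊕ κ 1ℤ) ⊜ v ⊕ v ⊖ (b ⊕ κ 1ℤ ⊕ (b ⊕ κ 1ℤ)) ⊕ κ 1ℤ)
        ≡.refl (+ b) v))))))
  ... | inj₂ (v , ord≡v , v≤b , eq) = ≡.trans eq
      (≡.trans (≡.cong [_] (≡.trans (≡.sym (2*≡+ v)) (≡.sym (ℤ.i≥j⇒i⊓j≡j (≡.subst₂ ℤ._≤_ (≡.sym (2*≡+ v)) (2b+1≡ b)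
      (lin₁ 1 (double-≤ v≤b) (ℤ-solve 2 (λ b v → b ⊕ b ⊕ κ 1ℤ ⊖ (v ⊕ v) ⊜ b ⊕ b ⊖ (v ⊕ v) ⊕ κ 1ℤ) ≡.refl (+ b)
        v))))))) (≡.cong (orderBound b) (≡.sym ord≡v)))

  ≤orderBound⇒isOrder : ∀ a b c → c ∈ F.𝒪 → [ + a ] ≤⁺ orderBound b (F.ord c) → IsOrder 𝒪[ a , b , c ]
  ≤orderBound⇒isOrder a b c c∈𝒪 a≤ = Std.isOrder (+ a) (+ b) c (ℤ.+≤+ ℕ.z≤n)
    (≤ord-+ _ _ (≤ord-*-integral _ _ (≤⇒≤ord (ord-^ π (+ b)) (ℤ.+≤+ ℕ.z≤n)) (≤ord-mono q (ℤ.+≤+ ℕ.z≤n) 1≤ord-q))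
      (≤ord-+ c c c∈𝒪 c∈𝒪))
    (t^-k*-integral π (+ a) (≡.subst ([ + a ] ≤⁺_) (≡.sym (ord-N≡orderBound (+ a) b c)) a≤))

  isOrder⇒≤ord-N : ∀ a b c → IsOrder 𝒪[ a , b , c ] → + a ≤ord Std.N (+ a) (+ b) c
  isOrder⇒≤ord-N a b c isOrd = t^-k*-integral⁻ π (+ a)
    (proj₂ (proj₂ (Std.closed⇒ (+ a) (+ b) c (IsOrder.*-closed isOrd))))

  -- The valuation of `N` is one of the two numbers 2n + 1 and 2 ord(c), namely the smaller, so the
  -- other bound follows from the comparison of `n` with ord(c).
  order-bounds : ∀ m n c → m ≤ord Std.N m n c → m ℤ.≤ n ℤ.+ n ℤ.+ 1ℤ × (∀ v → F.ord c ≡ [ v ] → m ℤ.≤ v ℤ.+ v)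
  order-bounds m n c m≤N with Std.ord-N m n c
  ... | inj₁ (n<c , eq) = ≤ord⇒≤ eq m≤N , λ v ord≡v →
    lin₂ 1 (≤ord⇒≤ eq m≤N) (double-≤ (≤ord⇒≤ ord≡v n<c))
      (ℤ-solve 3 (λ m n v → v ⊕ v ⊖ m ⊜ n ⊕ n ⊕ κ 1ℤ ⊖ m ⊕ (v ⊕ v ⊖ (n ⊕ κ 1ℤ ⊕ (n ⊕ κ 1ℤ))) ⊕ κ 1ℤ) ≡.refl m n v)
  ... | inj₂ (v , ord≡v , v≤n , eq) =
    lin₂ 1 (≤ord⇒≤ eq m≤N) (double-≤ v≤n)
      (ℤ-solve 3 (λ m n v → n ⊕ n ⊕ κ 1ℤ ⊖ m ⊜ v ⊕ v ⊖ m ⊕ (n ⊕ n ⊖ (v ⊕ v)) ⊕ κ 1ℤ) ≡.refl m n v) ,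
    λ v′ ord≡v′ → ≡.subst (λ v → m ℤ.≤ v ℤ.+ v) ([]-injective (≡.trans (≡.sym ord≡v) ord≡v′)) (≤ord⇒≤ eq m≤N)

  -- Both signs are forced by 0 ≤ m: it gives 0 ≤ 2n + 1 and 0 ≤ 2 ord(c), and an integer n with 0 ≤
  -- 2n + 1 is nonnegative.
  order-nonneg : ∀ m n c → 0ℤ ℤ.≤ m → m ≤ord Std.N m n c → 0ℤ ℤ.≤ n × c ∈ F.𝒪
  order-nonneg m n c 0≤m m≤N = halve (ℤ.≤-trans 0≤m (proj₁ (order-bounds m n c m≤N))) , c∈𝒪
    where
    c∈𝒪 : c ∈ F.𝒪
    c∈𝒪 with zero-or-ord c
    ... | inj₁ c≈0 = ≤ord-0 c≈0
    ... | inj₂ (v , ord≡v) = ≤⇒≤ord ord≡v (halve (lin₂ 1 0≤m (proj₂ (order-bounds m n c m≤N) v ord≡v)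
            (ℤ-solve 2 (λ m v → v ⊕ v ⊕ κ 1ℤ ⊖ (κ 0ℤ ⊕ κ 0ℤ) ⊜ m ⊖ κ 0ℤ ⊕ (v ⊕ v ⊖ m) ⊕ κ 1ℤ) ≡.refl m v)))

  -- With 1 as first vector, a pivot for `im` on the kernel of the first coordinate has the shape (0
  -- , π^n x + c), and a pivot for `re` on the remaining kernel is (0 , π^m). Here `c` is whatever
  -- real part the former pivot has.
  order-is-standard : ∀ O → IsOrder O → ∃ λ a → ∃ λ b → ∃ λ c →
                      c ∈ F.𝒪 × [ + a ] ≤⁺ orderBound b (F.ord c) × O ≐ 𝒪[ a , b , c ]
  order-is-standard O isOrd = conclude m n c (proj₁ closed) m≤N (order-nonneg m n c (proj₁ closed) m≤N)
    ((λ {y} → O⊆ {y}) , (λ {y} → ⊆O {y}))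
    where
    open IsOrder isOrd
    isSubmodule : IsSubmodule Δ𝒪 O
    isSubmodule = record { resp = resp ; 0∈ = 0∈ ; +-closed = +-closed ; *-closed = λ r∈ → *-closed (contains-Δ𝒪 r∈) }
    gens : Generators O
    gens = finitelyGenerated⇒generators finitelyGenerated isSubmodule
    full : Full O
    full = spanning⇒full F·O=E
    -- The projection of O to F is a ring, so an element of minimal valuation
    -- in it has nonnegative valuation.
    fst-integral : ∀ {y} → y ∈ O → 0ℤ ≤ord proj₁ y
    fst-integral y∈O = go gens y∈O
      where
      go : Generators O → ∀ {y} → y ∈ O → 0ℤ ≤ord proj₁ y
      go (_ , g , g∈O , gen) {y} y∈O with minimal-ord (proj₁ ∘ g)
      ... | inj₁ g≈0 = contradiction (≤ord-all⇒≈0 λ k → gen fst-functional k (≤ord-0 ∘ g≈0) 1∈) F.1≉0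
      ... | inj₂ (i , k , eq , k≤g) = ≤ord-mono _ 0≤k (gen fst-functional k k≤g y∈O)
        where
        0≤k : 0ℤ ℤ.≤ k
        0≤k = lin₁ 0 (≤ord⇒≤ (ord-*-finite eq eq) (gen fst-functional k k≤g (*-closed (g∈O i) (g∈O i))))
          (ℤ-solve 1 (λ k → k ⊖ κ 0ℤ ⊜ k ⊕ k ⊖ k ⊕ κ 0ℤ) ≡.refl k)
    -- The elimination is started by hand from 1 instead of an unspecified pivot. This is legitimate
    -- because the first coordinate is integral on `O` and equals 1 at 1.
    pf₀ : PartialFrame O (λ y → proj₁ y F.≈ F.0#) (1# ∷ []) (fst-functional ∷ [])
    pf₀ = record
      { K-resp   = λ p y≈0 → F.trans (F.sym (proj₁ p)) y≈0
      ; w∈M      = λ { zero → 1∈ }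
      ; integral = λ { zero → fst-integral }
      ; residue  = λ y → F-solve 1 (λ u → u :-′ (u :*′ con′ 1ℤ :+′ con′ 0ℤ) :=′ con′ 0ℤ) F.refl (proj₁ y)
      ; vanish   = λ y≈0 → trans (+-congʳ (*-congʳ (trans (Δ-cong y≈0) Δ-0)))
        (solve 0 (con 0ℤ :* con 1ℤ :+ con 0ℤ := con 0ℤ) refl)
      }
    ext₁ : Extension O (λ y → proj₁ y F.≈ F.0#) im-functional (1# ∷ []) (fst-functional ∷ [])
    ext₁ = extend isSubmodule gens full pf₀ im-functional (F.0# , coord F.0# F.1#) F.refl
             λ p → F.1≉0 (F.trans (F.sym (proj₂ (re-im-unique E′.refl))) p)
    module X₁ = Extension ext₁
    ext₂ : Extension O (λ y → proj₁ y F.≈ F.0# × im (proj₂ y) F.≈ F.0#) re-functional (X₁.v ∷ 1# ∷ [])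
      (X₁.χ ∷ fst-functional ∷ [])
    ext₂ = extend isSubmodule gens full X₁.extended re-functional (F.0# , coord F.1# F.0#)
      (F.refl , proj₂ (re-im-unique E′.refl))
             λ p → F.1≉0 (F.trans (F.sym (proj₁ (re-im-unique E′.refl))) p)
    module X₂ = Extension ext₂
    module PF = PartialFrame X₂.extended
    m n : ℤ
    m = X₂.exponent
    n = X₁.exponent
    c : F.Carrier
    c = re (proj₂ X₁.v)
    v₂≈e₁ : X₂.v ≈ Std.e₁ m n c
    v₂≈e₁ = proj₁ X₂.v∈K , E′.trans (coord-re-im _) (E′.trans (coord-cong X₂.φv (proj₂ X₂.v∈K)) (coord-ι _))
    v₁≈e₂ : X₁.v ≈ Std.e₂ m n c
    v₁≈e₂ = X₁.v∈K , E′.trans (coord-re-im _) (E′.trans (coord-cong F.refl X₁.φv) (E′.+-comm _ _))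
    O⊆ : O ⊆ Std.O m n c
    O⊆ {y} y∈O = S.resp (sym y≈) (comb∈ (X₂.χ ∷ X₁.χ ∷ fst-functional ∷ []) (X₂.v ∷ X₁.v ∷ 1# ∷ []) Std-sub w∈ {y}
      (λ i → PF.integral i y∈O))
      where
      Std-sub : IsSubmodule Δ𝒪 (Std.O m n c)
      Std-sub = Std.O-isSubmodule m n c
      module S = IsSubmodule Std-sub
      w∈ : ∀ i → (X₂.v ∷ X₁.v ∷ 1# ∷ []) i ∈ Std.O m n c
      w∈ zero             = S.resp (sym v₂≈e₁) (Std.basis∈O m n c (suc zero))
      w∈ (suc zero)       = S.resp (sym v₁≈e₂) (Std.basis∈O m n c (suc (suc zero)))
      w∈ (suc (suc zero)) = Std.basis∈O m n c zero
      y≈ : y ≈ comb (X₂.χ ∷ X₁.χ ∷ fst-functional ∷ []) (X₂.v ∷ X₁.v ∷ 1# ∷ []) y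
      y≈ = let ((fst≈0 , im≈0) , re≈0) = PF.residue y in
        x∙y⁻¹≈ε⇒x≈y _ _ (fst≈0 , E′.trans (coord-re-im _)
          (E′.trans (coord-cong re≈0 im≈0) (E′.trans (coord-ι F.0#) (proj₂ Δ-0))))
        where open import Algebra.Properties.AbelianGroup +-abelianGroup using (x∙y⁻¹≈ε⇒x≈y)
    ⊆O : Std.O m n c ⊆ O
    ⊆O = span⊆ isSubmodule (Std.basis m n c) λ
      { zero             → 1∈
      ; (suc zero)       → resp v₂≈e₁ (PF.w∈M zero)
      ; (suc (suc zero)) → resp v₁≈e₂ (PF.w∈M (suc zero)) }
    closed : 0ℤ ℤ.≤ m × 0ℤ ≤ord Std.A m n c × 0ℤ ≤ord Std.B m n c
    closed = Std.closed⇒ m n c (λ {y} {z} y∈ z∈ → O⊆ {y * z} (*-closed (⊆O {y} y∈) (⊆O {z} z∈)))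
    m≤N : m ≤ord Std.N m n c
    m≤N = t^-k*-integral⁻ π m (proj₂ (proj₂ closed))
    -- The exponents are abstracted to allow matching on them; negative values contradict the two
    -- inequalities among the arguments.
    conclude : ∀ m n c → 0ℤ ℤ.≤ m → m ≤ord Std.N m n c → 0ℤ ℤ.≤ n × c ∈ F.𝒪 → O ≐ Std.O m n c →
               ∃ λ a → ∃ λ b → ∃ λ c → c ∈ F.𝒪 × [ + a ] ≤⁺ orderBound b (F.ord c) × O ≐ 𝒪[ a , b , c ]
    conclude (+ a) (+ b) c _ m≤N (_ , c∈𝒪) O≐ = a , b , c , c∈𝒪 , ≡.subst ([ + a ] ≤⁺_) (ord-N≡orderBound (+ a) b c)
      m≤N , O≐

  -- Inclusion and equality of orders

  module Inclusion (a b : ℕ) (c : F.Carrier) (a′ b′ : ℕ) (c′ : F.Carrier) where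

    private
      module S  = StandardFrame F₀ E₀ π x (+ a) (+ b) c
      module S′ = StandardFrame F₀ E₀ π x (+ a′) (+ b′) c′
      d : ℤ
      d = + b ℤ.- + b′
      P^d : π F.^ (ℤ.- (+ b′)) F.* π F.^ (+ b) F.≈ π F.^ d
      P^d = F.trans (F.sym (^-homo-+ π (ℤ.- (+ b′)) (+ b)))
        (F.reflexive (≡.cong (π F.^_) (ℤ.+-comm (ℤ.- (+ b′)) (+ b))))
      β-e₁ : S′.β ⟨$⟩ S.e₁ F.≈ π F.^ (ℤ.- (+ a′)) F.* π F.^ (+ a)
      β-e₁ = F.trans (S′.β-coord {F.0#} (E′.sym (coord-ι (π F.^ (+ a)))))
        (F-solve 4 (λ P Q c R → P :*′ (Q :-′ con′ 0ℤ :-′ c :*′ (R :*′ con′ 0ℤ)) :=′ P :*′ Q) F.refl _ (π F.^ (+ a)) c′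
        (π F.^ (ℤ.- (+ b′))))
      γ-e₁ : S′.γ ⟨$⟩ S.e₁ F.≈ F.0#
      γ-e₁ = F.trans (S′.γ-coord {F.0#} (E′.sym (coord-ι (π F.^ (+ a))))) (F.zeroʳ _)
      β-e₂ : S′.β ⟨$⟩ S.e₂ F.≈ π F.^ (ℤ.- (+ a′)) F.* (c F.- π F.^ d F.* c′)
      β-e₂ = F.trans (S′.β-coord {F.0#} S.e₂≈)
        (F.*-congˡ (F.+-cong (F-solve 1 (λ c → c :-′ con′ 0ℤ :=′ c) F.refl c)
        (F.-‿cong (F.trans (F.*-comm c′ _) (F.*-congʳ P^d)))))
      γ-e₂ : S′.γ ⟨$⟩ S.e₂ F.≈ π F.^ (ℤ.- (+ b′)) F.* π F.^ (+ b)
      γ-e₂ = S′.γ-coord {F.0#} S.e₂≈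

    -- Inclusion means that e₁ and e₂ have integral coordinates in the primed basis. Three of these
    -- carry information: π^(a-a′), π^(b-b′) and π^(-a′) (c - π^d c′). Both cases of the criterion
    -- unfold the last one.
    contained⇒ : 𝒪[ a , b , c ] ⊆ 𝒪[ a′ , b′ , c′ ] → a′ ℕ.≤ a × b′ ℕ.≤ b × + a′ ≤ord (c F.- π F.^ d F.* c′)
    contained⇒ ⊆ = ℤ.drop‿+≤+ (≤ord⇒≤ (ord-^ π (+ a))
      (t^-k*-integral⁻ π (+ a′) (≤ord-resp β-e₁ (proj₁ (proj₂ (S′.∈O⇒integral (⊆ {S.e₁} (S.basis∈O (suc zero)))))))))
         , ℤ.drop‿+≤+ (≤ord⇒≤ (ord-^ π (+ b))
           (t^-k*-integral⁻ π (+ b′) (≤ord-resp γ-e₂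
           (proj₂ (proj₂ (S′.∈O⇒integral (⊆ {S.e₂} (S.basis∈O (suc (suc zero))))))))))
         , t^-k*-integral⁻ π (+ a′) (≤ord-resp β-e₂
           (proj₁ (proj₂ (S′.∈O⇒integral (⊆ {S.e₂} (S.basis∈O (suc (suc zero))))))))
    ⇒contained : a′ ℕ.≤ a × b′ ℕ.≤ b × + a′ ≤ord (c F.- π F.^ d F.* c′) → 𝒪[ a , b , c ] ⊆ 𝒪[ a′ , b′ , c′ ]
    ⇒contained (a′≤a , b′≤b , a′≤) = span⊆ S′.O-isSubmodule S.basis λ
      { zero             → S′.basis∈O zero
      ; (suc zero)       → S′.integral⇒∈O (≤ord-0 F.refl)
                             (≤ord-resp (F.sym β-e₁) (t^-k*-integral π (+ a′) (≤⇒≤ord (ord-^ π (+ a)) (ℤ.+≤+ a′≤a))))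
                             (≤ord-0 γ-e₁)
      ; (suc (suc zero)) → S′.integral⇒∈O (≤ord-0 F.refl)
                             (≤ord-resp (F.sym β-e₂) (t^-k*-integral π (+ a′) a′≤))
                             (≤ord-resp (F.sym γ-e₂) (t^-k*-integral π (+ b′) (≤⇒≤ord (ord-^ π (+ b)) (ℤ.+≤+ b′≤b))))
                               }

  ⌈/2⌉≤ : ∀ a {v} → + a ℤ.≤ v ℤ.+ v → + ⌈ a /2⌉ ℤ.≤ v
  ⌈/2⌉≤ a {+ v} (ℤ.+≤+ a≤v+v) = ℤ.+≤+ (≡.subst (⌈ a /2⌉ ℕ.≤_) (≡.sym (ℕ.n≡⌈n+n/2⌉ v)) (ℕ.⌈n/2⌉-mono a≤v+v))

  ≤ord-⊔ : ∀ {m n y} → m ≤ord y → n ≤ord y → (m ℤ.⊔ n) ≤ord y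
  ≤ord-⊔ {m} {n} {y} p q with ℤ.⊔-sel m n
  ... | inj₁ eq = ≤ord-mono y (ℤ.≤-reflexive eq) p
  ... | inj₂ eq = ≤ord-mono y (ℤ.≤-reflexive eq) q

  halves-order : ∀ a b c → IsOrder 𝒪[ a , b , c ] → + ⌈ a /2⌉ ≤ord c
  halves-order a b c isOrd with zero-or-ord c
  ... | inj₁ c≈0 = ≤ord-0 c≈0
  ... | inj₂ (v , ord≡v) = ≤⇒≤ord ord≡v
      (⌈/2⌉≤ a (proj₂ (order-bounds (+ a) (+ b) c (isOrder⇒≤ord-N a b c isOrd)) v ord≡v))

  <⁺⇒ord : ∀ {c n} → F.ord c <⁺ [ n ] → ∃ λ v → F.ord c ≡ [ v ] × v ℤ.+ 1ℤ ℤ.≤ n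
  <⁺⇒ord {c} {n} p = go (F.ord c) ≡.refl p
    where
    go : ∀ w → F.ord c ≡ w → w <⁺ [ n ] → ∃ λ v → F.ord c ≡ [ v ] × v ℤ.+ 1ℤ ℤ.≤ n
    go [ v ] eq [ v<n ] = v , eq , ≡.subst (ℤ._≤ n) (ℤ.+-comm 1ℤ v) (ℤ.i<j⇒suc[i]≤j v<n)

  ord⇒<⁺ : ∀ {c v n} → F.ord c ≡ [ v ] → v ℤ.+ 1ℤ ℤ.≤ n → F.ord c <⁺ [ n ]
  ord⇒<⁺ {v = v} {n} eq v<n = ≡.subst (_<⁺ [ n ]) (≡.sym eq) [ ℤ.suc[i]≤j⇒i<j (≡.subst (ℤ._≤ n) (ℤ.+-comm v 1ℤ) v<n) ]

  module InclusionCriterion (a b : ℕ) (c : F.Carrier) (a′ b′ : ℕ) (c′ : F.Carrier) where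

    open Inclusion a b c a′ b′ c′

    private
      d : ℤ
      d = + b ℤ.- + b′

      P^d : F.Carrier
      P^d = π F.^ d

      d+[a-d]≡a : ∀ a d → d ℤ.+ (a ℤ.- d) ≡ a
      d+[a-d]≡a = ℤ-solve 2 (λ a d → d ⊕ (a ⊖ d) ⊜ a) ≡.refl

      shift : ∀ {y} → + a′ ≤ord (P^d F.* y) → (+ a′ ℤ.- d) ≤ord y
      shift {y} p = ≤ord-cancel y (ord-^ π d) (≤ord-mono _ (ℤ.≤-reflexive (d+[a-d]≡a (+ a′) d)) p)

      unshift : ∀ {y} → (+ a′ ℤ.- d) ≤ord y → + a′ ≤ord (P^d F.* y)
      unshift {y} p = ≤ord-mono _ (ℤ.≤-reflexive (≡.sym (d+[a-d]≡a (+ a′) d))) (≤ord-^* π d y p)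

      P^d*[c′-P⁻c] : P^d F.* (c′ F.- π F.^ (ℤ.- d) F.* c) F.≈ F.- (c F.- P^d F.* c′)
      P^d*[c′-P⁻c] = begin
        P^d F.* (c′ F.- π F.^ (ℤ.- d) F.* c)            ≈⟨ F-solve 4
          (λ P Q c c′ → P :*′ (c′ :-′ Q :*′ c) :=′ P :*′ c′ :-′ P :*′ (Q :*′ c)) F.refl P^d (π F.^ (ℤ.- d)) c c′ ⟩
        P^d F.* c′ F.- P^d F.* (π F.^ (ℤ.- d) F.* c)    ≈⟨ F.+-congˡ (F.-‿cong (t^n*t^-n*y≈y π d c)) ⟩
        P^d F.* c′ F.- c                                ≈⟨ F-solve 2 (λ u c → u :-′ c :=′ :-′ (c :-′ u)) F.refl
          (P^d F.* c′) c ⟩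
        F.- (c F.- P^d F.* c′)                          ∎
        where open import Relation.Binary.Reasoning.Setoid F.setoid

      swap-sub : ∀ {k} y z → k ≤ord (y F.- z) → k ≤ord y → k ≤ord z
      swap-sub y z p r = ≤ord-resp (F-solve 2 (λ y z → y :-′ (y :-′ z) :=′ z) F.refl y z) (≤ord-- y (y F.- z) r p)

    InclusionCondition : Set _
    InclusionCondition = a′ ℕ.≤ a × b′ ℕ.≤ b
      × ([ + a′ ] ≤⁺ F.ord c → c′ ∈ F.⟨ π ^ + ⌈ a′ /2⌉ ℤ.⊔ (+ a′ ℤ.- d) ⟩)
      × (F.ord c <⁺ [ + a′ ] → (c′ F.- π F.^ (ℤ.- d) F.* c) ∈ F.⟨ π ^ + a′ ℤ.- d ⟩)

    -- If ord(c) ≥ a′, then `c` drops out of the congruence between `c` and π^d c′. The entry ⌈a′/2⌉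
    -- does not come from the inclusion: it is the bound a′ ≤ 2 ord(c′) valid in any order.
    inclusion⇔ : IsOrder 𝒪[ a′ , b′ , c′ ] → 𝒪[ a , b , c ] ⊆ 𝒪[ a′ , b′ , c′ ] ⇔ InclusionCondition
    inclusion⇔ isOrd′ = mk⇔ forward backward
      where
      to : a′ ℕ.≤ a × b′ ℕ.≤ b × + a′ ≤ord (c F.- P^d F.* c′) → InclusionCondition
      to (a′≤a , b′≤b , a′≤) = a′≤a , b′≤b ,
        (λ a′≤c → ≤ord⇒∈⟨^⟩ π {y = c′} (≤ord-⊔ {y = c′} (halves-order a′ b′ c′ isOrd′)
          (shift (swap-sub c (P^d F.* c′) a′≤ a′≤c)))) ,
        (λ _ → ≤ord⇒∈⟨^⟩ π {y = c′ F.- π F.^ (ℤ.- d) F.* c}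
          (shift (≤ord-resp (F.sym P^d*[c′-P⁻c]) (≤ord-neg (c F.- P^d F.* c′) a′≤))))
      from : InclusionCondition → a′ ℕ.≤ a × b′ ℕ.≤ b × + a′ ≤ord (c F.- P^d F.* c′)
      from (a′≤a , b′≤b , large , small) = a′≤a , b′≤b , a′≤ (≤ord-or-ord< (+ a′) c)
        where
        a′≤ : + a′ ≤ord c ⊎ (∃ λ v → v ℤ.+ 1ℤ ℤ.≤ + a′ × F.ord c ≡ [ v ]) → + a′ ≤ord (c F.- P^d F.* c′)
        a′≤ (inj₁ a′≤c) = ≤ord-- c (P^d F.* c′) a′≤c
          (unshift (≤ord-mono c′ (ℤ.i≤j⊔i (+ ⌈ a′ /2⌉) (+ a′ ℤ.- d)) (∈⟨^⟩⇒≤ord π (large a′≤c))))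
        a′≤ (inj₂ (v , v<a′ , ord≡v)) = ≤ord-resp (F-solve 1 (λ y → :-′ (:-′ y) :=′ y) F.refl (c F.- P^d F.* c′))
          (≤ord-neg (F.- (c F.- P^d F.* c′))
            (≤ord-resp P^d*[c′-P⁻c] (unshift (∈⟨^⟩⇒≤ord π (small (ord⇒<⁺ {c} ord≡v v<a′))))))

      forward : 𝒪[ a , b , c ] ⊆ 𝒪[ a′ , b′ , c′ ] → InclusionCondition
      forward O⊆ = to (contained⇒ (λ {y} → O⊆ {y}))
      backward : InclusionCondition → 𝒪[ a , b , c ] ⊆ 𝒪[ a′ , b′ , c′ ]
      backward cond = ⇒contained (from cond)

    -- π^d c′ differs from `c` by an element of valuation at least a′ > ord(c), so both have the
    -- same valuation. Integrality of `c′` then gives d ≤ ord(c) < a′.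
    inclusion-ord : c′ ∈ F.𝒪 → IsOrder 𝒪[ a′ , b′ , c′ ] →
      𝒪[ a , b , c ] ⊆ 𝒪[ a′ , b′ , c′ ] → F.ord c <⁺ [ + a′ ] →
      [ + ⌈ a′ /2⌉ ] ≤⁺ (F.ord c +∞ [ ℤ.- d ]) × F.ord c +∞ [ ℤ.- d ] ≡ F.ord c′ × 0ℤ ℤ.< + a′ ℤ.- d
    inclusion-ord c′∈𝒪 isOrd′ O⊆ c<a′ = go (<⁺⇒ord {c} c<a′) (zero-or-ord c′)
      where
      go : (∃ λ v → F.ord c ≡ [ v ] × v ℤ.+ 1ℤ ℤ.≤ + a′) → c′ F.≈ F.0# ⊎ (∃ λ k → F.ord c′ ≡ [ k ]) →
           [ + ⌈ a′ /2⌉ ] ≤⁺ (F.ord c +∞ [ ℤ.- d ]) × F.ord c +∞ [ ℤ.- d ] ≡ F.ord c′ × 0ℤ ℤ.< + a′ ℤ.- d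
      go (v , ord≡v , v<a′) c′-ord = cases c′-ord
        where
        ord-P^d*c′ : F.ord (P^d F.* c′) ≡ [ v ]
        ord-P^d*c′ = ≡.trans (F.ord-cong (F-solve 2 (λ c u → u :=′ c :+′ (:-′ (c :-′ u))) F.refl c (P^d F.* c′)))
          (ord-+-strict ord≡v (≤ord-mono (F.- (c F.- P^d F.* c′)) v<a′
            (≤ord-neg (c F.- P^d F.* c′) (proj₂ (proj₂ (contained⇒ (λ {y} → O⊆ {y})))))))
        cases : c′ F.≈ F.0# ⊎ (∃ λ k → F.ord c′ ≡ [ k ]) →
                [ + ⌈ a′ /2⌉ ] ≤⁺ (F.ord c +∞ [ ℤ.- d ]) × F.ord c +∞ [ ℤ.- d ] ≡ F.ord c′ × 0ℤ ℤ.< + a′ ℤ.- d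
        cases (inj₁ c′≈0) = contradiction (F.trans (F.*-congˡ c′≈0) (F.zeroʳ P^d)) (ord-finite⇒≉0 ord-P^d*c′)
        cases (inj₂ (k , ord≡k)) = ≡.subst ([ + ⌈ a′ /2⌉ ] ≤⁺_) (≡.sym ord-c′) (halves-order a′ b′ c′ isOrd′) , ord-c′
          ,
          ℤ.suc[i]≤j⇒i<j (1≤a-d (+ a′) d k (≤ord⇒≤ ord≡k c′∈𝒪) (≡.subst (λ w → w ℤ.+ 1ℤ ℤ.≤ + a′) v≡d+k v<a′))
          where
          1≤a-d : ∀ a d k → 0ℤ ℤ.≤ k → d ℤ.+ k ℤ.+ 1ℤ ℤ.≤ a → 1ℤ ℤ.≤ a ℤ.- d
          1≤a-d a d k p q = lin₂ 0 p q (ℤ-solve 3 (λ a d k → a ⊖ d ⊖ κ 1ℤ ⊜ k ⊖ κ 0ℤ ⊕ (a ⊖ (d ⊕ k ⊕ κ 1ℤ)) ⊕ κ 0ℤ)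
            ≡.refl a d k)
          v≡d+k : v ≡ d ℤ.+ k
          v≡d+k = []-injective (≡.trans (≡.sym ord-P^d*c′) (ord-*-finite (ord-^ π d) ord≡k))
          ord-c′ : F.ord c +∞ [ ℤ.- d ] ≡ F.ord c′
          ord-c′ = ≡.trans (≡.cong (_+∞ [ ℤ.- d ]) ord≡v) (≡.trans (≡.cong [_] (≡.trans (≡.cong (ℤ._+ (ℤ.- d)) v≡d+k)
            (ℤ-solve 2 (λ d k → d ⊕ k ⊖ d ⊜ k) ≡.refl d k))) (≡.sym ord≡k))

  equality⇔ : ∀ a b c a′ b′ c′ →
    𝒪[ a′ , b′ , c′ ] ≐ 𝒪[ a , b , c ] ⇔ (a ≡ a′ × b ≡ b′ × (c F.- c′) ∈ F.⟨ π ^ + a ⟩)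
  equality⇔ a b c a′ b′ c′ = mk⇔ to from
    where
    P⁰≈1 : ∀ b → π F.^ (+ b ℤ.- + b) F.≈ F.1#
    P⁰≈1 b = F.reflexive (≡.cong (π F.^_) (ℤ.+-inverseʳ (+ b)))
    c-P⁰c′ : ∀ b c c′ → c F.- π F.^ (+ b ℤ.- + b) F.* c′ F.≈ c F.- c′
    c-P⁰c′ b c c′ = F.+-congˡ (F.-‿cong (F.trans (F.*-congʳ (P⁰≈1 b)) (F.*-identityˡ c′)))
    to : 𝒪[ a′ , b′ , c′ ] ≐ 𝒪[ a , b , c ] → a ≡ a′ × b ≡ b′ × (c F.- c′) ∈ F.⟨ π ^ + a ⟩
    to (O′⊆O , O⊆O′) = antisym (Inclusion.contained⇒ a b c a′ b′ c′ (λ {y} → O⊆O′ {y}))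
      (Inclusion.contained⇒ a′ b′ c′ a b c (λ {y} → O′⊆O {y}))
      where
      antisym : a′ ℕ.≤ a × b′ ℕ.≤ b × + a′ ≤ord (c F.- π F.^ (+ b ℤ.- + b′) F.* c′) →
                a ℕ.≤ a′ × b ℕ.≤ b′ × + a ≤ord (c′ F.- π F.^ (+ b′ ℤ.- + b) F.* c) →
                a ≡ a′ × b ≡ b′ × (c F.- c′) ∈ F.⟨ π ^ + a ⟩
      antisym (a′≤a , b′≤b , p) (a≤a′ , b≤b′ , _) with ℕ.≤-antisym a≤a′ a′≤a | ℕ.≤-antisym b≤b′ b′≤b
      ... | ≡.refl | ≡.refl = ≡.refl , ≡.refl , ≤ord⇒∈⟨^⟩ π (≤ord-resp (c-P⁰c′ b c c′) p)
    from : a ≡ a′ × b ≡ b′ × (c F.- c′) ∈ F.⟨ π ^ + a ⟩ → 𝒪[ a′ , b′ , c′ ] ≐ 𝒪[ a , b , c ]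
    from (≡.refl , ≡.refl , c-c′∈) =
      (λ {y} → Inclusion.⇒contained a b c′ a b c (ℕ.≤-refl , ℕ.≤-refl , ≤ord-resp (F.sym (c-P⁰c′ b c′ c))
        (≤ord-resp (F-solve 2 (λ c c′ → :-′ (c :-′ c′) :=′ c′ :-′ c) F.refl c c′) (≤ord-neg _ a≤))) {y}) ,
      (λ {y} → Inclusion.⇒contained a b c a b c′ (ℕ.≤-refl , ℕ.≤-refl , ≤ord-resp (F.sym (c-P⁰c′ b c c′)) a≤) {y})
      where
      a≤ : + a ≤ord (c F.- c′)
      a≤ = ∈⟨^⟩⇒≤ord π c-c′∈


  -- The length of the maximal order modulo an order

  Least : ∀ {p} → (ℕ → Set p) → ℕ → Set p
  Least P n = P n × (∀ m → P m → n ℕ.≤ m)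

  -- The predicate is not decidable, so well-founded induction only refutes the absence of a least
  -- element.
  ¬¬-least : ∀ {p} (P : ℕ → Set p) {n} → P n → ¬ ¬ (∃ λ n → Least P n)
  ¬¬-least P Pn no-least = <-rec (λ n → ¬ P n) (λ n ih Pn → no-least (n , Pn , λ m Pm → ℕ.≮⇒≥ (λ m<n → ih m<n Pm))) _
    Pn

  -- For an 𝒪-module between 𝒪[ a , b , c ] and the maximal order, the least
  -- elements of the following two sets of valuations drop in total by at
  -- least one at each proper inclusion.
  ImOrd FOrd : Subset → ℕ → Set _
  ImOrd M j = ∃ λ y → y ∈ M × F.ord (im (proj₂ y)) ≡ [ + j ]
  FOrd M j = ∃ λ t → (F.0# , E′.ι t) ∈ M × F.ord t ≡ [ + j ]

  nonneg-ord : ∀ y → 0ℤ ≤ord y → y F.≈ F.0# ⊎ (∃ λ l → F.ord y ≡ [ + l ])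
  nonneg-ord y 0≤y with zero-or-ord y
  ... | inj₁ y≈0 = inj₁ y≈0
  ... | inj₂ (+ l , eq) = inj₂ (l , eq)
  ... | inj₂ (-[1+ l ] , eq) with () ← ≤ord⇒≤ eq 0≤y

  divide : ∀ {y z j} → F.ord z ≡ [ + j ] → 0ℤ ≤ord y → (∀ l → F.ord y ≡ [ + l ] → j ℕ.≤ l) →
           ∃ λ t → 0ℤ ≤ord t × y F.≈ t F.* z
  divide {y} {z} {j} eq 0≤y j≤ with invert eq
  ... | z⁻¹ , z⁻¹z≈1 , ord-z⁻¹ = y F.* z⁻¹ , 0≤t (nonneg-ord y 0≤y) ,
        F.trans (F.sym (F.*-identityʳ y)) (F.trans (F.*-congˡ (F.sym z⁻¹z≈1)) (F.sym (F.*-assoc y z⁻¹ z)))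
    where
    0≤t : y F.≈ F.0# ⊎ (∃ λ l → F.ord y ≡ [ + l ]) → 0ℤ ≤ord (y F.* z⁻¹)
    0≤t (inj₁ y≈0) = ≤ord-0 (F.trans (F.*-congʳ y≈0) (F.zeroˡ z⁻¹))
    0≤t (inj₂ (l , ord-y)) = ≤⇒≤ord (ord-*-finite ord-y ord-z⁻¹) (ℤ.i≤j⇒0≤j-i (ℤ.+≤+ (j≤ l ord-y)))

  module _ {M N : Subset} (subM : IsSubmodule Δ𝒪 M) (subN : IsSubmodule Δ𝒪 N) (1∈M : 1# ∈ M)
           (M⊆N : M ⊆ N) (N⊆𝒪E : N ⊆ 𝒪E) where

    private
      module M = IsSubmodule subM
      module N = IsSubmodule subN

    -- Division with remainder: a multiple of `w` clears the x-coordinate of an element of N, a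
    -- multiple of 1 clears the first coordinate, and what is left, of the form (0 , ι r), is a
    -- multiple of (0 , ι z). All quotients are integral because the minima of M are also lower
    -- bounds on N.
    equal-least⇒⊆ : ∀ {j t} → ImOrd M j → FOrd M t → (∀ l → ImOrd N l → j ℕ.≤ l) → (∀ l → FOrd N l → t ℕ.≤ l) → N ⊆ M
    equal-least⇒⊆ {j} {t} (w , w∈M , ord-w) (z , z∈M , ord-z) j≤ t≤ {y} y∈N = M.resp (sym y≈)
      (M.+-closed (⋆-closed subM 0≤g w∈M) (M.+-closed (⋆-closed subM 0≤f 1∈M) (⋆-closed subM 0≤h z∈M)))
      where
      dg : ∃ λ g → 0ℤ ≤ord g × im (proj₂ y) F.≈ g F.* im (proj₂ w)
      dg = divide ord-w (proj₂ (re-im-integral (proj₂ (N⊆𝒪E y∈N)))) (λ l eq → j≤ l (y , y∈N , eq))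
      g f h : F.Carrier
      g = proj₁ dg
      0≤g : 0ℤ ≤ord g
      0≤g = proj₁ (proj₂ dg)
      y′ : Carrier
      y′ = y - g ⋆ w
      y′∈N : y′ ∈ N
      y′∈N = ∸-closed subN y∈N (⋆-closed subN 0≤g (M⊆N w∈M))
      im-y′ : im (proj₂ y′) F.≈ F.0#
      im-y′ = F.trans (Functional.⟨$⟩-- im-functional y (g ⋆ w))
        (F.trans (F.+-cong (proj₂ (proj₂ dg)) (F.-‿cong (Functional.⟨$⟩-⋆ im-functional g w))) (F.-‿inverseʳ _))
      f = proj₁ y′
      0≤f : 0ℤ ≤ord f
      0≤f = proj₁ (N⊆𝒪E y′∈N)
      r : F.Carrier
      r = re (proj₂ y′) F.- f
      y″≈ : y′ - f ⋆ 1# ≈ (F.0# , E′.ι r)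
      y″≈ = F-solve 1 (λ f → f :-′ f :*′ con′ 1ℤ :=′ con′ 0ℤ) F.refl f , (begin
        proj₂ y′ E′.- E′.ι f E′.* E′.1#                            ≈⟨ E′.+-cong (coord-re-im (proj₂ y′))
          (E′.-‿cong (E′.*-identityʳ _)) ⟩
        coord (re (proj₂ y′)) (im (proj₂ y′)) E′.- E′.ι f           ≈⟨ E′.+-cong (coord-cong F.refl im-y′)
          (E′.-‿cong (E′.sym (coord-ι f))) ⟩
        coord (re (proj₂ y′)) F.0# E′.- coord f F.0#                ≈⟨ coord-- _ _ _ _ ⟩
        coord r (F.0# F.- F.0#)                                     ≈⟨ coord-cong F.refl (F.-‿inverseʳ F.0#) ⟩
        coord r F.0#                                                ≈⟨ coord-ι r ⟩
        E′.ι r                                                      ∎)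
        where open import Relation.Binary.Reasoning.Setoid E′.setoid
      y″∈N : (F.0# , E′.ι r) ∈ N
      y″∈N = N.resp y″≈ (∸-closed subN y′∈N (⋆-closed subN 0≤f (M⊆N 1∈M)))
      dh : ∃ λ h → 0ℤ ≤ord h × r F.≈ h F.* z
      dh = divide ord-z (proj₁ (coord-integral⇐ (E′≤.≤ord-resp (E′.sym (coord-ι r)) (proj₂ (N⊆𝒪E y″∈N)))))
        (λ l eq → t≤ l (r , y″∈N , eq))
        where module E′≤ = Valuation E′.discretelyValuedField
      h = proj₁ dh
      0≤h : 0ℤ ≤ord h
      0≤h = proj₁ (proj₂ dh)
      y″≈h⋆z : (F.0# , E′.ι r) ≈ h ⋆ (F.0# , E′.ι z)
      y″≈h⋆z = F.sym (F.zeroʳ h) , E′.trans (proj₂ (Δ-cong (proj₂ (proj₂ dh)))) (proj₂ (Δ-* h z))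
      y≈ : y ≈ g ⋆ w + (f ⋆ 1# + h ⋆ (F.0# , E′.ι z))
      y≈ = begin
        y                                             ≈⟨ solve 3 (λ y u v → y := u :+ (v :+ (y :- u :- v))) refl y
          (g ⋆ w) (f ⋆ 1#) ⟩
        g ⋆ w + (f ⋆ 1# + (y′ - f ⋆ 1#))              ≈⟨ +-congˡ (+-congˡ (trans y″≈ y″≈h⋆z)) ⟩
        g ⋆ w + (f ⋆ 1# + h ⋆ (F.0# , E′.ι z))        ∎
        where open import Relation.Binary.Reasoning.Setoid setoid

  module _ (a b : ℕ) (c : F.Carrier) (c∈𝒪 : c ∈ F.𝒪) where

    ⊆-smaller : ∀ {a b a′ b′} → a′ ℕ.≤ a → b′ ℕ.≤ b → b′ ≡ b ⊎ a′ ≡ 0 → 𝒪[ a , b , c ] ⊆ 𝒪[ a′ , b′ , c ]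
    ⊆-smaller {a} {b} {a′} {b′} a′≤a b′≤b (inj₁ ≡.refl) = Inclusion.⇒contained a b c a′ b c
      (a′≤a , b′≤b , ≤ord-0 (begin
        c F.- π F.^ (+ b ℤ.- + b) F.* c    ≡⟨ ≡.cong (λ d → c F.- π F.^ d F.* c) (ℤ.+-inverseʳ (+ b)) ⟩
        c F.- F.1# F.* c                   ≈⟨ F-solve 1 (λ c → c :-′ con′ 1ℤ :*′ c :=′ con′ 0ℤ) F.refl c ⟩
        F.0#                               ∎))
      where open import Relation.Binary.Reasoning.Setoid F.setoid
    ⊆-smaller {a} {b} {_} {b′} a′≤a b′≤b (inj₂ ≡.refl) = Inclusion.⇒contained a b c 0 b′ c (a′≤a , b′≤b ,
      ≤ord-- c _ c∈𝒪 (≤ord-*-integral _ c (≤⇒≤ord (ord-^ π (+ b ℤ.- + b′)) (ℤ.i≤j⇒0≤j-i (ℤ.+≤+ b′≤b))) c∈𝒪))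

    ⊆𝒪E : ∀ a b → 𝒪[ a , b , c ] ⊆ 𝒪E
    ⊆𝒪E a b {y} y∈O = let (p , q , r) = S.∈O⇒integral y∈O in
      p , E′≤.≤ord-resp (E′.sym (E′.trans (proj₂ (S.expand-elt y)) (S.elt-snd _ _ _)))
        (coord-integral⇒ (≤ord-+ _ _ (≤ord-+ _ _ p (≤ord-*-integral _ _ q (S.0≤ord-P {+ a} (ℤ.+≤+ ℕ.z≤n))))
          (≤ord-*-integral _ _ r c∈𝒪))
                         (≤ord-*-integral _ _ r (S.0≤ord-P {+ b} (ℤ.+≤+ ℕ.z≤n))))
      where
      module S = StandardFrame F₀ E₀ π x (+ a) (+ b) c
      module E′≤ = Valuation E′.discretelyValuedField

    -- The exponent `a` descends to 0 before `b` moves. With `c` fixed, lowering `b` requires c ≡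
    -- π^d c modulo π^a′, which is automatic once a′ = 0. Truncated subtraction keeps `b` constant
    -- during the first `a` steps.
    chain-a chain-b : ℕ → ℕ
    chain-a i = a ℕ.∸ i
    chain-b i = b ℕ.∸ (i ℕ.∸ a)

    chain-flat : ∀ i → chain-b i ≡ b ⊎ chain-a i ≡ 0
    chain-flat i with ℕ.≤-total i a
    ... | inj₁ i≤a = inj₁ (≡.cong (b ℕ.∸_) (ℕ.m≤n⇒m∸n≡0 i≤a))
    ... | inj₂ a≤i = inj₂ (ℕ.m≤n⇒m∸n≡0 a≤i)

    chain-step : ∀ i → i ℕ.< a ℕ.+ b → 𝒪[ chain-a i , chain-b i , c ] ⊂ 𝒪[ chain-a (suc i) , chain-b (suc i) , c ]
    chain-step i i<a+b = (λ {y} → ⊆-smaller {chain-a i} {chain-b i} a-mono b-mono flat {y}) ,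
      λ ⊇ → let (a≤ , b≤ , _) = Inclusion.contained⇒ (chain-a (suc i)) (chain-b (suc i)) c (chain-a i) (chain-b i) c (λ {y} → ⊇ {y}) in strict a≤ b≤
      where
      a-mono : chain-a (suc i) ℕ.≤ chain-a i
      a-mono = ℕ.∸-monoʳ-≤ a (ℕ.n≤1+n i)
      b-mono : chain-b (suc i) ℕ.≤ chain-b i
      b-mono = ℕ.∸-monoʳ-≤ b (ℕ.∸-monoˡ-≤ a (ℕ.n≤1+n i))
      flat : chain-b (suc i) ≡ chain-b i ⊎ chain-a (suc i) ≡ 0
      flat with ℕ.≤-<-connex (suc i) a
      ... | inj₁ i<a = inj₁ (≡.cong (b ℕ.∸_) (≡.trans (ℕ.m≤n⇒m∸n≡0 i<a) (≡.sym (ℕ.m≤n⇒m∸n≡0 (ℕ.<⇒≤ i<a)))))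
      ... | inj₂ a<i = inj₂ (ℕ.m≤n⇒m∸n≡0 (ℕ.<⇒≤ a<i))
      strict : chain-a i ℕ.≤ chain-a (suc i) → ¬ (chain-b i ℕ.≤ chain-b (suc i))
      strict a≤ b≤ with ℕ.≤-<-connex (suc i) a
      ... | inj₁ i<a = ℕ.<⇒≱ (ℕ.∸-monoʳ-< (ℕ.n<1+n i) i<a) a≤
      ... | inj₂ (ℕ.s≤s a≤i) = ℕ.<⇒≱ (ℕ.∸-monoʳ-< (ℕ.≤-reflexive (≡.sym (ℕ.+-∸-assoc 1 a≤i)))
          (ℕ.m≤n+o⇒m∸n≤o (suc i) a i<a+b)) b≤

    chain : QuotientChain Δ𝒪 𝒪[ a , b , c ] 𝒪E (a ℕ.+ b)
    chain = record
      { member      = λ i → 𝒪[ chain-a (toℕ i) , chain-b (toℕ i) , c ]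
      ; isSubmodule = λ i → Std.O-isSubmodule (+ chain-a (toℕ i)) (+ chain-b (toℕ i)) c
      ; lower       = λ i {y} → ⊆-smaller {a} {b} (ℕ.m∸n≤m a (toℕ i)) (ℕ.m∸n≤m b (toℕ i ℕ.∸ a)) (chain-flat (toℕ i))
        {y}
      ; upper       = λ i {y} → ⊆𝒪E (chain-a (toℕ i)) (chain-b (toℕ i)) {y}
      ; strict      = λ i → ≡.subst (λ j → 𝒪[ chain-a j , chain-b j , c ] ⊂ 𝒪[ chain-a (suc (toℕ i)) , chain-b
        (suc (toℕ i)) , c ])
                              (≡.sym (Fin.toℕ-inject₁ i)) (chain-step (toℕ i) (Fin.toℕ<n i))
      }

    module _ {k : ℕ} (C : QuotientChain Δ𝒪 𝒪[ a , b , c ] 𝒪E k) where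

      open QuotientChain C
      private module S = StandardFrame F₀ E₀ π x (+ a) (+ b) c

      -- The invariant of the induction along the chain. At the bottom, e₂ and e₁ bound the two
      -- minima by `b` and `a`; each step raises the index by one and lowers the sum of the minima
      -- by at least one.
      Bound : Fin (suc k) → Set _
      Bound i = ∃ λ j → ∃ λ t → Least (ImOrd (member i)) j × Least (FOrd (member i)) t × toℕ i ℕ.+ (j ℕ.+ t) ℕ.≤ a ℕ.+
        b

      ImOrd-b : ∀ i → ImOrd (member i) b
      ImOrd-b i = S.e₂ , lower i (S.basis∈O (suc (suc zero))) , ≡.trans (F.ord-cong (proj₂ (re-im-unique S.e₂≈)))
        (ord-^ π (+ b))

      FOrd-a : ∀ i → FOrd (member i) a
      FOrd-a i = π F.^ (+ a) , lower i (S.basis∈O (suc zero)) , ord-^ π (+ a)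

      bound : ∀ i → ¬ ¬ Bound i
      bound = <-weakInduction (λ i → ¬ ¬ Bound i) base step
        where
        base : ¬ ¬ Bound zero
        base ¬bound = ¬¬-least (ImOrd (member zero)) (ImOrd-b zero) λ (j , least-j) →
          ¬¬-least (FOrd (member zero)) (FOrd-a zero) λ (t , least-t) →
          ¬bound (j , t , least-j , least-t , ≡.subst (ℕ._≤ a ℕ.+ b) (ℕ.+-comm t j)
            (ℕ.+-mono-≤ (proj₂ least-t a (FOrd-a zero)) (proj₂ least-j b (ImOrd-b zero))))
        step : ∀ i → ¬ ¬ Bound (inject₁ i) → ¬ ¬ Bound (suc i)
        step i ih ¬bound = ih λ (j , t , (im-j , _) , (F-t , _) , ≤a+b) →
          ¬¬-least (ImOrd (member (suc i))) (ImOrd-b (suc i)) λ (j′ , least-j′) →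
          ¬¬-least (FOrd (member (suc i))) (FOrd-a (suc i)) λ (t′ , least-t′) →
          let M⊆N = proj₁ (strict i)
              j′≤j = proj₂ least-j′ j (let (y , y∈M , eq) = im-j in y , M⊆N y∈M , eq)
              t′≤t = proj₂ least-t′ t (let (r , r∈M , eq) = F-t in r , M⊆N r∈M , eq)
              1∈M = lower (inject₁ i) (S.basis∈O zero)
              N⊈M = proj₂ (strict i)
              -- Both minima can only decrease. If their sum did not, each would be unchanged, and
              -- division with remainder would make the inclusion an equality.
              drop : j′ ℕ.+ t′ ℕ.< j ℕ.+ t
              drop = ℕ.≰⇒> λ j+t≤ →
                let j≤j′ = ℕ.+-cancelʳ-≤ t j j′ (ℕ.≤-trans j+t≤ (ℕ.+-monoʳ-≤ j′ t′≤t))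
                    t≤t′ = ℕ.+-cancelˡ-≤ j t t′ (ℕ.≤-trans j+t≤ (ℕ.+-monoˡ-≤ t′ j′≤j)) in
                N⊈M (λ {y} → equal-least⇒⊆ (isSubmodule (inject₁ i)) (isSubmodule (suc i)) 1∈M M⊆N (upper (suc i))
                  im-j F-t
                  (λ l l∈ → ℕ.≤-trans j≤j′ (proj₂ least-j′ l l∈)) (λ l l∈ → ℕ.≤-trans t≤t′ (proj₂ least-t′ l l∈)) {y})
          in ¬bound (j′ , t′ , least-j′ , least-t′ , ℕ.≤-trans
               (≡.subst (ℕ._≤ toℕ i ℕ.+ (j ℕ.+ t)) (ℕ.+-suc (toℕ i) (j′ ℕ.+ t′)) (ℕ.+-monoʳ-≤ (toℕ i) drop))
               (≡.subst (λ l → l ℕ.+ (j ℕ.+ t) ℕ.≤ a ℕ.+ b) (Fin.toℕ-inject₁ i) ≤a+b))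

      -- The inequality between natural numbers is decidable, so the double negation of `bound` can
      -- be removed; at the top of the chain the minima are dropped as nonnegative.
      chain-length≤ : k ℕ.≤ a ℕ.+ b
      chain-length≤ = decidable-stable (k ℕ.≤? (a ℕ.+ b)) λ k≰ → bound (fromℕ k) λ (j , t , _ , _ , ≤a+b) →
        k≰ (ℕ.≤-trans (ℕ.m≤m+n k (j ℕ.+ t)) (≡.subst (λ l → l ℕ.+ (j ℕ.+ t) ℕ.≤ a ℕ.+ b) (Fin.toℕ-fromℕ k) ≤a+b))

    quotientLength : S[ 𝒪[ a , b , c ] ]≡ (a ℕ.+ b)
    quotientLength = chain , λ k C → chain-length≤ C

  -- The conductor

  private module VE′ = Valuation E′.discretelyValuedField

  -- The maximum unfolded into its entries, with the final subtraction of 1 moved to the other side.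
  -- It cancels the 1 in the two odd entries and survives only beside 2a.
  ExponentBound : ℕ → ℕ → ℤ∞ → ℤ → Set
  ExponentBound a b v n = + a ℤ.+ + a ℤ.≤ n ℤ.+ 1ℤ × + b ℤ.+ + b ℤ.≤ n ×
    (∀ w → v ≡ [ w ] → (+ a ℤ.+ + b ℤ.- w) ℤ.+ (+ a ℤ.+ + b ℤ.- w) ℤ.≤ n)

  conductorExponent≤⇔ : ∀ a b v n → conductorExponent a b v ℤ.≤ n ⇔ ExponentBound a b v n
  conductorExponent≤⇔ a b v n = mk⇔ (to v) (from v)
    where
    2a≡ : + (2 ℕ.* a) ≡ + a ℤ.+ + a
    2a≡ = ≡.cong (λ k → + (a ℕ.+ k)) (ℕ.+-identityʳ a)
    third : ℤ → ℤ
    third w = + (2 ℕ.* a ℕ.+ 2 ℕ.* b) ℤ.- + 2 ℤ.* w ℤ.+ 1ℤ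
    third≡ : ∀ w → third w ≡ (+ a ℤ.+ + b ℤ.- w) ℤ.+ (+ a ℤ.+ + b ℤ.- w) ℤ.+ 1ℤ
    third≡ w = ≡.trans
      (≡.cong₂ (λ k l → + (k ℕ.+ l) ℤ.- + 2 ℤ.* w ℤ.+ 1ℤ) (≡.cong (a ℕ.+_) (ℕ.+-identityʳ a))
        (≡.cong (b ℕ.+_) (ℕ.+-identityʳ b)))
      (ℤ-solve 3 (λ a b w → (a ⊕ a ⊕ (b ⊕ b)) ⊖ κ (+ 2) ⊗ w ⊕ κ 1ℤ ⊜ (a ⊕ b ⊖ w) ⊕ (a ⊕ b ⊖ w) ⊕ κ 1ℤ) ≡.refl (+ a)
        (+ b) w)
    pred≤⇒ : ∀ {m n} → m ℤ.- 1ℤ ℤ.≤ n → m ℤ.≤ n ℤ.+ 1ℤ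
    pred≤⇒ {m} {n} p = lin₁ 0 p (ℤ-solve 2 (λ m n → n ⊕ κ 1ℤ ⊖ m ⊜ n ⊖ (m ⊖ κ 1ℤ) ⊕ κ 0ℤ) ≡.refl m n)
    pred≤⇐ : ∀ {m n} → m ℤ.≤ n ℤ.+ 1ℤ → m ℤ.- 1ℤ ℤ.≤ n
    pred≤⇐ {m} {n} p = lin₁ 0 p (ℤ-solve 2 (λ m n → n ⊖ (m ⊖ κ 1ℤ) ⊜ n ⊕ κ 1ℤ ⊖ m ⊕ κ 0ℤ) ≡.refl m n)
    cancel-1 : ∀ {m n} → m ℤ.+ 1ℤ ℤ.≤ n ℤ.+ 1ℤ → m ℤ.≤ n
    cancel-1 {m} {n} p = lin₁ 0 p (ℤ-solve 2 (λ m n → n ⊖ m ⊜ n ⊕ κ 1ℤ ⊖ (m ⊕ κ 1ℤ) ⊕ κ 0ℤ) ≡.refl m n)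
    two : ∀ {n} → + (2 ℕ.* a) ℤ.⊔ + (2 ℕ.* b ℕ.+ 1) ℤ.≤ n ℤ.+ 1ℤ → + a ℤ.+ + a ℤ.≤ n ℤ.+ 1ℤ × + b ℤ.+ + b ℤ.≤ n
    two {n} p = ≡.subst (ℤ._≤ n ℤ.+ 1ℤ) 2a≡ (ℤ.≤-trans (ℤ.i≤i⊔j (+ (2 ℕ.* a)) (+ (2 ℕ.* b ℕ.+ 1))) p) ,
                cancel-1 (≡.subst (ℤ._≤ n ℤ.+ 1ℤ) (≡.sym (2b+1≡ b))
                  (ℤ.≤-trans (ℤ.i≤j⊔i (+ (2 ℕ.* a)) (+ (2 ℕ.* b ℕ.+ 1))) p))
    to : ∀ v → conductorExponent a b v ℤ.≤ n → ExponentBound a b v n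
    to ⊤⁺ p = let (q , r) = two (pred≤⇒ p) in q , r , λ w ()
    to [ w ] p = let (q , r) = two (ℤ.≤-trans (ℤ.i≤i⊔j (+ (2 ℕ.* a) ℤ.⊔ + (2 ℕ.* b ℕ.+ 1)) (third w)) (pred≤⇒ p)) in q
      , r ,
      λ { _ ≡.refl → cancel-1 (≡.subst (ℤ._≤ n ℤ.+ 1ℤ) (third≡ w)
        (ℤ.≤-trans (ℤ.i≤j⊔i (+ (2 ℕ.* a) ℤ.⊔ + (2 ℕ.* b ℕ.+ 1)) (third w)) (pred≤⇒ p))) }
    two⁻ : + a ℤ.+ + a ℤ.≤ n ℤ.+ 1ℤ → + b ℤ.+ + b ℤ.≤ n → + (2 ℕ.* a) ℤ.⊔ + (2 ℕ.* b ℕ.+ 1) ℤ.≤ n ℤ.+ 1ℤ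
    two⁻ q r = ℤ.⊔-lub (≡.subst (ℤ._≤ n ℤ.+ 1ℤ) (≡.sym 2a≡) q) (≡.subst (ℤ._≤ n ℤ.+ 1ℤ) (2b+1≡ b) (ℤ.+-monoˡ-≤ 1ℤ r))
    from : ∀ v → ExponentBound a b v n → conductorExponent a b v ℤ.≤ n
    from ⊤⁺    (q , r , s) = pred≤⇐ (two⁻ q r)
    from [ w ] (q , r , s) = pred≤⇐
      (ℤ.⊔-lub (two⁻ q r) (≡.subst (ℤ._≤ n ℤ.+ 1ℤ) (≡.sym (third≡ w)) (ℤ.+-monoˡ-≤ 1ℤ (s w ≡.refl))))

  module _ (a b : ℕ) (c : F.Carrier) where

    private
      module S = StandardFrame F₀ E₀ π x (+ a) (+ b) c

      M : ℤ
      M = conductorExponent a b (F.ord c)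

      -- Chosen so that π^b x + c = π^b (x + κ′).
      κ′ : F.Carrier
      κ′ = π F.^ (ℤ.- (+ b)) F.* c

      ord-κ′ : ∀ {w} → F.ord c ≡ [ w ] → F.ord κ′ ≡ [ w ℤ.- + b ]
      ord-κ′ {w} eq = ≡.trans (ord-*-finite (ord-^ π (ℤ.- (+ b))) eq) (≡.cong [_] (ℤ.+-comm (ℤ.- (+ b)) w))

    ∈O⇔ : ∀ {u y r s} → y E′.≈ coord r s → (u , y) ∈ 𝒪[ a , b , c ] ⇔
      (0ℤ ≤ord u × + a ≤ord (r F.- u F.- κ′ F.* s) × + b ≤ord s)
    ∈O⇔ {u} {y} {r} {s} y≈ = mk⇔
      (λ ∈O → let (p , q , t) = S.∈O⇒integral ∈O in p , t^-k*-integral⁻ π (+ a) (≤ord-resp β≈ q) , t^-k*-integral⁻ π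
        (+ b) (≤ord-resp (S.γ-coord {u} y≈) t))
      (λ (p , q , t) → S.integral⇒∈O p (≤ord-resp (F.sym β≈) (t^-k*-integral π (+ a) q))
        (≤ord-resp (F.sym (S.γ-coord {u} y≈)) (t^-k*-integral π (+ b) t)))
      where
      β≈ : S.β ⟨$⟩ (u , y) F.≈ π F.^ (ℤ.- (+ a)) F.* (r F.- u F.- κ′ F.* s)
      β≈ = F.trans (S.β-coord {u} y≈)
        (F.*-congˡ (F.+-congˡ (F.-‿cong
        (F-solve 3 (λ c P s → c :*′ (P :*′ s) :=′ P :*′ c :*′ s) F.refl c (π F.^ (ℤ.- (+ b))) s))))

    ideal⇒∈O : ∀ {u y} → + a ≤ord u → M VE′.≤ord y → (u , y) ∈ 𝒪[ a , b , c ]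
    ideal⇒∈O {u} {y} a≤u M≤y = Equivalence.from (∈O⇔ (coord-re-im y)) (≤ord-mono u (ℤ.+≤+ ℕ.z≤n) a≤u ,
      ≤ord-- _ _ (≤ord-- _ _ a≤r a≤u) a≤κs , b≤s)
      where
      bounds : (∀ k → F.ord (re y) ≡ [ k ] → M ℤ.≤ k ℤ.+ k) × (∀ k → F.ord (im y) ≡ [ k ] → M ℤ.≤ k ℤ.+ k ℤ.+ 1ℤ)
      bounds = Equivalence.to ≤ord-coord (VE′.≤ord-resp (coord-re-im y) M≤y)
      exponent : ∀ n → M ℤ.≤ n → ExponentBound a b (F.ord c) n
      exponent n = Equivalence.to (conductorExponent≤⇔ a b (F.ord c) n)
      -- The coordinates `r` and `s` of valuation k contribute 2k and 2k + 1 in E′. Each of the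
      -- three bounds is an even number against at most an odd one, which `halve` resolves.
      a≤r : + a ≤ord re y
      a≤r = ≤ord-∀ λ k eq → halve {+ a} {k} (proj₁ (exponent _ (proj₁ bounds k eq)))
      b≤s : + b ≤ord im y
      b≤s = ≤ord-∀ λ k eq → halve {+ b} {k} (proj₁ (proj₂ (exponent _ (proj₂ bounds k eq))))
      a≤κs : + a ≤ord (κ′ F.* im y)
      a≤κs = go (zero-or-ord c)
        where
        go : c F.≈ F.0# ⊎ (∃ λ w → F.ord c ≡ [ w ]) → + a ≤ord (κ′ F.* im y)
        go (inj₁ c≈0) = ≤ord-0 (F.trans (F.*-congʳ (F.trans (F.*-congˡ c≈0) (F.zeroʳ _))) (F.zeroˡ _))
        go (inj₂ (w , eq)) = ≤ord-mono (κ′ F.* im y)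
          (ℤ.≤-reflexive (ℤ-solve 3 (λ a b w → a ⊜ w ⊖ b ⊕ (a ⊕ b ⊖ w)) ≡.refl (+ a) (+ b) w))
          (≤ord-* κ′ (im y) (ord≡⇒≤ord (ord-κ′ eq))
            (≤ord-∀ λ k eq′ → halve {+ a ℤ.+ + b ℤ.- w} {k} (proj₂ (proj₂ (exponent _ (proj₂ bounds k eq′))) w eq)))

    0≤M : 0ℤ ℤ.≤ M
    0≤M = ℤ.≤-trans (ℤ.+≤+ ℕ.z≤n) (proj₁ (proj₂ (Equivalence.to (conductorExponent≤⇔ a b (F.ord c) M) ℤ.≤-refl)))

    module _ {r s : F.Carrier} where

      private
        -- For y = r + s x, `A` and `iv` are the expressions that must be divisible by π^a for (0 ,
        -- y) and (0 , y x) to lie in the order. They are linear forms in `r` and `s`; eliminating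
        -- `r` leaves `D`, which is minus the norm of x + κ′.
        D A iv : F.Carrier
        D = p F.- (κ′ F.* κ′ F.+ κ′ F.* q)
        A = r F.- κ′ F.* s
        iv = s F.* p F.- κ′ F.* (r F.+ s F.* q)

        sD : s F.* D F.≈ iv F.+ κ′ F.* A
        sD = F-solve 5 (λ s p k q r → s :*′ (p :-′ (k :*′ k :+′ k :*′ q)) :=′ (s :*′ p :-′ k :*′ (r :+′ s :*′ q)) :+′
          k :*′ (r :-′ k :*′ s)) F.refl s p κ′ q r

        r≈ : r F.≈ A F.+ κ′ F.* s
        r≈ = F-solve 3 (λ r k s → r :=′ (r :-′ k :*′ s) :+′ k :*′ s) F.refl r κ′ s

        cancelˡ : ∀ {t k n} y → F.ord t ≡ [ k ] → n ≤ord (t F.* y) → (n ℤ.- k) ≤ord y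
        cancelˡ {t} {k} {n} y eq p = ≤ord-cancel y eq
          (≤ord-mono (t F.* y) (ℤ.≤-reflexive (ℤ-solve 2 (λ k n → k ⊕ (n ⊖ k) ⊜ n) ≡.refl k n)) p)

      CoordinateBounds : Set
      CoordinateBounds = (+ a ≤ord r × (∀ w → F.ord c ≡ [ w ] → (+ a ℤ.+ + b ℤ.- w) ≤ord r)) ×
                         ((+ a ℤ.- 1ℤ) ≤ord s × (∀ w → F.ord c ≡ [ w ] → (+ a ℤ.+ + b ℤ.- w) ≤ord s))

      -- `D` has valuation 1 if ord(κ′) ≥ 1, and 2k if ord(κ′) = k ≤ 0. Dividing by it bounds `s`.
      -- Then `r` is recovered from `A` in the first case and from `iv` in the second, where the
      -- division by κ′ again gives a - k = a + b - ord(c).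
      coordinateBounds : + a ≤ord A → + a ≤ord iv → CoordinateBounds
      coordinateBounds a≤A a≤iv = go (≤ord-or-ord< 1ℤ κ′)
        where
        go : 1ℤ ≤ord κ′ ⊎ (∃ λ k → k ℤ.+ 1ℤ ℤ.≤ 1ℤ × F.ord κ′ ≡ [ k ]) → CoordinateBounds
        go (inj₁ 1≤κ) = (a≤r , λ w eq → ≤ord-mono r (ℤ.≤-trans (≤a-1 w eq) (ℤ.i≤j⇒i-k≤j 1ℤ ℤ.≤-refl)) a≤r) ,
          (a-1≤s , λ w eq → ≤ord-mono s (≤a-1 w eq) a-1≤s)
          where
          ord-D : F.ord D ≡ [ 1ℤ ]
          ord-D = ord-+-strict ord-p (≤ord-neg _ (≤ord-+ _ _ (≤ord-* κ′ κ′ 1≤κ 1≤κ) (≤ord-* κ′ q 1≤κ 1≤ord-q)))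
          a-1≤s : (+ a ℤ.- 1ℤ) ≤ord s
          a-1≤s = cancelˡ s ord-D (≤ord-resp (F.trans (F.sym sD) (F.*-comm s D))
            (≤ord-+ iv (κ′ F.* A) a≤iv (≤ord-*-integral κ′ A (≤ord-mono κ′ (ℤ.+≤+ ℕ.z≤n) 1≤κ) a≤A)))
          a≤r : + a ≤ord r
          a≤r = ≤ord-resp (F.sym r≈) (≤ord-+ A _ a≤A
            (≤ord-mono (κ′ F.* s) (ℤ.≤-reflexive (ℤ-solve 1 (λ a → a ⊜ κ 1ℤ ⊕ (a ⊖ κ 1ℤ)) ≡.refl (+ a)))
            (≤ord-* κ′ s 1≤κ a-1≤s)))
          ≤a-1 : ∀ w → F.ord c ≡ [ w ] → + a ℤ.+ + b ℤ.- w ℤ.≤ + a ℤ.- 1ℤ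
          ≤a-1 w eq = lin₁ 0 (≤ord⇒≤ (ord-κ′ eq) 1≤κ)
            (ℤ-solve 3 (λ a b w → a ⊖ κ 1ℤ ⊖ (a ⊕ b ⊖ w) ⊜ w ⊖ b ⊖ κ 1ℤ ⊕ κ 0ℤ) ≡.refl (+ a) (+ b) w)
        go (inj₂ (k , k<1 , ord-κ)) = (≤ord-mono r a≤a-k a-k≤r , λ w eq → ≤ord-mono r (≡a-k w eq) a-k≤r) ,
                                      (≤ord-mono s (ℤ.≤-trans (ℤ.i≤j⇒i-k≤j 1ℤ ℤ.≤-refl) a≤a-k) a-k≤s , λ w eq →
                                        ≤ord-mono s (≡a-k w eq) a-k≤s)
          where
          k≤0 : k ℤ.≤ 0ℤ
          k≤0 = lin₁ 0 k<1 (ℤ-solve 1 (λ k → κ 0ℤ ⊖ k ⊜ κ 1ℤ ⊖ (k ⊕ κ 1ℤ) ⊕ κ 0ℤ) ≡.refl k)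
          a≤a-k : + a ℤ.≤ + a ℤ.- k
          a≤a-k = lin₁ 0 k≤0 (ℤ-solve 2 (λ a k → a ⊖ k ⊖ a ⊜ κ 0ℤ ⊖ k ⊕ κ 0ℤ) ≡.refl (+ a) k)
          2k+1≤1 : k ℤ.+ k ℤ.+ 1ℤ ℤ.≤ 1ℤ
          2k+1≤1 = lin₁ 0 (double-≤ k≤0) (ℤ-solve 1 (λ k → κ 1ℤ ⊖ (k ⊕ k ⊕ κ 1ℤ) ⊜ (κ 0ℤ ⊕ κ 0ℤ) ⊖ (k ⊕ k) ⊕ κ 0ℤ)
            ≡.refl k)
          2k+1≤k+1 : k ℤ.+ k ℤ.+ 1ℤ ℤ.≤ k ℤ.+ 1ℤ
          2k+1≤k+1 = lin₁ 0 k≤0 (ℤ-solve 1 (λ k → k ⊕ κ 1ℤ ⊖ (k ⊕ k ⊕ κ 1ℤ) ⊜ κ 0ℤ ⊖ k ⊕ κ 0ℤ) ≡.refl k)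
          -κ : F.ord (F.- (κ′ F.* κ′)) ≡ [ k ℤ.+ k ]
          -κ = ord-neg (ord-*-finite ord-κ ord-κ)
          ord-D : F.ord D ≡ [ k ℤ.+ k ]
          ord-D = ≡.trans (F.ord-cong (F-solve 3 (λ p u v → p :-′ (u :+′ v) :=′ (:-′ u) :+′ (p :-′ v)) F.refl p
            (κ′ F.* κ′) (κ′ F.* q)))
            (ord-+-strict -κ (≤ord-- p _ (≤ord-mono p 2k+1≤1 1≤ord-p)
              (≤ord-mono (κ′ F.* q) 2k+1≤k+1 (≤ord-* κ′ q (ord≡⇒≤ord ord-κ) 1≤ord-q))))
          a-k≤s : (+ a ℤ.- k) ≤ord s
          a-k≤s = ≤ord-mono s (ℤ.≤-reflexive (ℤ-solve 2 (λ a k → a ⊖ k ⊜ k ⊕ a ⊖ (k ⊕ k)) ≡.refl (+ a) k))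
            (cancelˡ s ord-D (≤ord-resp (F.trans (F.sym sD) (F.*-comm s D))
              (≤ord-+ iv (κ′ F.* A) (≤ord-mono iv
                (lin₁ 0 k≤0 (ℤ-solve 2 (λ a k → a ⊖ (k ⊕ a) ⊜ κ 0ℤ ⊖ k ⊕ κ 0ℤ) ≡.refl (+ a) k)) a≤iv)
                (≤ord-* κ′ A (ord≡⇒≤ord ord-κ) a≤A))))
          a-k≤r : (+ a ℤ.- k) ≤ord r
          a-k≤r = ≤ord-resp (F-solve 2 (λ r u → (r :+′ u) :-′ u :=′ r) F.refl r (s F.* q))
            (≤ord-- (r F.+ s F.* q) (s F.* q)
            (cancelˡ (r F.+ s F.* q) ord-κ (≤ord-resp
              (F-solve 2 (λ u v → u :-′ (u :-′ v) :=′ v) F.refl (s F.* p) (κ′ F.* (r F.+ s F.* q)))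
              (≤ord-- (s F.* p) iv (≤ord-resp (F.*-comm p s)
                (≤ord-*-integral p s (≤ord-mono p (ℤ.+≤+ ℕ.z≤n) 1≤ord-p) (≤ord-mono s a≤a-k a-k≤s))) a≤iv)))
            (≤ord-resp (F.*-comm q s) (≤ord-*-integral q s (≤ord-mono q (ℤ.+≤+ ℕ.z≤n) 1≤ord-q) a-k≤s)))
          ≡a-k : ∀ w → F.ord c ≡ [ w ] → + a ℤ.+ + b ℤ.- w ℤ.≤ + a ℤ.- k
          ≡a-k w eq = ℤ.≤-reflexive (≡.trans (ℤ-solve 3 (λ a b w → a ⊕ b ⊖ w ⊜ a ⊖ (w ⊖ b)) ≡.refl (+ a) (+ b) w)
            (≡.cong (λ j → + a ℤ.- j) ([]-injective (≡.trans (≡.sym (ord-κ′ eq)) ord-κ))))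

    -- One inclusion holds because the right side is an ideal of the maximal order lying in the
    -- order. For the other, multiplying by (1 , 0), (0 , 1) and (0 , x), which span the maximal
    -- order, already yields all the bounds.
    conductor≐ : conductor 𝒪[ a , b , c ] ≐ (λ z → F.⟨ π ^ + a ⟩ (proj₁ z) × E′.⟨ x ^ M ⟩ (proj₂ z))
    conductor≐ = (λ {z} → to {z}) , (λ {z} → from {z})
      where
      from : ∀ {z} → F.⟨ π ^ + a ⟩ (proj₁ z) × E′.⟨ x ^ M ⟩ (proj₂ z) → z ∈ conductor 𝒪[ a , b , c ]
      from {u , y} (u∈ , y∈) =
        (≤ord-mono u (ℤ.+≤+ ℕ.z≤n) a≤u , VE′.≤ord-mono y 0≤M M≤y) ,
        λ { (u′ , y′) (0≤u′ , 0≤y′) → ideal⇒∈O (≤ord-resp (F.*-comm u′ u) (≤ord-*-integral u′ u 0≤u′ a≤u))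
                                               (VE′.≤ord-resp (E′.*-comm y′ y) (VE′.≤ord-*-integral y′ y 0≤y′ M≤y)) }
        where
        a≤u : + a ≤ord u
        a≤u = ∈⟨^⟩⇒≤ord π u∈
        M≤y : M VE′.≤ord y
        M≤y = VE′.∈⟨^⟩⇒≤ord x y∈
      to : ∀ {z} → z ∈ conductor 𝒪[ a , b , c ] → F.⟨ π ^ + a ⟩ (proj₁ z) × E′.⟨ x ^ M ⟩ (proj₂ z)
      to {u , y} (_ , z*∈O) = ≤ord⇒∈⟨^⟩ π a≤u , VE′.≤ord⇒∈⟨^⟩ x
        (VE′.≤ord-resp (E′.sym (coord-re-im y)) (Equivalence.from ≤ord-coord (M≤2r , M≤2s+1)))
        where
        r s : F.Carrier
        r = re y
        s = im y
        fst-test : + a ≤ord (F.0# F.- u F.* F.1# F.- κ′ F.* F.0#)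
        fst-test = proj₁ (proj₂ (Equivalence.to
          (∈O⇔ (E′.trans (E′.zeroʳ y) (E′.sym (E′.trans (coord-ι F.0#) (proj₂ Δ-0)))))
          (z*∈O (F.1# , E′.0#) (≤ord-1 , VE′.≤ord-0 E′.refl))))
        one-test : + a ≤ord (r F.- u F.* F.0# F.- κ′ F.* s) × + b ≤ord s
        one-test = proj₂ (Equivalence.to (∈O⇔ (E′.trans (E′.*-identityʳ y) (coord-re-im y)))
          (z*∈O (F.0# , E′.1#) (≤ord-0 F.refl , VE′.≤ord-1)))
        y*X≈ : y E′.* X E′.≈ coord (r F.* F.0# F.+ s F.* F.1# F.* p) (r F.* F.1# F.+ s F.* F.0# F.+ s F.* F.1# F.* q)
        y*X≈ = E′.trans (E′.*-cong (coord-re-im y)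
          (E′.sym (E′.trans (coord-ι*X F.1#) (E′.trans (E′.*-congʳ (proj₂ Δ-1)) (E′.*-identityˡ X)))))
          (coord-* r s F.0# F.1#)
        X-test : + a ≤ord ((r F.* F.0# F.+ s F.* F.1# F.* p) F.- u F.* F.0# F.- κ′ F.*
          (r F.* F.1# F.+ s F.* F.0# F.+ s F.* F.1# F.* q)) × + b ≤ord
          (r F.* F.1# F.+ s F.* F.0# F.+ s F.* F.1# F.* q)
        X-test = proj₂ (Equivalence.to (∈O⇔ y*X≈)
          (z*∈O (F.0# , X) (≤ord-0 F.refl , VE′.≤ord-mono X (ℤ.+≤+ ℕ.z≤n) (VE′.ord≡⇒≤ord (E′.Uniformizer.ord≡1 x)))))
        a≤u : + a ≤ord u
        a≤u = ≤ord-resp (F-solve 2 (λ u k → :-′ (con′ 0ℤ :-′ u :*′ con′ 1ℤ :-′ k :*′ con′ 0ℤ) :=′ u) F.refl u κ′)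
          (≤ord-neg _ fst-test)
        b≤s : + b ≤ord s
        b≤s = proj₂ one-test
        b≤r : + b ≤ord r
        b≤r = ≤ord-resp (F-solve 3 (λ r s q → (r :*′ con′ 1ℤ :+′ s :*′ con′ 0ℤ :+′ s :*′ con′ 1ℤ :*′ q) :-′ q :*′ s
          :=′ r) F.refl r s q)
          (≤ord-- _ (q F.* s) (proj₂ X-test) (≤ord-*-integral q s (≤ord-mono q (ℤ.+≤+ ℕ.z≤n) 1≤ord-q) b≤s))
        bounds : CoordinateBounds {r} {s}
        bounds = coordinateBounds
          (≤ord-resp (F-solve 4 (λ r u k s → r :-′ u :*′ con′ 0ℤ :-′ k :*′ s :=′ r :-′ k :*′ s) F.refl r u κ′ s)
            (proj₁ one-test))
          (≤ord-resp (F-solve 6 (λ r s p u k q → (r :*′ con′ 0ℤ :+′ s :*′ con′ 1ℤ :*′ p) :-′ u :*′ con′ 0ℤ :-′ k :*′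
            (r :*′ con′ 1ℤ :+′ s :*′ con′ 0ℤ :+′ s :*′ con′ 1ℤ :*′ q)
                         :=′ s :*′ p :-′ k :*′ (r :+′ s :*′ q)) F.refl r s p u κ′ q) (proj₁ X-test))
        M≤2r : ∀ k → F.ord r ≡ [ k ] → M ℤ.≤ k ℤ.+ k
        M≤2r k eq = Equivalence.from (conductorExponent≤⇔ a b (F.ord c) (k ℤ.+ k))
          ( ℤ.≤-trans (double-≤ (≤ord⇒≤ eq (proj₁ (proj₁ bounds)))) (ℤ.i≤i+j (k ℤ.+ k) 1ℤ)
          , double-≤ (≤ord⇒≤ eq b≤r)
          , λ w eq′ → double-≤ (≤ord⇒≤ eq (proj₂ (proj₁ bounds) w eq′)) )
        M≤2s+1 : ∀ k → F.ord s ≡ [ k ] → M ℤ.≤ k ℤ.+ k ℤ.+ 1ℤ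
        M≤2s+1 k eq = Equivalence.from (conductorExponent≤⇔ a b (F.ord c) (k ℤ.+ k ℤ.+ 1ℤ))
          -- The weaker bound a - 1 on `s` is enough: ι s * x has valuation 2k + 1, and the exponent
          -- demands only 2a ≤ 2k + 2.
          ( lin₁ 0 (double-≤ (≤ord⇒≤ eq (proj₁ (proj₂ bounds))))
            (ℤ-solve 2 (λ a k → k ⊕ k ⊕ κ 1ℤ ⊕ κ 1ℤ ⊖ (a ⊕ a) ⊜ k ⊕ k ⊖ (a ⊖ κ 1ℤ ⊕ (a ⊖ κ 1ℤ)) ⊕ κ 0ℤ) ≡.refl (+ a)
            k)
          , ℤ.≤-trans (double-≤ (≤ord⇒≤ eq b≤s)) (ℤ.i≤i+j (k ℤ.+ k) 1ℤ)
          , λ w eq′ → ℤ.≤-trans (double-≤ (≤ord⇒≤ eq (proj₂ (proj₂ bounds) w eq′))) (ℤ.i≤i+j (k ℤ.+ k) 1ℤ) )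

  -- Self-dual orders and inverses of ideals

  open import Algebra.Properties.AbelianGroup +-abelianGroup using (x∙y⁻¹≈ε⇒x≈y)
  open Sum +-commutativeMonoid using (sum)
  private module FS = Sum F.+-commutativeMonoid

  linear-sum : ∀ φ {n} (t : Fin n → F.Carrier) (w : Fin n → Carrier) →
               φ ⟨$⟩ sum (λ i → t i ⋆ w i) F.≈ FS.sum (λ i → t i F.* φ ⟨$⟩ w i)
  linear-sum φ {zero}  t w = ⟨$⟩-0 φ
  linear-sum φ {suc n} t w = F.trans (⟨$⟩-+ φ _ _)
    (F.+-cong (⟨$⟩-⋆ φ (t zero) (w zero)) (linear-sum φ (t ∘ suc) (w ∘ suc)))

  -- The form (y , z) ↦ θ (y z) identifies O with its 𝒪-dual.
  record Dualizing (O : Subset) (θ : Functional) : Set (ℓ₁ ⊔ ℓ₂) where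
    field
      integral      : ∀ {y} → y ∈ O → 0ℤ ≤ord (θ ⟨$⟩ y)
      nondegenerate : ∀ {g} → (∀ y → θ ⟨$⟩ (g * y) F.≈ F.0#) → g ≈ 0#
      represent     : ∀ φ → ∃ λ g → (∀ y → φ ⟨$⟩ y F.≈ θ ⟨$⟩ (g * y)) × ((∀ {y} → y ∈ O → 0ℤ ≤ord (φ ⟨$⟩ y)) → g ∈ O)

  module _ {O : Subset} (isOrd : IsOrder O) {θ : Functional} (dualizing : Dualizing O θ) where

    private
      module O = IsOrder isOrd
      module D = Dualizing dualizing

    -- The functional `θ (g y)` is integral on `O`, so it is represented by some h in `O`;
    -- nondegeneracy identifies h with `g`.
    dual∈O : ∀ {g} → (∀ {y} → y ∈ O → 0ℤ ≤ord (θ ⟨$⟩ (g * y))) → g ∈ O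
    dual∈O {g} θg-integral = O.resp (sym g≈h)
      (proj₂ (proj₂ rep) λ {y} y∈O → ≤ord-resp (⟨$⟩-cong θ (*-comm g y)) (θg-integral y∈O))
      where
      rep = D.represent (θ ∘* g)
      h : Carrier
      h = proj₁ rep
      g≈h : g ≈ h
      g≈h = x∙y⁻¹≈ε⇒x≈y g h (D.nondegenerate λ y → F.trans
        (⟨$⟩-cong θ (solve 3 (λ g h y → (g :- h) :* y := y :* g :- h :* y) refl g h y))
        (F.trans (⟨$⟩-- θ _ _) (F.trans (F.+-congʳ (proj₁ (proj₂ rep) y)) (F.-‿inverseʳ _))))

    module _ {I : Subset} (fracI : IsFractionalIdeal O I) (multI : multiplierRing I ≐ O) where

      private
        module I = IsFractionalIdeal fracI
        module IS = IsSubmodule I.isSubmodule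

        Δ𝒪⊆O : Δ𝒪 ⊆ O
        Δ𝒪⊆O = O.contains-Δ𝒪

        O-sub : IsSubmodule Δ𝒪 O
        O-sub = record { resp = O.resp ; 0∈ = O.0∈ ; +-closed = O.+-closed ; *-closed = λ r∈ → O.*-closed (Δ𝒪⊆O r∈) }

        I-sub : IsSubmodule Δ𝒪 I
        I-sub = restrict I.isSubmodule Δ𝒪⊆O

        I-frame : ∃ λ n → ∃ λ (w : Fin n → Carrier) → ∃ λ ψ → Frame I w ψ
        I-frame = frame I-sub
          (generators-extend (finitelyGenerated⇒generators O.finitelyGenerated O-sub) I.isSubmodule
            I.finitelyGenerated O.1∈ O.0∈)
          (spanning⇒full I.F·I=E)

      dual : Subset
      dual y = ∀ z → z ∈ I → 0ℤ ≤ord (θ ⟨$⟩ (y * z))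

      dual-isSubmodule : IsSubmodule O dual
      dual-isSubmodule = record
        { resp     = λ y≈y′ y∈ z z∈ → ≤ord-resp (⟨$⟩-cong θ (*-congʳ y≈y′)) (y∈ z z∈)
        ; 0∈       = λ z _ → ≤ord-0 (F.trans (⟨$⟩-cong θ (zeroˡ z)) (⟨$⟩-0 θ))
        ; +-closed = λ {y} {y′} y∈ y′∈ z z∈ → ≤ord-resp (F.sym (F.trans (⟨$⟩-cong θ (distribʳ z y y′)) (⟨$⟩-+ θ _ _)))
          (≤ord-+ _ _ (y∈ z z∈) (y′∈ z z∈))
        ; *-closed = λ {r} {y} r∈ y∈ z z∈ → ≤ord-resp
          (⟨$⟩-cong θ (solve 3 (λ r y z → y :* (r :* z) := (r :* y) :* z) refl r y z))
          (y∈ (r * z) (IS.*-closed r∈ z∈))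
        }

      module _ {n : ℕ} {w : Fin n → Carrier} {ψ : Fin n → Functional} (fr : Frame I w ψ) where

        private
          module Fr = Frame fr

          g : Fin n → Carrier
          g i = proj₁ (D.represent (ψ i))

          ψ≈ : ∀ i z → ψ i ⟨$⟩ z F.≈ θ ⟨$⟩ (g i * z)
          ψ≈ i = proj₁ (proj₂ (D.represent (ψ i)))

          χ : Fin n → Functional
          χ i = θ ∘* w i

        -- The dual basis: `g i` represents the coordinate `ψ i`, and conversely pairing with `w i`
        -- is the coordinate along `g i`. The expansion is checked by pairing both sides with an
        -- arbitrary `z`.
        dual-frame : Frame dual g χ
        dual-frame = record
          { w∈M      = λ i z z∈I → ≤ord-resp (ψ≈ i z) (Fr.integral i z∈I)
          ; integral = λ i {y} y∈ → y∈ (w i) (Fr.w∈M i)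
          ; expand   = λ y → x∙y⁻¹≈ε⇒x≈y y _ (D.nondegenerate λ z → F.trans
              (⟨$⟩-cong θ (solve 3 (λ y u z → (y :- u) :* z := z :* y :- u :* z) refl y (comb χ g y) z))
              (F.trans (⟨$⟩-- θ _ _) (F.trans (F.+-congʳ (same y z)) (F.-‿inverseʳ _))))
          }
          where
          same : ∀ y z → θ ⟨$⟩ (z * y) F.≈ θ ⟨$⟩ (comb χ g y * z)
          same y z = begin
            θ ⟨$⟩ (z * y)                                             ≈⟨ ⟨$⟩-cong (θ ∘* y) (Fr.expand z) ⟩
            (θ ∘* y) ⟨$⟩ comb ψ w z                                   ≈⟨ linear-sum (θ ∘* y) (λ i → ψ i ⟨$⟩ z) w ⟩
            FS.sum (λ i → (ψ i ⟨$⟩ z) F.* (θ ⟨$⟩ (w i * y)))          ≈⟨ FS.sum-cong-≋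
              (λ i → F.trans (F.*-comm _ _) (F.*-cong (⟨$⟩-cong θ (*-comm (w i) y)) (ψ≈ i z))) ⟩
            FS.sum (λ i → (χ i ⟨$⟩ y) F.* (θ ⟨$⟩ (g i * z)))          ≈⟨ linear-sum (θ ∘* z) (λ i → χ i ⟨$⟩ y) g ⟨
            θ ⟨$⟩ (comb χ g y * z)                                    ∎
            where open import Relation.Binary.Reasoning.Setoid F.setoid

        private
          wg : Fin n → Fin n → Carrier
          wg i j = w i * g j

          products : Fin (n ℕ.* n) → Carrier
          products k = uncurry wg (remQuot n k)

          -- The product of the ideal and its dual, given by finitely many generators over 𝒪 so that
          -- elimination applies to it.
          P : Subset
          P = Span Δ𝒪 products

          wg∈P : ∀ i j → w i * g j ∈ P
          wg∈P i j = IsSubmodule.resp (span-isSubmodule products)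
            (reflexive (≡.cong (uncurry wg) (Fin.remQuot-combine i j)))
            (generator∈span Δ𝒪 1∈Δ𝒪 0∈Δ𝒪 products (combine i j))

          P⊆I·J : P ⊆ I · dual
          P⊆I·J (r , r∈ , y≈) = n ℕ.* n , (λ k → r k * w (proj₁ (remQuot {n} n k))) ,
            (λ k → g (proj₂ (remQuot {n} n k))) ,
            (λ k → IS.*-closed (Δ𝒪⊆O (r∈ k)) (Fr.w∈M _)) , (λ k → Frame.w∈M dual-frame _) ,
            trans y≈ (Sum.sum-cong-≋ +-commutativeMonoid (λ k → sym (*-assoc (r k) _ _)))

          -- A functional that kills all `w i * g j` kills every product of an element of `I` with
          -- an element of the dual, by linearity in each factor. Fullness of the two modules is
          -- then applied one factor at a time.
          P-full : Full P
          P-full φ φ≈0 y = F.trans (⟨$⟩-cong φ (sym (*-identityˡ y))) (Frame.full dual-frame (φ ∘* y) (λ {z} z∈ →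
              F.trans (⟨$⟩-cong φ (*-comm z y)) (Frame.full fr (φ ∘* z) (λ {u} u∈I → kill u u∈I z z∈) y)) 1#)
            where
            kill : ∀ u → u ∈ I → ∀ z → z ∈ dual → φ ⟨$⟩ (u * z) F.≈ F.0#
            kill u u∈I z z∈ = ≤ord-all⇒≈0 λ k →
              proj₂ (proj₂ (proj₂ Fr.generators)) (φ ∘* z) k (λ i →
                ≤ord-resp (⟨$⟩-cong φ (*-comm z (w i)))
                  (proj₂ (proj₂ (proj₂ (Frame.generators dual-frame))) (φ ∘* w i) k (λ j →
                  ≤ord-0 (F.trans (⟨$⟩-cong φ (*-comm (g j) (w i))) (φ≈0 (wg∈P i j)))) z∈)) u∈I

          P-frame : ∃ λ m → ∃ λ (h : Fin m → Carrier) → ∃ λ ξ → Frame P h ξ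
          P-frame = frame (span-isSubmodule products)
            (finitelyGenerated⇒generators (n ℕ.* n , products , id , id) (span-isSubmodule products)) P-full

        I·dual⊆O : I · dual ⊆ O
        I·dual⊆O (m , u , v , u∈I , v∈ , y≈) = O.resp (sym y≈)
          (sum-closed O-sub (λ i → u i * v i) λ i → dual∈O λ {y} y∈O →
          ≤ord-resp (⟨$⟩-cong θ (solve 3 (λ u v y → v :* (y :* u) := (u :* v) :* y) refl (u i) (v i) y))
            (v∈ i (y * u i) (IS.*-closed y∈O (u∈I i))))

        -- Let `k i` represent the coordinate `ξ i` of `P`. For z in `I` the coordinate
        -- `ψ j (k i * z)` equals `ξ i (z * g j)`, which is integral; so `k i` maps `I` to itself
        -- and lies in `O` by the hypothesis on the multiplier ring. Hence each `ξ i` is integral on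
        -- `O`.
        O⊆I·dual : O ⊆ I · dual
        O⊆I·dual {y} y∈O = go P-frame
          where
          go : (∃ λ m → ∃ λ (h : Fin m → Carrier) → ∃ λ ξ → Frame P h ξ) → y ∈ I · dual
          go (m , h , ξ , fr′) = P⊆I·J (Frame.member fr′ (span-isSubmodule products) λ i →
            ≤ord-resp (F.sym (proj₁ (proj₂ (D.represent (ξ i))) y)) (D.integral (O.*-closed (k∈O i) y∈O)))
            where
            k : Fin m → Carrier
            k i = proj₁ (D.represent (ξ i))
            k∈O : ∀ i → k i ∈ O
            k∈O i = proj₁ multI λ z z∈I → Fr.member I-sub λ j → ≤ord-resp
              (F.sym (F.trans (ψ≈ j (k i * z))
                (F.trans (⟨$⟩-cong θ (solve 3 (λ g k z → g :* (k :* z) := k :* (z :* g)) refl (g j) (k i) z))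
                (F.sym (proj₁ (proj₂ (D.represent (ξ i))) (z * g j))))))
              (proj₂ (proj₂ (proj₂ Fr.generators)) (ξ i ∘* g j) 0ℤ (λ l → Frame.integral fr′ i (wg∈P l j)) z∈I)

      invertible : Invertible O I
      invertible = go I-frame
        where
        go : (∃ λ n → ∃ λ (w : Fin n → Carrier) → ∃ λ ψ → Frame I w ψ) → Invertible O I
        go (n , w , ψ , fr) = dual , Frame.isFractionalIdeal (dual-frame fr) Δ𝒪⊆O dual-isSubmodule ,
          (λ {y} → I·dual⊆O fr {y}) , (λ {y} → O⊆I·dual fr {y})

    dualizing⇒Gorenstein : Gorenstein O
    dualizing⇒Gorenstein I fracI multI = invertible fracI multI

  infixl 6 _⟨+⟩_
  _⟨+⟩_ : Functional → Functional → Functional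
  φ ⟨+⟩ χ = record
    { _⟨$⟩_    = λ y → φ ⟨$⟩ y F.+ χ ⟨$⟩ y
    ; ⟨$⟩-cong = λ p → F.+-cong (⟨$⟩-cong φ p) (⟨$⟩-cong χ p)
    ; ⟨$⟩-+    = λ y z → F.trans (F.+-cong (⟨$⟩-+ φ y z) (⟨$⟩-+ χ y z))
                   (F-solve 4 (λ a b c d → (a :+′ b) :+′ (c :+′ d) :=′ (a :+′ c) :+′ (b :+′ d)) F.refl (φ ⟨$⟩ y)
                     (φ ⟨$⟩ z) (χ ⟨$⟩ y) (χ ⟨$⟩ z))
    ; ⟨$⟩-⋆    = λ t y → F.trans (F.+-cong (⟨$⟩-⋆ φ t y) (⟨$⟩-⋆ χ t y))
                   (F-solve 3 (λ t a b → t :*′ a :+′ t :*′ b :=′ t :*′ (a :+′ b)) F.refl t (φ ⟨$⟩ y) (χ ⟨$⟩ y))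
    }

  module _ (a b : ℕ) (c : F.Carrier) where

    private
      module S = StandardFrame F₀ E₀ π x (+ a) (+ b) c

      P : F.Carrier
      P = π F.^ (+ a)

      O : Subset
      O = 𝒪[ a , b , c ]

    coords-* : ∀ y z → let y₀ = S.α ⟨$⟩ y ; y₁ = S.β ⟨$⟩ y ; y₂ = S.γ ⟨$⟩ y ; z₀ = S.α ⟨$⟩ z ; z₁ = S.β ⟨$⟩ z ; z₂ = S.γ ⟨$⟩ z in
      (S.α ⟨$⟩ (y * z) F.≈ y₀ F.* z₀) × (S.β ⟨$⟩ (y * z) F.≈ S.β* y₀ y₁ y₂ z₀ z₁ z₂) ×
        (S.γ ⟨$⟩ (y * z) F.≈ S.γ* y₀ y₁ y₂ z₀ z₁ z₂)
    coords-* y z = F.refl , F.trans (⟨$⟩-cong S.β y*z≈) (S.β-elt _ _ _) , F.trans (⟨$⟩-cong S.γ y*z≈) (S.γ-elt _ _ _)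
      where
      y*z≈ : y * z ≈ S.elt (S.α ⟨$⟩ y F.* S.α ⟨$⟩ z)
                           (S.β* (S.α ⟨$⟩ y) (S.β ⟨$⟩ y) (S.γ ⟨$⟩ y) (S.α ⟨$⟩ z) (S.β ⟨$⟩ z) (S.γ ⟨$⟩ z))
                           (S.γ* (S.α ⟨$⟩ y) (S.β ⟨$⟩ y) (S.γ ⟨$⟩ y) (S.α ⟨$⟩ z) (S.β ⟨$⟩ z) (S.γ ⟨$⟩ z))
      y*z≈ = trans (*-cong (S.expand-elt y) (S.expand-elt z)) (S.elt-* _ _ _ _ _ _)

    *-cong₃ : ∀ {y₀ y₁ y₂ z₀ z₁ z₂ y₀′ y₁′ y₂′} → y₀ F.≈ y₀′ → y₁ F.≈ y₁′ → y₂ F.≈ y₂′ →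
              (S.β* y₀ y₁ y₂ z₀ z₁ z₂ F.≈ S.β* y₀′ y₁′ y₂′ z₀ z₁ z₂) ×
                (S.γ* y₀ y₁ y₂ z₀ z₁ z₂ F.≈ S.γ* y₀′ y₁′ y₂′ z₀ z₁ z₂)
    *-cong₃ p q r =
      F.+-cong (F.+-cong (F.+-cong (F.*-congʳ p) (F.*-congʳ q)) (F.*-congˡ (F.*-congʳ q))) (F.*-congˡ (F.*-congʳ r)) ,
      F.+-cong (F.+-cong (F.+-cong (F.*-congʳ p) (F.*-congʳ r)) (F.*-congˡ (F.+-cong (F.*-congʳ q) (F.*-congʳ r))))
        (F.*-congˡ (F.*-congʳ r))

    elt-*ʳ : ∀ g₀ g₁ g₂ y → let z₀ = S.α ⟨$⟩ y ; z₁ = S.β ⟨$⟩ y ; z₂ = S.γ ⟨$⟩ y in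
      (S.α ⟨$⟩ (S.elt g₀ g₁ g₂ * y) F.≈ g₀ F.* z₀) × (S.β ⟨$⟩ (S.elt g₀ g₁ g₂ * y) F.≈ S.β* g₀ g₁ g₂ z₀ z₁ z₂) ×
        (S.γ ⟨$⟩ (S.elt g₀ g₁ g₂ * y) F.≈ S.γ* g₀ g₁ g₂ z₀ z₁ z₂)
    elt-*ʳ g₀ g₁ g₂ y = let (p , q , r) = coords-* (S.elt g₀ g₁ g₂) y ; (s , t) = *-cong₃ (S.α-elt g₀ g₁ g₂) (S.β-elt g₀ g₁ g₂) (S.γ-elt g₀ g₁ g₂) in
      F.trans p (F.*-congʳ (S.α-elt g₀ g₁ g₂)) , F.trans q s , F.trans r t

    φ-expand : ∀ φ y → φ ⟨$⟩ y F.≈ S.α ⟨$⟩ y F.* φ ⟨$⟩ 1# F.+ (S.β ⟨$⟩ y F.* φ ⟨$⟩ S.e₁ F.+ S.γ ⟨$⟩ y F.* φ ⟨$⟩ S.e₂)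
    φ-expand φ y = F.trans (⟨$⟩-cong φ (S.expand-elt y))
      (F.trans (linear-sum φ (λ i → S.coords i ⟨$⟩ y) S.basis) (F.+-congˡ (F.+-congˡ (F.+-identityʳ _))))

    ≈0-coords : ∀ {y} → S.α ⟨$⟩ y F.≈ F.0# → S.β ⟨$⟩ y F.≈ F.0# → S.γ ⟨$⟩ y F.≈ F.0# → y ≈ 0#
    ≈0-coords {y} p q r = trans (S.expand-elt y) (trans (S.elt-cong p q r)
      (trans (+-cong (*-congʳ Δ-0) (+-cong (*-congʳ Δ-0) (+-congʳ (*-congʳ Δ-0))))
        (solve 2 (λ e f → con 0ℤ :* con 1ℤ :+ (con 0ℤ :* e :+ (con 0ℤ :* f :+ con 0ℤ)) := con 0ℤ) refl S.e₁ S.e₂)))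

    module _ (B⁻¹ : F.Carrier) (B⁻¹B≈1 : B⁻¹ F.* S.B F.≈ F.1#) where

      β-form-elt : ∀ g z₀ z₁ z₂ → S.β ⟨$⟩ (g * S.elt z₀ z₁ z₂) F.≈ S.β* (S.α ⟨$⟩ g) (S.β ⟨$⟩ g) (S.γ ⟨$⟩ g) z₀ z₁ z₂
      β-form-elt g z₀ z₁ z₂ = F.trans (⟨$⟩-cong S.β (*-comm g _)) (F.trans (proj₁ (proj₂ (elt-*ʳ z₀ z₁ z₂ g)))
        (F-solve 8 (λ P B g₀ g₁ g₂ z₀ z₁ z₂ → z₀ :*′ g₁ :+′ z₁ :*′ g₀ :+′ P :*′ (z₁ :*′ g₁) :+′ B :*′ (z₂ :*′ g₂)
            :=′ g₀ :*′ z₁ :+′ g₁ :*′ z₀ :+′ P :*′ (g₁ :*′ z₁) :+′ B :*′ (g₂ :*′ z₂)) F.refl P S.B (S.α ⟨$⟩ g)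
              (S.β ⟨$⟩ g) (S.γ ⟨$⟩ g) z₀ z₁ z₂))

      -- In the basis 1, e₁, e₂ the form has the blocks (0 1; 1 π^a) and (B), with determinant -B,
      -- so it is perfect over 𝒪 when `B` is a unit.
      dualizing-β : 0ℤ ≤ord B⁻¹ → Dualizing O S.β
      dualizing-β 0≤B⁻¹ = record
        { integral      = λ y∈O → proj₁ (proj₂ (S.∈O⇒integral y∈O))
        ; nondegenerate = λ {g} zero-form →
            let g₀ = S.α ⟨$⟩ g ; g₁ = S.β ⟨$⟩ g ; g₂ = S.γ ⟨$⟩ g
                g₁≈0 : g₁ F.≈ F.0#
                g₁≈0 = F.trans (F-solve 5 (λ P B g₀ g₁ g₂ → g₁ :=′ g₀ :*′ con′ 0ℤ :+′ g₁ :*′ con′ 1ℤ :+′ P :*′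
                  (g₁ :*′ con′ 0ℤ) :+′ B :*′ (g₂ :*′ con′ 0ℤ)) F.refl P S.B g₀ g₁ g₂)
                         (F.trans (F.sym (β-form-elt g F.1# F.0# F.0#)) (zero-form _))
                g₀≈0 : g₀ F.≈ F.0#
                g₀≈0 = F.trans (F-solve 5 (λ P B g₀ g₁ g₂ → g₀ :=′
                  (g₀ :*′ con′ 1ℤ :+′ g₁ :*′ con′ 0ℤ :+′ P :*′ (g₁ :*′ con′ 1ℤ) :+′ B :*′ (g₂ :*′ con′ 0ℤ)) :-′ P :*′
                  g₁) F.refl P S.B g₀ g₁ g₂)
                         (F.trans (F.+-cong (F.trans (F.sym (β-form-elt g F.0# F.1# F.0#)) (zero-form _))
                           (F.-‿cong (F.*-congˡ g₁≈0)))
                           (F-solve 1 (λ P → con′ 0ℤ :-′ P :*′ con′ 0ℤ :=′ con′ 0ℤ) F.refl P))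
                Bg₂≈0 : S.B F.* g₂ F.≈ F.0#
                Bg₂≈0 = F.trans (F-solve 5 (λ P B g₀ g₁ g₂ → B :*′ g₂ :=′ g₀ :*′ con′ 0ℤ :+′ g₁ :*′ con′ 0ℤ :+′ P :*′
                  (g₁ :*′ con′ 0ℤ) :+′ B :*′ (g₂ :*′ con′ 1ℤ)) F.refl P S.B g₀ g₁ g₂)
                         (F.trans (F.sym (β-form-elt g F.0# F.0# F.1#)) (zero-form _))
                g₂≈0 : g₂ F.≈ F.0#
                g₂≈0 = F.trans (F.sym (F.*-identityˡ g₂))
                  (F.trans (F.*-congʳ (F.sym B⁻¹B≈1))
                  (F.trans (F.*-assoc B⁻¹ S.B g₂) (F.trans (F.*-congˡ Bg₂≈0) (F.zeroʳ B⁻¹))))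
            in ≈0-coords g₀≈0 g₁≈0 g₂≈0
        ; represent     = λ φ →
            let φ₀ = φ ⟨$⟩ 1# ; φ₁ = φ ⟨$⟩ S.e₁ ; φ₂ = φ ⟨$⟩ S.e₂ in
            -- Solves φ₀ = g₁, φ₁ = g₀ + P g₁, φ₂ = B g₂ for the coordinates of g.
            S.elt (φ₁ F.- P F.* φ₀) φ₀ (B⁻¹ F.* φ₂) ,
            (λ y → let z₀ = S.α ⟨$⟩ y ; z₁ = S.β ⟨$⟩ y ; z₂ = S.γ ⟨$⟩ y in F.trans (φ-expand φ y)
              (F.sym (F.trans (proj₁ (proj₂ (elt-*ʳ _ _ _ y)))
              (F.trans (F-solve 9 (λ P B B⁻¹ φ₀ φ₁ φ₂ z₀ z₁ z₂ → (φ₁ :-′ P :*′ φ₀) :*′ z₁ :+′ φ₀ :*′ z₀ :+′ P :*′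
                (φ₀ :*′ z₁) :+′ B :*′ ((B⁻¹ :*′ φ₂) :*′ z₂)
                  :=′ z₀ :*′ φ₀ :+′ (z₁ :*′ φ₁ :+′ (B⁻¹ :*′ B) :*′ (z₂ :*′ φ₂))) F.refl P S.B B⁻¹ φ₀ φ₁ φ₂ z₀ z₁ z₂)
                (F.+-congˡ (F.+-congˡ (F.trans (F.*-congʳ B⁻¹B≈1) (F.*-identityˡ _)))))))) ,
            (λ φ-integral → S.elt∈O (≤ord-- φ₁ _ (φ-integral (S.basis∈O (suc zero)))
              (≤ord-*-integral P φ₀ (S.0≤ord-P {+ a} (ℤ.+≤+ ℕ.z≤n)) (φ-integral (S.basis∈O zero))))
                                    (φ-integral (S.basis∈O zero))
                                    (≤ord-*-integral B⁻¹ φ₂ 0≤B⁻¹ (φ-integral (S.basis∈O (suc (suc zero))))))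
        }

  module _ (b : ℕ) (c : F.Carrier) (isOrd : IsOrder 𝒪[ 0 , b , c ]) where

    private
      module S = StandardFrame F₀ E₀ π x (+ 0) (+ b) c

      θ : Functional
      θ = S.α ⟨+⟩ S.γ

      θ-form : F.Carrier → F.Carrier → F.Carrier → F.Carrier → F.Carrier → F.Carrier → F.Carrier
      θ-form g₀ g₁ g₂ z₀ z₁ z₂ = g₀ F.* z₀ F.+ S.γ* g₀ g₁ g₂ z₀ z₁ z₂

      elt-form : ∀ g₀ g₁ g₂ y → θ ⟨$⟩ (S.elt g₀ g₁ g₂ * y) F.≈ θ-form g₀ g₁ g₂ (S.α ⟨$⟩ y) (S.β ⟨$⟩ y) (S.γ ⟨$⟩ y)
      elt-form g₀ g₁ g₂ y = let (p , _ , r) = elt-*ʳ 0 b c g₀ g₁ g₂ y in F.+-cong p r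

      θ-form-elt : ∀ g z₀ z₁ z₂ → θ ⟨$⟩ (g * S.elt z₀ z₁ z₂) F.≈ θ-form z₀ z₁ z₂ (S.α ⟨$⟩ g) (S.β ⟨$⟩ g) (S.γ ⟨$⟩ g)
      θ-form-elt g z₀ z₁ z₂ = F.trans (⟨$⟩-cong θ (*-comm g _)) (elt-form z₀ z₁ z₂ g)

    -- `θ` adds the coordinate of the factor 𝒪 and, on 𝒪[π^b x + c], the coefficient of the
    -- generator. The Gram matrix has rows (1 0 1), (0 0 1), (1 1 A) and determinant -1, whatever
    -- the valuation of `B`.
    dualizing-α+γ : Dualizing 𝒪[ 0 , b , c ] θ
    dualizing-α+γ = record
      { integral      = λ y∈O → let (p , _ , r) = S.∈O⇒integral y∈O in ≤ord-+ _ _ p r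
      ; nondegenerate = λ {g} zero-form →
          let g₀ = S.α ⟨$⟩ g ; g₁ = S.β ⟨$⟩ g ; g₂ = S.γ ⟨$⟩ g
              g₂≈0 : g₂ F.≈ F.0#
              g₂≈0 = F.trans (F-solve 4 (λ A g₀ g₁ g₂ → g₂ :=′ con′ 0ℤ :*′ g₀ :+′
                (con′ 0ℤ :*′ g₂ :+′ con′ 0ℤ :*′ g₀ :+′ con′ 1ℤ :*′ (con′ 1ℤ :*′ g₂ :+′ con′ 0ℤ :*′ g₁) :+′ A :*′
                (con′ 0ℤ :*′ g₂))) F.refl S.A g₀ g₁ g₂)
                       (F.trans (F.sym (θ-form-elt g F.0# F.1# F.0#)) (zero-form _))
              g₀≈0 : g₀ F.≈ F.0#
              g₀≈0 = F.trans (F-solve 4 (λ A g₀ g₁ g₂ → g₀ :=′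
                (con′ 1ℤ :*′ g₀ :+′ (con′ 1ℤ :*′ g₂ :+′ con′ 0ℤ :*′ g₀ :+′ con′ 1ℤ :*′
                (con′ 0ℤ :*′ g₂ :+′ con′ 0ℤ :*′ g₁) :+′ A :*′ (con′ 0ℤ :*′ g₂))) :-′ g₂) F.refl S.A g₀ g₁ g₂)
                       (F.trans (F.+-cong (F.trans (F.sym (θ-form-elt g F.1# F.0# F.0#)) (zero-form _))
                         (F.-‿cong g₂≈0)) (F.-‿inverseʳ F.0#))
              g₁≈0 : g₁ F.≈ F.0#
              g₁≈0 = F.trans (F-solve 4 (λ A g₀ g₁ g₂ → g₁ :=′
                (con′ 0ℤ :*′ g₀ :+′ (con′ 0ℤ :*′ g₂ :+′ con′ 1ℤ :*′ g₀ :+′ con′ 1ℤ :*′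
                (con′ 0ℤ :*′ g₂ :+′ con′ 1ℤ :*′ g₁) :+′ A :*′ (con′ 1ℤ :*′ g₂))) :-′ (g₀ :+′ A :*′ g₂)) F.refl S.A g₀
                g₁ g₂)
                       (F.trans (F.+-cong (F.trans (F.sym (θ-form-elt g F.0# F.0# F.1#)) (zero-form _))
                         (F.-‿cong (F.+-cong g₀≈0 (F.*-congˡ g₂≈0))))
                         (F-solve 1 (λ A → con′ 0ℤ :-′ (con′ 0ℤ :+′ A :*′ con′ 0ℤ) :=′ con′ 0ℤ) F.refl S.A))
          in ≈0-coords 0 b c g₀≈0 g₁≈0 g₂≈0
      ; represent     = λ φ →
          let φ₀ = φ ⟨$⟩ 1# ; φ₁ = φ ⟨$⟩ S.e₁ ; φ₂ = φ ⟨$⟩ S.e₂ in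
          -- Solves φ₀ = g₀ + g₂, φ₁ = g₂, φ₂ = g₀ + g₁ + A g₂ for the coordinates of g.
          S.elt (φ₀ F.- φ₁) (φ₂ F.- (φ₀ F.- φ₁) F.- S.A F.* φ₁) φ₁ ,
          (λ y → let z₀ = S.α ⟨$⟩ y ; z₁ = S.β ⟨$⟩ y ; z₂ = S.γ ⟨$⟩ y in F.trans (φ-expand 0 b c φ y)
            (F.sym (F.trans (elt-form _ _ _ y)
            (F-solve 7 (λ A φ₀ φ₁ φ₂ z₀ z₁ z₂ → (φ₀ :-′ φ₁) :*′ z₀ :+′
              ((φ₀ :-′ φ₁) :*′ z₂ :+′ φ₁ :*′ z₀ :+′ con′ 1ℤ :*′
              ((φ₂ :-′ (φ₀ :-′ φ₁) :-′ A :*′ φ₁) :*′ z₂ :+′ φ₁ :*′ z₁) :+′ A :*′ (φ₁ :*′ z₂))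
                :=′ z₀ :*′ φ₀ :+′ (z₁ :*′ φ₁ :+′ z₂ :*′ φ₂)) F.refl S.A φ₀ φ₁ φ₂ z₀ z₁ z₂)))) ,
          (λ φ-integral →
            let 0≤φ₀ = φ-integral (S.basis∈O zero) ; 0≤φ₁ = φ-integral (S.basis∈O (suc zero)) ; 0≤φ₂ = φ-integral (S.basis∈O (suc (suc zero)))
                0≤A = proj₁ (proj₂ (S.closed⇒ (IsOrder.*-closed isOrd))) in
            S.elt∈O (≤ord-- φ₀ φ₁ 0≤φ₀ 0≤φ₁)
              (≤ord-- _ _ (≤ord-- φ₂ _ 0≤φ₂ (≤ord-- φ₀ φ₁ 0≤φ₀ 0≤φ₁)) (≤ord-*-integral S.A φ₁ 0≤A 0≤φ₁)) 0≤φ₁)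
      }

  -- An ideal that is not invertible

  module _ (a b : ℕ) (c : F.Carrier) (isOrd : IsOrder 𝒪[ a , b , c ]) where

    private
      module S = StandardFrame F₀ E₀ π x (+ a) (+ b) c

      P : F.Carrier
      P = π F.^ (+ a)

      O : Subset
      O = 𝒪[ a , b , c ]

      0≤A : 0ℤ ≤ord S.A
      0≤A = proj₁ (proj₂ (S.closed⇒ (IsOrder.*-closed isOrd)))

      0≤B : 0ℤ ≤ord S.B
      0≤B = proj₂ (proj₂ (S.closed⇒ (IsOrder.*-closed isOrd)))

      0≤P : 0ℤ ≤ord P
      0≤P = S.0≤ord-P {+ a} (ℤ.+≤+ ℕ.z≤n)

      infixr 7 _⊛_
      _⊛_ : ∀ {y z} → 0ℤ ≤ord y → 0ℤ ≤ord z → 0ℤ ≤ord (y F.* z)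
      _⊛_ = ≤ord-*-integral _ _

    -- The fractional ideal 𝒪 + 𝒪 e₁ + 𝒪 B⁻¹ e₂ is the dual of O for the form
    -- S.β (y z); when a > 0 and B is not a unit it is not invertible.
    module NotInvertible (B⁻¹ : F.Carrier) (B⁻¹B≈1 : B⁻¹ F.* S.B F.≈ F.1#) where

      v : Carrier
      v = B⁻¹ ⋆ S.e₂

      ideal-basis : Fin 3 → Carrier
      ideal-basis = 1# ∷ S.e₁ ∷ v ∷ []

      Bγ : Functional
      Bγ = S.B *∘ S.γ

      I : Subset
      I = Span Δ𝒪 ideal-basis

      I-sub : IsSubmodule Δ𝒪 I
      I-sub = span-isSubmodule ideal-basis

      B*B⁻¹*y≈y : ∀ y → S.B F.* (B⁻¹ F.* y) F.≈ y
      B*B⁻¹*y≈y y = F.trans (F-solve 3 (λ B B⁻¹ y → B :*′ (B⁻¹ :*′ y) :=′ (B⁻¹ :*′ B) :*′ y) F.refl S.B B⁻¹ y)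
        (F.trans (F.*-congʳ B⁻¹B≈1) (F.*-identityˡ y))

      I-expand : ∀ {b₀ b₁ b₂} → S.elt b₀ b₁ b₂ ≈ b₀ ⋆ 1# + (b₁ ⋆ S.e₁ + ((S.B F.* b₂) ⋆ v + 0#))
      I-expand {b₀} {b₁} {b₂} = +-congˡ
        (+-congˡ (+-congʳ (trans (*-congʳ (trans (Δ-cong b₂≈) (Δ-* _ B⁻¹))) (*-assoc _ _ S.e₂))))
        where
        b₂≈ : b₂ F.≈ (S.B F.* b₂) F.* B⁻¹
        b₂≈ = F.sym (F.trans (F-solve 3 (λ B B⁻¹ y → (B :*′ y) :*′ B⁻¹ :=′ B :*′ (B⁻¹ :*′ y)) F.refl S.B B⁻¹ b₂)
          (B*B⁻¹*y≈y b₂))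

      ⇒∈I : ∀ {y} → 0ℤ ≤ord (S.α ⟨$⟩ y) → 0ℤ ≤ord (S.β ⟨$⟩ y) → 0ℤ ≤ord (Bγ ⟨$⟩ y) → y ∈ I
      ⇒∈I {y} p q r = (Δ (S.α ⟨$⟩ y) ∷ Δ (S.β ⟨$⟩ y) ∷ Δ (Bγ ⟨$⟩ y) ∷ []) ,
        (λ { zero → _ , p , refl ; (suc zero) → _ , q , refl ; (suc (suc zero)) → _ , r , refl }) ,
        trans (S.expand-elt y) I-expand

      v≈ : v ≈ S.elt F.0# F.0# B⁻¹
      v≈ = sym (trans (+-cong (*-congʳ Δ-0) (+-congʳ (*-congʳ Δ-0)))
        (solve 3 (λ t e f → con 0ℤ :* con 1ℤ :+ (con 0ℤ :* e :+ (t :* f :+ con 0ℤ)) := t :* f) refl (Δ B⁻¹) S.e₁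
          S.e₂))

      IntegralCoords : Carrier → Set
      IntegralCoords y = 0ℤ ≤ord (S.α ⟨$⟩ y) × 0ℤ ≤ord (S.β ⟨$⟩ y) × 0ℤ ≤ord (Bγ ⟨$⟩ y)

      ∈I⇒ : ∀ {y} → y ∈ I → IntegralCoords y
      ∈I⇒ (r , r∈ , y≈) =
        let (b₀ , 0≤b₀ , r₀≈) = r∈ zero ; (b₁ , 0≤b₁ , r₁≈) = r∈ (suc zero) ; (b₂ , 0≤b₂ , r₂≈) = r∈ (suc (suc zero))
            y≈elt = trans y≈ (trans (+-cong (*-congʳ r₀≈) (+-cong (*-congʳ r₁≈) (+-congʳ (*-congʳ r₂≈))))
                      (+-congˡ (+-congˡ (+-congʳ (trans (sym (*-assoc (Δ b₂) (Δ B⁻¹) S.e₂))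
                        (*-congʳ (sym (Δ-* b₂ B⁻¹))))))))
        in ≤ord-resp (F.sym (F.trans (⟨$⟩-cong S.α y≈elt) (S.α-elt b₀ b₁ (b₂ F.* B⁻¹)))) 0≤b₀ ,
           ≤ord-resp (F.sym (F.trans (⟨$⟩-cong S.β y≈elt) (S.β-elt b₀ b₁ (b₂ F.* B⁻¹)))) 0≤b₁ ,
           ≤ord-resp (F.sym (F.trans (⟨$⟩-cong Bγ y≈elt) (F.trans (F.*-congˡ (S.γ-elt b₀ b₁ (b₂ F.* B⁻¹)))
             (F.trans (F.*-congˡ (F.*-comm b₂ B⁻¹)) (B*B⁻¹*y≈y b₂))))) 0≤b₂

      I-frame : Frame I ideal-basis (S.α ∷ S.β ∷ Bγ ∷ [])
      I-frame = record
        { w∈M      = generator∈span Δ𝒪 1∈Δ𝒪 0∈Δ𝒪 ideal-basis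
        ; integral = λ { zero y∈ → proj₁ (∈I⇒ y∈) ; (suc zero) y∈ → proj₁ (proj₂ (∈I⇒ y∈)) ; (suc (suc zero)) y∈ →
          proj₂ (proj₂ (∈I⇒ y∈)) }
        ; expand   = λ y → trans (S.expand-elt y) I-expand
        }

      O*I⊆I : ∀ {y z} → y ∈ O → z ∈ I → y * z ∈ I
      O*I⊆I {y} {z} y∈O z∈I =
        let (0≤y₀ , 0≤y₁ , 0≤y₂) = S.∈O⇒integral y∈O ; (0≤z₀ , 0≤z₁ , 0≤Bz₂) = ∈I⇒ z∈I
            (α≈ , β≈ , γ≈) = coords-* a b c y z
            y₀ = S.α ⟨$⟩ y ; y₁ = S.β ⟨$⟩ y ; y₂ = S.γ ⟨$⟩ y ; z₀ = S.α ⟨$⟩ z ; z₁ = S.β ⟨$⟩ z ; z₂ = S.γ ⟨$⟩ z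
        in ⇒∈I (≤ord-resp (F.sym α≈) (0≤y₀ ⊛ 0≤z₀))
          (≤ord-resp (F.sym (F.trans β≈ (F-solve 8
            (λ P B y₀ y₁ y₂ z₀ z₁ z₂ → y₀ :*′ z₁ :+′ y₁ :*′ z₀ :+′ P :*′ (y₁ :*′ z₁) :+′ B :*′ (y₂ :*′ z₂)
                :=′ y₀ :*′ z₁ :+′ y₁ :*′ z₀ :+′ P :*′ (y₁ :*′ z₁) :+′ y₂ :*′ (B :*′ z₂)) F.refl P S.B y₀ y₁ y₂ z₀ z₁
                  z₂)))
            (≤ord-+ _ _ (≤ord-+ _ _ (≤ord-+ _ _ (0≤y₀ ⊛ 0≤z₁) (0≤y₁ ⊛ 0≤z₀)) (0≤P ⊛ (0≤y₁ ⊛ 0≤z₁))) (0≤y₂ ⊛ 0≤Bz₂)))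
          (≤ord-resp (F.sym (F.trans (F.*-congˡ γ≈)
            (F-solve 9 (λ P A B y₀ y₁ y₂ z₀ z₁ z₂ → B :*′
            (y₀ :*′ z₂ :+′ y₂ :*′ z₀ :+′ P :*′ (y₁ :*′ z₂ :+′ y₂ :*′ z₁) :+′ A :*′ (y₂ :*′ z₂))
                :=′ y₀ :*′ (B :*′ z₂) :+′ B :*′ (y₂ :*′ z₀) :+′ P :*′ (y₁ :*′ (B :*′ z₂) :+′ B :*′ (y₂ :*′ z₁)) :+′ A
                  :*′ (y₂ :*′ (B :*′ z₂))) F.refl P S.A S.B y₀ y₁ y₂ z₀ z₁ z₂)))
            (≤ord-+ _ _ (≤ord-+ _ _ (≤ord-+ _ _ (0≤y₀ ⊛ 0≤Bz₂) (0≤B ⊛ (0≤y₂ ⊛ 0≤z₀)))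
              (0≤P ⊛ ≤ord-+ _ _ (0≤y₁ ⊛ 0≤Bz₂) (0≤B ⊛ (0≤y₂ ⊛ 0≤z₁)))) (0≤A ⊛ (0≤y₂ ⊛ 0≤Bz₂))))

      I-submodule : IsSubmodule O I
      I-submodule = record { resp = IsSubmodule.resp I-sub ; 0∈ = IsSubmodule.0∈ I-sub ; +-closed =
        IsSubmodule.+-closed I-sub ; *-closed = O*I⊆I }

      I-fractional : IsFractionalIdeal O I
      I-fractional = Frame.isFractionalIdeal I-frame (IsOrder.contains-Δ𝒪 isOrd) I-submodule

      1∈I : 1# ∈ I
      1∈I = Frame.w∈M I-frame zero

      v∈I : v ∈ I
      v∈I = Frame.w∈M I-frame (suc (suc zero))

      -- Multiplying 1 shows that the first two coordinates of `y` are integral. Multiplying `v`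
      -- gives the third, since the e₁-coordinate of `y * v` is `γ y`: the factor `B` from e₂²
      -- cancels the B⁻¹ in `v`.
      multiplierRing⊆O : ∀ {y} → y ∈ multiplierRing I → y ∈ O
      multiplierRing⊆O {y} yI⊆I = S.integral⇒∈O (proj₁ y-int) (proj₁ (proj₂ y-int))
        (≤ord-resp β≈ (proj₁ (proj₂ (∈I⇒ (yI⊆I v v∈I)))))
        where
        y-int : IntegralCoords y
        y-int = ∈I⇒ (IsSubmodule.resp I-sub (*-identityʳ y) (yI⊆I 1# 1∈I))
        β≈ : S.β ⟨$⟩ (y * v) F.≈ S.γ ⟨$⟩ y
        β≈ = F.trans (⟨$⟩-cong S.β (trans (*-congˡ v≈) (*-comm y _)))
          (F.trans (proj₁ (proj₂ (elt-*ʳ a b c F.0# F.0# B⁻¹ y)))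
          (F.trans (F-solve 6 (λ P B B⁻¹ y₀ y₁ y₂ → con′ 0ℤ :*′ y₁ :+′ con′ 0ℤ :*′ y₀ :+′ P :*′ (con′ 0ℤ :*′ y₁) :+′ B
            :*′ (B⁻¹ :*′ y₂) :=′ B :*′ (B⁻¹ :*′ y₂)) F.refl P S.B B⁻¹ (S.α ⟨$⟩ y) (S.β ⟨$⟩ y) (S.γ ⟨$⟩ y))
            (B*B⁻¹*y≈y (S.γ ⟨$⟩ y))))

      multiplierRing≐O : multiplierRing I ≐ O
      multiplierRing≐O = (λ {y} → multiplierRing⊆O {y}) , λ y∈O z z∈I → O*I⊆I y∈O z∈I

      -- As 1 lies in `I`, an inverse J would lie in `O`. For q in J the e₂-coordinate of `v * q` is
      -- B⁻¹ (q₀ + P q₁ + A q₂), and its integrality forces π to divide q₀, because π divides `B`,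
      -- `P` and `A`. Then π divides the first coordinate of every element of I J, so 1 is missing.
      not-invertible : 1ℤ ≤ord P → 1ℤ ≤ord S.A → 1ℤ ≤ord S.B → ¬ Invertible O I
      not-invertible 1≤P 1≤A 1≤B (J , J-fractional , I·J⊆O , O⊆I·J) = go (O⊆I·J (S.basis∈O zero))
        where
        module J = IsSubmodule (IsFractionalIdeal.isSubmodule J-fractional)
        1≤fst : ∀ {q} → q ∈ J → 1ℤ ≤ord proj₁ q
        1≤fst {q} q∈J = ≤ord-resp (F-solve 3 (λ u v w → (u :+′ v :+′ w) :-′ (v :+′ w) :=′ u) F.refl q₀ (P F.* q₁)
          (S.A F.* q₂))
          (≤ord-- _ _ 1≤sum (≤ord-+ _ _ (≤ord-resp (F.*-comm q₁ P) (≤ord-*-integral q₁ P (proj₁ (proj₂ q-int)) 1≤P))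
                                        (≤ord-resp (F.*-comm q₂ S.A) (≤ord-*-integral q₂ S.A (proj₂ (proj₂ q-int))
                                          1≤A))))
          where
          q₀ q₁ q₂ : F.Carrier
          q₀ = S.α ⟨$⟩ q
          q₁ = S.β ⟨$⟩ q
          q₂ = S.γ ⟨$⟩ q
          q-int : 0ℤ ≤ord q₀ × 0ℤ ≤ord q₁ × 0ℤ ≤ord q₂
          q-int = S.∈O⇒integral (IsSubmodule.resp S.O-isSubmodule (*-identityˡ q) (I·J⊆O (*∈· I J 1∈I q∈J)))
          γ≈ : S.γ ⟨$⟩ (v * q) F.≈ B⁻¹ F.* (q₀ F.+ P F.* q₁ F.+ S.A F.* q₂)
          γ≈ = F.trans (⟨$⟩-cong S.γ (*-congʳ {q} v≈)) (F.trans (proj₂ (proj₂ (elt-*ʳ a b c F.0# F.0# B⁻¹ q)))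
            (F-solve 6 (λ P A B⁻¹ q₀ q₁ q₂ → con′ 0ℤ :*′ q₂ :+′ B⁻¹ :*′ q₀ :+′ P :*′ (con′ 0ℤ :*′ q₂ :+′ B⁻¹ :*′ q₁)
              :+′ A :*′ (B⁻¹ :*′ q₂) :=′ B⁻¹ :*′ (q₀ :+′ P :*′ q₁ :+′ A :*′ q₂)) F.refl P S.A B⁻¹ q₀ q₁ q₂))
          1≤sum : 1ℤ ≤ord (q₀ F.+ P F.* q₁ F.+ S.A F.* q₂)
          1≤sum = ≤ord-resp (B*B⁻¹*y≈y (q₀ F.+ P F.* q₁ F.+ S.A F.* q₂))
            (≤ord-* S.B (B⁻¹ F.* (q₀ F.+ P F.* q₁ F.+ S.A F.* q₂)) 1≤B
            (≤ord-resp γ≈ (proj₂ (proj₂ (S.∈O⇒integral (I·J⊆O (*∈· I J v∈I q∈J)))))))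
        go : ¬ (1# ∈ I · J)
        go (n , p , q , p∈I , q∈J , 1≈) = 1≰0 (≤ord⇒≤ ord-1 (≤ord-resp (F.sym (proj₁ 1≈))
          (Functional.≤ord-sum fst-functional (λ i → p i * q i)
            (λ i → ≤ord-*-integral _ _ (proj₁ (∈I⇒ (p∈I i))) (1≤fst (q∈J i))))))
          where
          1≰0 : ¬ (1ℤ ℤ.≤ 0ℤ)
          1≰0 (ℤ.+≤+ ())

  -- The Gorenstein criterion in terms of a, b and ord(c)

  Criterion : ℕ → ℕ → F.Carrier → Set
  Criterion a b c = a ≡ 0 ⊎ F.ord (Std.N (+ a) (+ b) c) ≡ [ + a ]

  criterion⇒Gorenstein : ∀ a b c → IsOrder 𝒪[ a , b , c ] → Criterion a b c → Gorenstein 𝒪[ a , b , c ]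
  criterion⇒Gorenstein .0 b c isOrd (inj₁ ≡.refl) = dualizing⇒Gorenstein isOrd (dualizing-α+γ b c isOrd)
  criterion⇒Gorenstein a b c isOrd (inj₂ ord-N) = dualizing⇒Gorenstein isOrd
    (dualizing-β a b c (proj₁ inv) (proj₁ (proj₂ inv))
      (≤⇒≤ord (proj₂ (proj₂ inv)) (ℤ.≤-reflexive (≡.sym (≡.cong ℤ.-_ (ℤ.+-inverseʳ (+ a)))))))
    where
    inv = invert (Std.ord-B (+ a) (+ b) c ord-N)

  -- For positive exponent, 2 ord(c) ≥ 1 makes π divide `c`, hence the trace `A` as well. If
  -- moreover ord(N) exceeds the exponent, then `B` is not a unit and the ideal above contradicts
  -- the Gorenstein property.
  Gorenstein⇒criterion : ∀ a b c → IsOrder 𝒪[ a , b , c ] → Gorenstein 𝒪[ a , b , c ] → Criterion a b c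
  Gorenstein⇒criterion zero    b c isOrd gor = inj₁ ≡.refl
  Gorenstein⇒criterion (suc a) b c isOrd gor = go (Std.N-finite (+ suc a) (+ b) c)
    where
    1≤a : 1ℤ ℤ.≤ + suc a
    1≤a = ℤ.+≤+ (ℕ.s≤s ℕ.z≤n)
    a≤N : + suc a ≤ord Std.N (+ suc a) (+ b) c
    a≤N = isOrder⇒≤ord-N (suc a) b c isOrd
    1≤c : 1ℤ ≤ord c
    1≤c = ≤ord-∀ λ v eq → halve-< {0ℤ} {v} (ℤ.≤-trans 1≤a (proj₂ (order-bounds (+ suc a) (+ b) c a≤N) v eq))
    1≤A : 1ℤ ≤ord Std.A (+ suc a) (+ b) c
    1≤A = ≤ord-+ _ _ (≤ord-*-integral (π F.^ (+ b)) q (≤⇒≤ord (ord-^ π (+ b)) (ℤ.+≤+ ℕ.z≤n)) 1≤ord-q)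
      (≤ord-+ c c 1≤c 1≤c)
    go : (∃ λ k → F.ord (Std.N (+ suc a) (+ b) c) ≡ [ k ]) → Criterion (suc a) b c
    go (k , ord-N) = cases (≤-or-> k (+ suc a))
      where
      ord-B : F.ord (Std.B (+ suc a) (+ b) c) ≡ [ k ℤ.- + suc a ]
      ord-B = Std.ord-B (+ suc a) (+ b) c ord-N
      cases : k ℤ.≤ + suc a ⊎ + suc a ℤ.+ 1ℤ ℤ.≤ k → Criterion (suc a) b c
      cases (inj₁ k≤a) = inj₂ (≡.trans ord-N (≡.cong [_] (ℤ.≤-antisym k≤a (≤ord⇒≤ ord-N a≤N))))
      cases (inj₂ a<k) = contradiction (gor NI.I NI.I-fractional NI.multiplierRing≐O)
        (NI.not-invertible (≤⇒≤ord (ord-^ π (+ suc a)) 1≤a) 1≤A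
          (≤⇒≤ord ord-B (lin₁ 0 a<k (ℤ-solve 2 (λ a k → k ⊖ a ⊖ κ 1ℤ ⊜ k ⊖ (a ⊕ κ 1ℤ) ⊕ κ 0ℤ) ≡.refl (+ suc a) k))))
        where
        inv = invert ord-B
        module NI = NotInvertible (suc a) b c isOrd (proj₁ inv) (proj₁ (proj₂ inv))

  module _ (a b : ℕ) (c : F.Carrier) (c∈𝒪 : c ∈ F.𝒪) (isOrd : IsOrder 𝒪[ a , b , c ]) where

    GorensteinCondition : Set
    GorensteinCondition = ([ + a ] ≤⁺ F.ord c → (a ≡ 2 ℕ.* b ℕ.+ 1 ⊎ a ≡ 0)) ×
      (F.ord c <⁺ [ + a ] → [ + a ] ≡ orderBound b (F.ord c))

    private
      a≤N : + a ≤ord Std.N (+ a) (+ b) c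
      a≤N = isOrder⇒≤ord-N a b c isOrd

      N≡ : F.ord (Std.N (+ a) (+ b) c) ≡ orderBound b (F.ord c)
      N≡ = ord-N≡orderBound (+ a) b c

    criterion⇒condition : Criterion a b c → GorensteinCondition
    criterion⇒condition (inj₁ a≡0) = (λ _ → inj₂ a≡0) , λ c<a → contradiction (<⁺⇒ord {c} c<a) λ (v , eq , v<a) →
      i+1≰i (ℤ.≤-trans v<a (ℤ.≤-trans (ℤ.≤-reflexive (≡.cong +_ a≡0)) (≤ord⇒≤ eq c∈𝒪)))
    criterion⇒condition (inj₂ N≡a) = large (Std.ord-N (+ a) (+ b) c) , λ _ → ≡.trans (≡.sym N≡a) N≡
      where
      large : ((+ b ℤ.+ 1ℤ) ≤ord c × F.ord (Std.N (+ a) (+ b) c) ≡ [ + b ℤ.+ + b ℤ.+ 1ℤ ]) ⊎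
              (∃ λ v → F.ord c ≡ [ v ] × v ℤ.≤ + b × F.ord (Std.N (+ a) (+ b) c) ≡ [ v ℤ.+ v ]) →
              [ + a ] ≤⁺ F.ord c → (a ≡ 2 ℕ.* b ℕ.+ 1 ⊎ a ≡ 0)
      large (inj₁ (_ , eq)) _ = inj₁ (ℤ.+-injective (≡.trans ([]-injective (≡.trans (≡.sym N≡a) eq)) (2b+1≡ b)))
      -- Here a = 2v and a ≤ v leave only v ≤ 0, so this case falls under a = 0.
      large (inj₂ (v , ord≡v , _ , eq)) a≤c = inj₂ (ℤ.+-injective (ℤ.≤-antisym a≤0 (ℤ.+≤+ ℕ.z≤n)))
        where
        a≡2v : + a ≡ v ℤ.+ v
        a≡2v = []-injective (≡.trans (≡.sym N≡a) eq)
        v≤0 : v ℤ.≤ 0ℤ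
        v≤0 = lin₁ 0 (≡.subst (ℤ._≤ v) a≡2v (≤ord⇒≤ ord≡v a≤c))
          (ℤ-solve 1 (λ v → κ 0ℤ ⊖ v ⊜ v ⊖ (v ⊕ v) ⊕ κ 0ℤ) ≡.refl v)
        a≤0 : + a ℤ.≤ 0ℤ
        a≤0 = ≡.subst (ℤ._≤ 0ℤ) (≡.sym a≡2v) (double-≤ v≤0)

    condition⇒criterion : GorensteinCondition → Criterion a b c
    condition⇒criterion (large , small) = go (≤ord-or-ord< (+ a) c)
      where
      a≡2b+1⇒ : a ≡ 2 ℕ.* b ℕ.+ 1 → F.ord (Std.N (+ a) (+ b) c) ≡ [ + a ]
      a≡2b+1⇒ a≡ = cases (Std.ord-N (+ a) (+ b) c)
        where
        a≡′ : + a ≡ + b ℤ.+ + b ℤ.+ 1ℤ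
        a≡′ = ≡.trans (≡.cong +_ a≡) (≡.sym (2b+1≡ b))
        cases : ((+ b ℤ.+ 1ℤ) ≤ord c × F.ord (Std.N (+ a) (+ b) c) ≡ [ + b ℤ.+ + b ℤ.+ 1ℤ ]) ⊎
                (∃ λ v → F.ord c ≡ [ v ] × v ℤ.≤ + b × F.ord (Std.N (+ a) (+ b) c) ≡ [ v ℤ.+ v ]) →
                F.ord (Std.N (+ a) (+ b) c) ≡ [ + a ]
        cases (inj₁ (_ , eq)) = ≡.trans eq (≡.cong [_] (≡.sym a≡′))
        -- The order inequality excludes this case: it would give 2b + 1 = a ≤ 2v ≤ 2b.
        cases (inj₂ (v , _ , v≤b , eq)) = contradiction
          (ℤ.≤-trans (≡.subst (ℤ._≤ v ℤ.+ v) a≡′ (≤ord⇒≤ eq a≤N)) (double-≤ v≤b)) i+1≰i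
      go : + a ≤ord c ⊎ (∃ λ v → v ℤ.+ 1ℤ ℤ.≤ + a × F.ord c ≡ [ v ]) → Criterion a b c
      go (inj₁ a≤c) = cases (large a≤c)
        where
        cases : a ≡ 2 ℕ.* b ℕ.+ 1 ⊎ a ≡ 0 → Criterion a b c
        cases (inj₁ a≡2b+1) = inj₂ (a≡2b+1⇒ a≡2b+1)
        cases (inj₂ a≡0)    = inj₁ a≡0
      go (inj₂ (v , v<a , eq)) = inj₂ (≡.trans N≡ (≡.sym (small (ord⇒<⁺ {c} eq v<a))))

    Gorenstein⇔ : Gorenstein 𝒪[ a , b , c ] ⇔ GorensteinCondition
    Gorenstein⇔ = mk⇔ (λ gor → criterion⇒condition (Gorenstein⇒criterion a b c isOrd gor))
                      (λ cond → criterion⇒Gorenstein a b c isOrd (condition⇒criterion cond))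

proposition5p4 : ∀ {ℓ₁ ℓ₂ : Level} (F : LocalField ℓ₁ ℓ₂) (E′ : RamifiedQuadraticExtension F) →
    let open Orders F E′ in
    (π : F.Uniformizer) (x : E′.Uniformizer) →
    let open Family π x in
    ( (∀ O → IsOrder O →
    ∃ λ a → ∃ λ b → ∃ λ c →
    c ∈ F.𝒪 × [ + a ] ≤⁺ orderBound b (F.ord c) × O ≐ 𝒪[ a , b , c ])
    × (∀ a b c → c ∈ F.𝒪 → [ + a ] ≤⁺ orderBound b (F.ord c) → IsOrder 𝒪[ a , b , c ]) )
    ×
    (∀ a b c a′ b′ c′ → c ∈ F.𝒪 → c′ ∈ F.𝒪 →
    IsOrder 𝒪[ a , b , c ] → IsOrder 𝒪[ a′ , b′ , c′ ] →
    let d = + b ℤ.- + b′ in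
    ( 𝒪[ a , b , c ] ⊆ 𝒪[ a′ , b′ , c′ ]
    ⇔
    ( a′ ℕ.≤ a × b′ ℕ.≤ b
    × ([ + a′ ] ≤⁺ F.ord c → c′ ∈ F.⟨ π ^ + ⌈ a′ /2⌉ ℤ.⊔ (+ a′ ℤ.- d) ⟩)
    × (F.ord c <⁺ [ + a′ ] → (c′ F.- π F.^ (ℤ.- d) F.* c) ∈ F.⟨ π ^ + a′ ℤ.- d ⟩) ) )
    ×
    ( 𝒪[ a , b , c ] ⊆ 𝒪[ a′ , b′ , c′ ] → F.ord c <⁺ [ + a′ ] →
    [ + ⌈ a′ /2⌉ ] ≤⁺ (F.ord c +∞ [ ℤ.- d ])
    × F.ord c +∞ [ ℤ.- d ] ≡ F.ord c′
    × 0ℤ ℤ.< + a′ ℤ.- d ))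
    ×
    (∀ a b c a′ b′ c′ → c ∈ F.𝒪 → c′ ∈ F.𝒪 →
    IsOrder 𝒪[ a , b , c ] → IsOrder 𝒪[ a′ , b′ , c′ ] →
    𝒪[ a′ , b′ , c′ ] ≐ 𝒪[ a , b , c ]
    ⇔
    (a ≡ a′ × b ≡ b′ × (c F.- c′) ∈ F.⟨ π ^ + a ⟩))
    ×
    (∀ a b c → c ∈ F.𝒪 → IsOrder 𝒪[ a , b , c ] →
    (S[ 𝒪[ a , b , c ] ]≡ (a ℕ.+ b))
    × conductor 𝒪[ a , b , c ]
    ≐ (F.⟨ π ^ + a ⟩ ⟨×⟩ E′.⟨ x ^ conductorExponent a b (F.ord c) ⟩))
    ×
    (∀ a b c → c ∈ F.𝒪 → IsOrder 𝒪[ a , b , c ] →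
    Gorenstein 𝒪[ a , b , c ]
    ⇔
    ( ([ + a ] ≤⁺ F.ord c → (a ≡ 2 ℕ.* b ℕ.+ 1 ⊎ a ≡ 0))
    × (F.ord c <⁺ [ + a ] → [ + a ] ≡ orderBound b (F.ord c)) ))
proposition5p4 F E′ π x =
  ((λ O → order-is-standard O) , ≤orderBound⇒isOrder) ,
  (λ a b c a′ b′ c′ c∈𝒪 c′∈𝒪 isOrd isOrd′ →
    InclusionCriterion.inclusion⇔ a b c a′ b′ c′ isOrd′ ,
    λ O⊆O′ → InclusionCriterion.inclusion-ord a b c a′ b′ c′ c′∈𝒪 isOrd′ (λ {y} → O⊆O′ {y})) ,
  (λ a b c a′ b′ c′ _ _ _ _ → equality⇔ a b c a′ b′ c′) ,
  (λ a b c c∈𝒪 _ → quotientLength a b c c∈𝒪 , conductor≐ a b c) ,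
  (λ a b c c∈𝒪 isOrd → Gorenstein⇔ a b c c∈𝒪 isOrd)
  where
  open OrderFamily F E′ π x
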